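{- Let $\mathbb{F}$ be a field and $n\in\mathbb{N}$ such that $\operatorname{char}(\mathbb{F})\nmid n$. Then any unlayered algebraic branching program over $\mathbb{F}$ with edge labels of degree at most $\Delta$ computing the polynomial $\sum_{i=1}^n x_i^n$ is of size at least $\Omega\left(n\log n/(\log\log n+\log\Delta)\right)$.
   Context: All logarithms are base 2. An unlayered algebraic branching program over $\mathbb{F}$ with edge labels of degree at most $\Delta$ is a directed acyclic graph (not required to be layered) with a designated start (source) vertex and a designated end (sink) vertex, in which each edge is labeled by an arbitrary polynomial in $\mathbb{F}[x_1,\dots,x_n]$ of degree at most $\Delta$. The polynomial it computes is the sum of the weights of all paths from the start vertex to the end vertex, where the weight of a path is the product of the labels of all the edges on it. The size of an algebraic branching program is the number of vertices in it. The $\Omega(\cdot)$ notation hides an absolute positive constant.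
   Formalization: The formal theorem assumes 1 ≤ Δ < n and n ≥ 3: for Δ = n one edge labelled by the whole sum gives size 2, contradicting the bound with an absolute constant, and for smaller n or Δ = 0 the expression is undefined or the bound trivial. -}

module Defs where

open import Algebra.Apartness.Bundles using (HeytingField)
open import Algebra.Bundles using (RawMonoid; RawSemiring)
import Algebra.Definitions.RawMonoid as RawMonoidDefs
import Algebra.Definitions.RawSemiring as RawSemiringDefs
open import Data.Bool.Base using (Bool; T; if_then_else_)
open import Data.Bool.Properties using (T?)
open import Data.Fin.Base using (Fin)
import Data.Fin.Properties as Fin
open import Data.Integer.Base using (+_; ∣_∣)
open import Data.List.Base
  using (List; []; _∷_; [_]; _++_; map; foldr; concatMap; cartesianProductWith; allFin; upTo)
open import Data.Nat.Base as ℕ using (ℕ; zero; suc)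
open import Data.Nat.Divisibility using (_∣_)
import Data.Nat.Properties as ℕ
open import Data.Product.Base using (_×_; _,_; ∃-syntax)
open import Data.Rational.Unnormalised.Base as ℚ using (ℚᵘ; 0ℚᵘ; ↥_; ↧ₙ_)
open import Data.Vec.Base as Vec using (Vec; replicate; zipWith; _[_]≔_)
open import Data.Vec.Properties using (≡-dec)
open import Function.Bundles using (_⇔_)
open import Level using (Level; 0ℓ; _⊔_)
open import Relation.Binary.Construct.Closure.ReflexiveTransitive using (Star; ε; _◅_; fold)
open import Relation.Binary.Construct.Closure.Transitive using (TransClosure)
open import Relation.Binary.Core using (Rel)
open import Relation.Binary.PropositionalEquality.Core using (refl)
open import Relation.Nullary.Decidable.Core using (does; yes; no)
open import Relation.Nullary.Negation.Core using (¬_)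

-- A non-negative real x, given by its open upper cut: `x q` means x < q.
UpperReal : Set₁
UpperReal = ℚᵘ → Set

module _ where
  open ℚ using (_+_; _*_; _<_; _≤_; _/_)
  open RawSemiringDefs ℚ.+-*-rawSemiring using (_^_)

  infix  4 _≤ᵣ_
  infixl 6 _+ᵣ_
  infixl 7 _*ᵣ_

  -- Only for non-negative rationals.
  fromℚ : ℚᵘ → UpperReal
  fromℚ c q = c < q

  fromℕ : ℕ → UpperReal
  fromℕ m = fromℚ (+ m / 1)

  _≤ᵣ_ : UpperReal → UpperReal → Set
  x ≤ᵣ y = ∀ q → y q → x q

  _+ᵣ_ : UpperReal → UpperReal → UpperReal
  (x +ᵣ y) q = ∃[ r ] ∃[ s ] x r × y s × r + s ≤ q

  -- This is the product because x and y are non-negative, so that r and s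
  -- are positive.
  _*ᵣ_ : UpperReal → UpperReal → UpperReal
  (x *ᵣ y) q = ∃[ r ] ∃[ s ] x r × y s × r * s ≤ q

  -- The binary logarithm of a real x ≥ 1.  For q = k / d > 0,
  -- log x < q iff x < r ≤ 2^q for some rational r, and r ≤ 2^q is
  -- r^d ≤ 2^k.
  log₂ : UpperReal → UpperReal
  log₂ x q = 0ℚᵘ < q × (∃[ r ] x r × r ^ (↧ₙ q) ≤ (+ 2 / 1) ^ ∣ ↥ q ∣)

module OverField {a ℓ₁ ℓ₂ : Level} (F : HeytingField a ℓ₁ ℓ₂) where
  open HeytingField F

  private
    +-rawMonoid : RawMonoid a ℓ₁
    +-rawMonoid = record { Carrier = Carrier ; _≈_ = _≈_ ; _∙_ = _+_ ; ε = 0# }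

  open RawMonoidDefs +-rawMonoid using () renaming (_×_ to _·_)

  -- p generates the kernel of ℤ → F.
  HasCharacteristic : ℕ → Set ℓ₁
  HasCharacteristic p = ∀ m → (m · 1#) ≈ 0# ⇔ p ∣ m

  -- x₁^m₁ ⋯ xₙ^mₙ is represented by its exponent vector.
  Monomial : ℕ → Set
  Monomial n = Vec ℕ n

  -- A formal sum of terms; monomials may repeat, so a polynomial is
  -- determined only by its coefficients (see _≈ₚ_).
  Poly : ℕ → Set a
  Poly n = List (Carrier × Monomial n)

  coeff : ∀ {n} → Poly n → Monomial n → Carrier
  coeff []            m = 0#
  coeff ((c , m′) ∷ p) m = (if does (≡-dec ℕ._≟_ m′ m) then c else 0#) + coeff p m

  infix 4 _≈ₚ_

  _≈ₚ_ : ∀ {n} → Rel (Poly n) ℓ₁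
  p ≈ₚ q = ∀ m → coeff p m ≈ coeff q m

  Degree≤ : ∀ {n} → ℕ → Poly n → Set ℓ₁
  Degree≤ Δ p = ∀ m → Δ ℕ.< Vec.sum m → coeff p m ≈ 0#

  polyRawSemiring : ℕ → RawSemiring a ℓ₁
  polyRawSemiring n = record
    { Carrier = Poly n
    ; _≈_     = _≈ₚ_
    ; _+_     = _++_
    ; _*_     = cartesianProductWith λ (c , m) (c′ , m′) → c * c′ , zipWith ℕ._+_ m m′
    ; 0#      = []
    ; 1#      = [ 1# , replicate n 0 ]
    }

  var : ∀ {n} → Fin n → Poly n
  var {n} i = [ 1# , replicate n 0 [ i ]≔ 1 ]

  powerSum : (n d : ℕ) → Poly n
  powerSum n d = sum λ (i : Fin n) → var i ^ d
    where open RawSemiringDefs (polyRawSemiring n) using (sum; _^_)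

  record ABP (n : ℕ) : Set a where
    open RawSemiring (polyRawSemiring n)
      using () renaming (_+_ to _+ₚ_; _*_ to _*ₚ_; 0# to 0ₚ; 1# to 1ₚ)

    field
      size  : ℕ
      edge  : Fin size → Fin size → Bool
      label : ∀ {u v} → T (edge u v) → Poly n
      start : Fin size
      end   : Fin size

    _⟶_ : Rel (Fin size) 0ℓ
    u ⟶ v = T (edge u v)

    field
      acyclic : ∀ v → ¬ TransClosure _⟶_ v v

    Path : Rel (Fin size) 0ℓ
    Path = Star _⟶_

    weight : ∀ {u v} → Path u v → Poly n
    weight = fold (λ _ _ → Poly n) (λ e p → label e *ₚ p) 1ₚ

    pathsOfLength : ℕ → ∀ u v → List (Path u v)
    pathsOfLength zero u v with u Fin.≟ v
    ... | yes refl = [ ε ]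
    ... | no  _    = []
    pathsOfLength (suc k) u v = concatMap via (allFin size)
      where
      via : Fin size → List (Path u v)
      via w with T? (edge u w)
      ... | yes e = map (e ◅_) (pathsOfLength k w v)
      ... | no  _ = []

    -- By acyclicity no path repeats a vertex, so every path has fewer than
    -- `size` edges and is listed exactly once.
    paths : ∀ u v → List (Path u v)
    paths u v = concatMap (λ k → pathsOfLength k u v) (upTo size)

    output : Poly n
    output = foldr _+ₚ_ 0ₚ (map weight (paths start end))

  open ABP public using (size; output)

  LabelDegrees≤ : ∀ {n} → ℕ → ABP n → Set ℓ₁
  LabelDegrees≤ Δ A = ∀ {u v} (e : u ⟶ v) → Degree≤ Δ (label e)
    where open ABP A

  Computes : ∀ {n} → ABP n → Poly n → Set ℓ₁
  Computes A f = output A ≈ₚ f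

module Submission where

-- Write P_u for the sum of the path weights from the start to u, Q_v for the sum
-- from v to the end, and M_uv for the edge labels.  Differentiating the output
-- gives n x_i^(n-1) = Σ_uv P_u (∂_i M_uv) Q_v, and two dimension counts on this
-- identity bound the number s of vertices.
--
-- Let the P_u and Q_v, less their constant terms, generate the ideal J.  Modulo J
-- each x_i^(n-1) equals a polynomial of degree < n - 1, so modulo all monomials
-- of degree ≥ k the polynomials are spanned by the products of the small
-- monomials with the monomials of degree < k in each of the 2s generators.
-- Comparing the growth in k of both sides gives n ≤ 2s.
--
-- For the second bound, filter the polynomials by degree / Δ and adjoin the P_u
-- and Q_v one by one, each in level 1, along a topological order.  Each lies in
-- level 2 beforehand, so each at most doubles the dimension of level T, while in
-- the end every x_i^(n-1) is in level 3.  Counting the monomials this puts in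
-- level 4n² gives (n-1)^n ≤ 4^s (4Δ)^n.  This is a Bézout inequality, as in
-- Strassen's degree bound, but it counts vertices and not edges because each
-- P_u is given by a single equation of degree Δ + 1.
--
-- The logarithm of the second inequality together with the first one gives
-- s (1/2 + log Δ) ≥ n log n / 48 up to rounding.

open import Defs
open import Algebra.Apartness.Bundles using (HeytingField)
open import Algebra.Bundles using (CommutativeMonoid; CommutativeRing; RawSemiring; Semiring)
import Algebra.Definitions.RawSemiring as RawSemiringDefs
open import Algebra.Module.Bundles using (LeftSemimodule)
import Algebra.Properties.CommutativeSemigroup as CommutativeSemigroupProperties
import Algebra.Properties.CommutativeSemiring.Exp as CommutativeSemiringExp
import Algebra.Properties.Group as GroupProperties
import Algebra.Properties.Ring as RingProperties
import Algebra.Properties.Semiring.Mult as SemiringMult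
import Algebra.Properties.Semiring.Sum as SemiringSum
import Algebra.Solver.Ring.NaturalCoefficients.Default as RingSolver
open import Data.Bool.Base using (true; false; if_then_else_)
open import Data.Bool.Properties using (T?)
open import Data.Fin.Base as Fin using (Fin; zero; suc; toℕ; fromℕ<; inject₁)
import Data.Fin.Induction as Fin
import Data.Fin.Properties as Fin
open import Data.Integer.Base as ℤ using (+_; -[1+_]; ℤ; ∣_∣)
import Data.Integer.Properties as ℤ
open import Data.List.Base
  using (List; []; [_]; _++_; _∷_; allFin; applyUpTo; cartesianProductWith; concatMap; filter
        ; foldr; length; lookup; map; tabulate; upTo)
open import Data.List.Membership.Propositional using (_∈_)
open import Data.List.Membership.Propositional.Properties
  using (∈-++⁺ʳ; ∈-++⁺ˡ; ∈-++⁻; ∈-allFin; ∈-cartesianProductWith⁺; ∈-cartesianProductWith⁻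
        ; ∈-filter⁺; ∈-filter⁻; ∈-length; ∈-lookup; ∈-map⁺; ∈-map⁻)
import Data.List.Properties as List
open import Data.List.Relation.Binary.Permutation.Propositional using (_↭_; ↭-sym)
open import Data.List.Relation.Binary.Permutation.Propositional.Properties
  using (↭-length; ∈-resp-↭)
open import Data.List.Relation.Unary.All as All using (All; []; _∷_)
import Data.List.Relation.Unary.All.Properties as All
open import Data.List.Relation.Unary.AllPairs using ([]; _∷_)
open import Data.List.Relation.Unary.Any as Any using (here; there)
open import Data.List.Relation.Unary.Any.Properties using (lookup-index)
import Data.List.Relation.Unary.Sorted.TotalOrder.Properties as Sorted
open import Data.List.Relation.Unary.Unique.Propositional using (Unique)
import Data.List.Relation.Unary.Unique.Propositional.Properties as Unique
import Data.List.Sort as Sort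
open import Data.Nat.Base as ℕ using (ℕ; zero; suc; _≤_; _<_; z≤n; s≤s; NonZero; _/_; _%_)
import Data.Nat.DivMod as ℕ
open import Data.Nat.Divisibility using (_∣_)
import Data.Nat.Properties as ℕ
open import Data.Nat.Tactic.RingSolver using (solve-∀)
open import Data.Product.Base using (_×_; _,_; ∃-syntax; proj₁; proj₂)
open import Data.Rational.Unnormalised.Base as ℚ
  using (*<*; *≡*; *≤*; NonNegative; Positive; _≃_; mkℚᵘ; ℚᵘ)
import Data.Rational.Unnormalised.Properties as ℚ
open import Data.Sum.Base using ([_,_]′; _⊎_; inj₁; inj₂)
open import Data.Unit.Base using (tt; ⊤)
open import Data.Vec.Base as Vec using (Vec; []; _[_]%=_; _[_]≔_; _∷_; replicate; zipWith)
import Data.Vec.Properties as Vec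
open import Function.Base using (_$_; _∘_; id)
open import Function.Bundles using (Equivalence)
open import Induction.WellFounded using (Acc; WellFounded; acc)
open import Level using (_⊔_)
import Level
open import Relation.Binary.Bundles using (DecTotalOrder)
open import Relation.Binary.Construct.Closure.ReflexiveTransitive using (_◅_)
open import Relation.Binary.Construct.Closure.Transitive as Plus using (TransClosure)
import Relation.Binary.Construct.On as On
open import Relation.Binary.PropositionalEquality.Core as ≡ using (_≡_; _≢_; subst; subst₂)
open import Relation.Binary.PropositionalEquality.Properties
  using (isEquivalence; module ≡-Reasoning)
import Relation.Binary.Reasoning.Setoid as SetoidReasoning
open import Relation.Nullary.Decidable.Core
  using (Dec; decidable-stable; does; no; yes; ¬?; ¬¬-excluded-middle)
open import Relation.Nullary.Negation.Core using (contradiction; ¬_)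
open import Relation.Unary using (Decidable)

-- The second bound alone gives 2s ≥ n (log n - log Δ - O(1)), which says nothing once Δ is
-- comparable to n; there `n ≤ 2 s` takes over, because s log Δ is then already of order n log n.
-- The hypothesis `Δ < n` is indispensable: for Δ = n a single edge labelled with the power sum
-- needs two vertices only. It enters through the degree Δ - 1 < n - 1 of the derivatives of the
-- labels. The obstacle is that equality in a Heyting field is not decidable, so pivots cannot be
-- chosen and no basis can be extracted from a spanning list. Elimination is therefore carried out
-- under a double negation. This is harmless, because the claims it serves are inequalities between
-- natural numbers, which are stable. For the same reason a dimension appears only as the length of
-- a spanning list, and lower bounds for such a length come from strict flags inside the span. The
-- 1/2 in the last inequality is a lower bound for log log n when n ≥ 3.

none-below-suc : ∀ {p} {P : ℕ → Set p} {T} →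
  (∀ {t} → t ℕ.≤ T → ¬ P t) → ¬ P (suc T) → ∀ {t} → t ℕ.≤ suc T → ¬ P t
none-below-suc none ¬p t≤1+T Pt with ℕ.m≤n⇒m<n∨m≡n t≤1+T
... | inj₁ (s≤s t≤T) = none t≤T Pt
... | inj₂ ≡.refl    = ¬p Pt

-- The search has to decide `P` at each step, and excluded middle is available under a double
-- negation. This selects the level of the pivot in `adapted-family`.
¬¬-least : ∀ {p} (P : ℕ → Set p) T →
  ¬ ¬ ((∃[ t ] t ℕ.≤ T × P t × (∀ {s} → s ℕ.< t → ¬ P s)) ⊎ (∀ {t} → t ℕ.≤ T → ¬ P t))
¬¬-least P zero k = ¬¬-excluded-middle λ where
  (yes p) → k (inj₁ (0 , z≤n , p , λ ()))
  (no ¬p) → k (inj₂ λ { z≤n → ¬p })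
¬¬-least P (suc T) k = ¬¬-least P T λ where
  (inj₁ (t , t≤T , p , least)) → k (inj₁ (t , ℕ.m≤n⇒m≤1+n t≤T , p , least))
  (inj₂ none) → ¬¬-excluded-middle λ where
    (yes p) → k (inj₁ (suc T , ℕ.≤-refl , p , λ { (s≤s s≤T) → none s≤T }))
    (no ¬p) → k (inj₂ (none-below-suc none ¬p))

-- Linear algebra over a Heyting field: spans and flags.

heytingRing : ∀ {a ℓ₁ ℓ₂} → HeytingField a ℓ₁ ℓ₂ → CommutativeRing a ℓ₁
heytingRing F = record { isCommutativeRing = HeytingField.isCommutativeRing F }

heytingSemiring : ∀ {a ℓ₁ ℓ₂} → HeytingField a ℓ₁ ℓ₂ → Semiring a ℓ₁
heytingSemiring F = CommutativeRing.semiring (heytingRing F)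

module LinearAlgebra {a ℓ₁ ℓ₂ m ℓm} (F : HeytingField a ℓ₁ ℓ₂)
  (V : LeftSemimodule (heytingSemiring F) m ℓm) where

  open HeytingField F
  open LeftSemimodule V
  open SetoidReasoning ≈ᴹ-setoid
  private
    module S = SetoidReasoning setoid
  open RingProperties (CommutativeRing.ring (heytingRing F)) using (-0#≈0#; -‿distribˡ-*)

  record Subspace {p} (P : Carrierᴹ → Set p) : Set (a ⊔ m ⊔ ℓm ⊔ p) where
    field
      resp   : ∀ {u v} → u ≈ᴹ v → P u → P v
      zero∈  : P 0ᴹ
      plus∈  : ∀ {u v} → P u → P v → P (u +ᴹ v)
      scale∈ : ∀ c {v} → P v → P (c *ₗ v)
  open Subspace

  -- Coefficients are peeled off one generator at a time, so that elimination can inspect the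
  -- coefficient of the head.
  data Span : List Carrierᴹ → Carrierᴹ → Set (a ⊔ m ⊔ ℓm) where
    []  : ∀ {v} → v ≈ᴹ 0ᴹ → Span [] v
    _∷_ : ∀ {v w ws} → (∃[ c ] ∃[ u ] v ≈ᴹ c *ₗ w +ᴹ u × Span ws u) → Span (w ∷ ws) v

  open CommutativeSemigroupProperties (CommutativeMonoid.commutativeSemigroup +ᴹ-commutativeMonoid)
    using (interchange)

  span-subspace : ∀ ws → Subspace (Span ws)
  span-subspace [] .resp eq ([] v≈0) = [] (≈ᴹ-trans (≈ᴹ-sym eq) v≈0)
  span-subspace [] .zero∈ = [] ≈ᴹ-refl
  span-subspace [] .plus∈ ([] u≈0) ([] v≈0) = [] (≈ᴹ-trans (+ᴹ-cong u≈0 v≈0) (+ᴹ-identityˡ 0ᴹ))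
  span-subspace [] .scale∈ c ([] v≈0) = [] (≈ᴹ-trans (*ₗ-congˡ v≈0) (*ₗ-zeroʳ c))
  span-subspace (w ∷ ws) .resp eq (_∷_ (c , u , v≈ , s)) = _∷_ (c , u , ≈ᴹ-trans (≈ᴹ-sym eq) v≈ , s)
  span-subspace (w ∷ ws) .zero∈ = _∷_ (0# , 0ᴹ , ≈ᴹ-sym (≈ᴹ-trans (+ᴹ-identityʳ _) (*ₗ-zeroˡ w)) , span-subspace ws .zero∈)
  span-subspace (w ∷ ws) .plus∈ {u} {v} (_∷_ (c , u′ , u≈ , s)) (_∷_ (d , v′ , v≈ , s′)) =
    _∷_ (c + d , u′ +ᴹ v′ , eq , span-subspace ws .plus∈ s s′)
    where
    eq : u +ᴹ v ≈ᴹ (c + d) *ₗ w +ᴹ (u′ +ᴹ v′)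
    eq = begin
      u +ᴹ v                                ≈⟨ +ᴹ-cong u≈ v≈ ⟩
      (c *ₗ w +ᴹ u′) +ᴹ (d *ₗ w +ᴹ v′)       ≈⟨ interchange _ _ _ _ ⟩
      (c *ₗ w +ᴹ d *ₗ w) +ᴹ (u′ +ᴹ v′)       ≈⟨ +ᴹ-congʳ (≈ᴹ-sym (*ₗ-distribʳ w c d)) ⟩
      (c + d) *ₗ w +ᴹ (u′ +ᴹ v′)             ∎
  span-subspace (w ∷ ws) .scale∈ c {v} (_∷_ (d , u , v≈ , s)) =
    _∷_ (c * d , c *ₗ u , eq , span-subspace ws .scale∈ c s)
    where
    eq : c *ₗ v ≈ᴹ (c * d) *ₗ w +ᴹ c *ₗ u
    eq = begin
      c *ₗ v                   ≈⟨ *ₗ-congˡ v≈ ⟩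
      c *ₗ (d *ₗ w +ᴹ u)       ≈⟨ *ₗ-distribˡ c _ _ ⟩
      c *ₗ (d *ₗ w) +ᴹ c *ₗ u  ≈⟨ +ᴹ-congʳ (≈ᴹ-sym (*ₗ-assoc c d w)) ⟩
      (c * d) *ₗ w +ᴹ c *ₗ u   ∎

  span-weaken : ∀ {w ws v} → Span ws v → Span (w ∷ ws) v
  span-weaken {w} {v = v} s = _∷_ (0# , v , ≈ᴹ-sym (≈ᴹ-trans (+ᴹ-congʳ (*ₗ-zeroˡ w)) (+ᴹ-identityˡ v)) , s)

  span-∈ : ∀ {w ws} → w ∈ ws → Span ws w
  span-∈ {w} {ws = _ ∷ ws} (here ≡.refl) =
    _∷_ (1# , 0ᴹ , ≈ᴹ-sym (≈ᴹ-trans (+ᴹ-identityʳ _) (*ₗ-identityˡ w)) , span-subspace ws .zero∈)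
  span-∈ (there w∈ws) = span-weaken (span-∈ w∈ws)

  span-least : ∀ {p} {P : Carrierᴹ → Set p} → Subspace P →
    ∀ {ws v} → (∀ {w} → w ∈ ws → P w) → Span ws v → P v
  span-least sub ws⊆P ([] v≈0) = sub .resp (≈ᴹ-sym v≈0) (sub .zero∈)
  span-least sub ws⊆P (_∷_ (c , u , v≈ , s)) =
    sub .resp (≈ᴹ-sym v≈) (sub .plus∈ (sub .scale∈ c (ws⊆P (here ≡.refl))) (span-least sub (ws⊆P ∘ there) s))

  #0-inverse : ∀ {c} → c # 0# → ∃[ d ] d * c ≈ 1#
  #0-inverse {c} c#0 with #⇒invertible c#0
  ... | d , inv , _ = d , trans (*-congˡ (sym c-0)) inv
    where
    c-0 : c - 0# ≈ c
    c-0 = trans (+-congˡ -0#≈0#) (+-identityʳ c)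

  below : ℕ → List (Carrierᴹ × ℕ) → List Carrierᴹ
  below t bs = map proj₁ (filter ((ℕ._≤? t) ∘ proj₂) bs)

  below-accept : ∀ {t v l} bs → l ℕ.≤ t → below t ((v , l) ∷ bs) ≡ v ∷ below t bs
  below-accept {t} bs l≤t = ≡.cong (map proj₁) (List.filter-accept ((ℕ._≤? t) ∘ proj₂) {xs = bs} l≤t)

  below-reject : ∀ {t v l} bs → ¬ l ℕ.≤ t → below t ((v , l) ∷ bs) ≡ below t bs
  below-reject {t} bs l≰t = ≡.cong (map proj₁) (List.filter-reject ((ℕ._≤? t) ∘ proj₂) {xs = bs} l≰t)

  ∈-below⁻ : ∀ {t v} bs → v ∈ below t bs → ∃[ l ] (v , l) ∈ bs × l ℕ.≤ t
  ∈-below⁻ {t} bs v∈ with ∈-map⁻ proj₁ v∈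
  ... | (_ , l) , vl∈ , ≡.refl with ∈-filter⁻ ((ℕ._≤? t) ∘ proj₂) {xs = bs} vl∈
  ...   | vl∈bs , l≤t = l , vl∈bs , l≤t

  -- If some vector of the flag involves w, the first one that does can replace
  -- w in the spanning list; the others are then reduced modulo it.
  adapted-family : ∀ {p} (A : ℕ → Carrierᴹ → Set p) →
    (∀ t → Subspace (A t)) → (∀ {s t v} → s ℕ.≤ t → A s v → A t v) →
    ∀ T ws → (∀ {v} → A T v → Span ws v) →
    ¬ ¬ (∃[ bs ] length bs ℕ.≤ length ws × (∀ {b l} → (b , l) ∈ bs → A l b) ×
         (∀ {t v} → t ℕ.≤ T → A t v → Span (below t bs) v))
  adapted-family A sub mono T [] A⊆ k =
    k ([] , z≤n , (λ ()) , λ t≤T At → A⊆ (mono t≤T At))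
  adapted-family A sub mono T (w ∷ ws) A⊆ k = ¬¬-least Involved T λ where
      (inj₂ none) → adapted-family A sub mono T ws (λ At → uninvolved (none ℕ.≤-refl) At (A⊆ At))
        λ { (bs , len , lev , spans) → k (bs , ℕ.m≤n⇒m≤1+n len , lev , spans) }
      (inj₁ (t₀ , t₀≤T , (v₀ , Av₀ , c₀ , u₀ , c₀#0 , v₀≈ , s₀) , least)) →
        adapted-family (λ t v → A t v × Span ws v) sub′
          (λ { s≤t (Av , s) → mono s≤t Av , s }) T ws proj₂
          λ { (bs , len , lev , spans) → k ((v₀ , t₀) ∷ bs , s≤s len
            , (λ { (here ≡.refl) → Av₀ ; (there b∈) → proj₁ (lev b∈) })
            , λ {t} → extend t₀≤T Av₀ c₀#0 v₀≈ s₀ least bs spans {t}) }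
    where
    -- Apartness from zero is required, not mere inequality, since the coefficient will be inverted.
    Involved : ℕ → Set _
    Involved t = ∃[ v ] A t v × ∃[ c ] ∃[ u ] c # 0# × v ≈ᴹ c *ₗ w +ᴹ u × Span ws u

    -- By tightness a coefficient that is not apart from zero is zero, so `w` can be left out.
    uninvolved : ∀ {t v} → ¬ Involved t → A t v → Span (w ∷ ws) v → Span ws v
    uninvolved {v = v} ¬inv Av (_∷_ (c , u , v≈ , s)) = span-subspace ws .resp u≈v s
      where
      c≈0 : c ≈ 0#
      c≈0 = proj₁ (tight c 0#) λ c#0 → ¬inv (v , Av , c , u , c#0 , v≈ , s)
      u≈v : u ≈ᴹ v
      u≈v = begin
        u            ≈⟨ +ᴹ-identityˡ u ⟨
        0ᴹ +ᴹ u      ≈⟨ +ᴹ-congʳ (≈ᴹ-sym (≈ᴹ-trans (*ₗ-congʳ c≈0) (*ₗ-zeroˡ w))) ⟩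
        c *ₗ w +ᴹ u  ≈⟨ v≈ ⟨
        v            ∎

    sub′ : ∀ t → Subspace (λ v → A t v × Span ws v)
    sub′ t .resp eq (x , y) = sub t .resp eq x , span-subspace ws .resp eq y
    sub′ t .zero∈ = sub t .zero∈ , span-subspace ws .zero∈
    sub′ t .plus∈ (x , y) (x′ , y′) = sub t .plus∈ x x′ , span-subspace ws .plus∈ y y′
    sub′ t .scale∈ c (x , y) = sub t .scale∈ c x , span-subspace ws .scale∈ c y

    -- Below level `t₀` no vector involves `w`. From `t₀` on, `v₀` itself lies in `A t`, so
    -- subtracting the multiple of `v₀` that cancels `w` does not raise the level of `v`.
    extend : ∀ {t₀ v₀ c₀ u₀} → t₀ ℕ.≤ T → A t₀ v₀ → c₀ # 0# → v₀ ≈ᴹ c₀ *ₗ w +ᴹ u₀ → Span ws u₀ →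
      (∀ {s} → s ℕ.< t₀ → ¬ Involved s) → ∀ bs →
      (∀ {t v} → t ℕ.≤ T → A t v × Span ws v → Span (below t bs) v) →
      ∀ {t v} → t ℕ.≤ T → A t v → Span (below t ((v₀ , t₀) ∷ bs)) v
    extend {t₀} {v₀} {c₀} {u₀} t₀≤T Av₀ c₀#0 v₀≈ s₀ least bs spans {t} {v} t≤T Av with t₀ ℕ.≤? t | A⊆ (mono t≤T Av)
    ... | no t₀≰t | s = subst (λ ws → Span ws v) (≡.sym (below-reject bs t₀≰t)) $ spans t≤T (Av , uninvolved (least (ℕ.≰⇒> t₀≰t)) Av s)
    ... | yes t₀≤t | _∷_ (c , u , v≈ , s) = subst (λ ws → Span ws v) (≡.sym (below-accept bs t₀≤t)) $ _∷_ (d , v +ᴹ (- d) *ₗ v₀ , v≈′ ,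
        spans t≤T (sub t .plus∈ Av (sub t .scale∈ (- d) (mono t₀≤t Av₀)) ,
          span-subspace ws .resp (≈ᴹ-sym reduced) (span-subspace ws .plus∈ s (span-subspace ws .scale∈ (- d) s₀))))
      where
      c₀⁻¹ = proj₁ (#0-inverse c₀#0)
      d = c * c₀⁻¹

      v≈′ : v ≈ᴹ d *ₗ v₀ +ᴹ (v +ᴹ (- d) *ₗ v₀)
      v≈′ = ≈ᴹ-sym (begin
        d *ₗ v₀ +ᴹ (v +ᴹ (- d) *ₗ v₀)  ≈⟨ +ᴹ-congˡ (+ᴹ-comm v _) ⟩
        d *ₗ v₀ +ᴹ ((- d) *ₗ v₀ +ᴹ v)  ≈⟨ +ᴹ-assoc _ _ _ ⟨
        (d *ₗ v₀ +ᴹ (- d) *ₗ v₀) +ᴹ v  ≈⟨ +ᴹ-congʳ (*ₗ-distribʳ v₀ d (- d)) ⟨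
        (d - d) *ₗ v₀ +ᴹ v             ≈⟨ +ᴹ-congʳ (≈ᴹ-trans (*ₗ-congʳ (-‿inverseʳ d)) (*ₗ-zeroˡ v₀)) ⟩
        0ᴹ +ᴹ v                        ≈⟨ +ᴹ-identityˡ v ⟩
        v                              ∎)

      cancels : c + (- d) * c₀ ≈ 0#
      cancels = S.begin
        c + (- d) * c₀           S.≈⟨ +-congˡ (sym (-‿distribˡ-* d c₀)) ⟩
        c - d * c₀               S.≈⟨ +-congˡ (-‿cong (trans (*-assoc c c₀⁻¹ c₀) (*-congˡ (proj₂ (#0-inverse c₀#0))))) ⟩
        c - c * 1#               S.≈⟨ +-congˡ (-‿cong (*-identityʳ c)) ⟩
        c - c                    S.≈⟨ -‿inverseʳ c ⟩
        0#                       S.∎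

      reduced : v +ᴹ (- d) *ₗ v₀ ≈ᴹ u +ᴹ (- d) *ₗ u₀
      reduced = begin
        v +ᴹ (- d) *ₗ v₀                                      ≈⟨ +ᴹ-cong v≈ (*ₗ-congˡ v₀≈) ⟩
        (c *ₗ w +ᴹ u) +ᴹ (- d) *ₗ (c₀ *ₗ w +ᴹ u₀)              ≈⟨ +ᴹ-congˡ (*ₗ-distribˡ (- d) _ _) ⟩
        (c *ₗ w +ᴹ u) +ᴹ ((- d) *ₗ (c₀ *ₗ w) +ᴹ (- d) *ₗ u₀)   ≈⟨ interchange _ _ _ _ ⟩
        (c *ₗ w +ᴹ (- d) *ₗ (c₀ *ₗ w)) +ᴹ (u +ᴹ (- d) *ₗ u₀)
          ≈⟨ +ᴹ-congʳ (+ᴹ-congˡ (≈ᴹ-sym (*ₗ-assoc (- d) c₀ w))) ⟩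
        (c *ₗ w +ᴹ ((- d) * c₀) *ₗ w) +ᴹ (u +ᴹ (- d) *ₗ u₀)    ≈⟨ +ᴹ-congʳ (≈ᴹ-sym (*ₗ-distribʳ w c ((- d) * c₀))) ⟩
        (c + (- d) * c₀) *ₗ w +ᴹ (u +ᴹ (- d) *ₗ u₀)
          ≈⟨ +ᴹ-congʳ (≈ᴹ-trans (*ₗ-congʳ cancels) (*ₗ-zeroˡ w)) ⟩
        0ᴹ +ᴹ (u +ᴹ (- d) *ₗ u₀)                               ≈⟨ +ᴹ-identityˡ _ ⟩
        u +ᴹ (- d) *ₗ u₀                                       ∎

  -- Every level `suc t` must occur in an adapted family: otherwise the members below `suc t` all
  -- have level at most `t`, and `A (suc t)` collapses into `A t`. Hence the family has at least `T`
  -- members.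
  strict-flag-length : ∀ {p} (A : ℕ → Carrierᴹ → Set p) →
    (∀ t → Subspace (A t)) → (∀ {s t v} → s ℕ.≤ t → A s v → A t v) →
    ∀ T ws → (∀ {v} → A T v → Span ws v) →
    (∀ {t} → t ℕ.< T → ∃[ v ] A (suc t) v × ¬ A t v) → T ℕ.≤ length ws
  strict-flag-length A sub mono T ws A⊆ strict =
    decidable-stable (T ℕ.≤? length ws) λ ¬le →
      adapted-family A sub mono T ws A⊆ λ (bs , len , lev , spans) →
        ¬le (ℕ.≤-trans (levels-≤ bs lev spans) len)
    where
    levels-≤ : ∀ bs → (∀ {b l} → (b , l) ∈ bs → A l b) →
      (∀ {t v} → t ℕ.≤ T → A t v → Span (below t bs) v) → T ℕ.≤ length bs
    levels-≤ bs lev spans = subst (T ℕ.≤_) (List.length-map proj₂ bs) (Fin.injective⇒≤ {f = position} position-injective)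
      where
      open import Data.List.Membership.DecPropositional ℕ._≟_ using (_∈?_)
      levels = map proj₂ bs

      occurs : ∀ {t} → t ℕ.< T → suc t ∈ levels
      occurs {t} t<T with suc t ∈? levels | strict t<T
      ... | yes t∈ | _ = t∈
      ... | no ∌t | v , Av , ¬Av = contradiction
        (span-least (sub t) stays (spans t<T Av)) ¬Av
        where
        stays : ∀ {b} → b ∈ below (suc t) bs → A t b
        stays b∈ with ∈-below⁻ bs b∈
        ... | l , bl∈ , l≤1+t with ℕ.m≤n⇒m<n∨m≡n l≤1+t
        ...   | inj₁ (s≤s l≤t) = mono l≤t (lev bl∈)
        ...   | inj₂ ≡.refl = contradiction (∈-map⁺ proj₂ bl∈) ∌t

      position : Fin T → Fin (length levels)
      position i = Any.index (occurs (Fin.toℕ<n i))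

      position-injective : ∀ {i j} → position i ≡ position j → i ≡ j
      position-injective {i} {j} eq = Fin.toℕ-injective (ℕ.suc-injective (≡.trans
        (lookup-index (occurs (Fin.toℕ<n i)))
        (≡.trans (≡.cong (lookup levels) eq) (≡.sym (lookup-index (occurs (Fin.toℕ<n j)))))))

-- Filtrations and the adjunction of a linear operator.

module Adjunction {a ℓ₁ ℓ₂ m ℓm} (F : HeytingField a ℓ₁ ℓ₂)
  (V : LeftSemimodule (heytingSemiring F) m ℓm) where

  open LeftSemimodule V
  open LinearAlgebra F V
  open Subspace

  record Linear (E : Carrierᴹ → Carrierᴹ) : Set (a ⊔ m ⊔ ℓm) where
    field
      L-cong : ∀ {u v} → u ≈ᴹ v → E u ≈ᴹ E v
      L-zero : E 0ᴹ ≈ᴹ 0ᴹ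
      L-plus : ∀ u v → E (u +ᴹ v) ≈ᴹ E u +ᴹ E v
      L-scale : ∀ c v → E (c *ₗ v) ≈ᴹ c *ₗ E v

  record Filtration : Set (a ⊔ Level.suc (m ⊔ ℓm)) where
    field
      Level≤   : ℕ → Carrierᴹ → Set (m ⊔ ℓm)
      subspace : ∀ t → Subspace (Level≤ t)
      mono     : ∀ {s t v} → s ℕ.≤ t → Level≤ s v → Level≤ t v
  open Filtration

  -- The least filtration above `𝓐` on which `E` raises levels by one. Closure under scalars is no
  -- constructor because it follows from the linearity of `E`.
  data Adjoin (𝓐 : Filtration) (E : Carrierᴹ → Carrierᴹ) : ℕ → Carrierᴹ → Set (m ⊔ ℓm) where
    incl  : ∀ {t v} → Level≤ 𝓐 t v → Adjoin 𝓐 E t v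
    apply : ∀ {t v} → Adjoin 𝓐 E t v → Adjoin 𝓐 E (suc t) (E v)
    plus  : ∀ {t u v} → Adjoin 𝓐 E t u → Adjoin 𝓐 E t v → Adjoin 𝓐 E t (u +ᴹ v)
    conv  : ∀ {t u v} → u ≈ᴹ v → Adjoin 𝓐 E t u → Adjoin 𝓐 E t v

  module _ (𝓐 : Filtration) {E : Carrierᴹ → Carrierᴹ} (linear : Linear E) where
    open Linear linear renaming (L-cong to E-cong; L-zero to E-zero; L-plus to E-plus; L-scale to E-scale)

    adjoin-scale : ∀ {t v} c → Adjoin 𝓐 E t v → Adjoin 𝓐 E t (c *ₗ v)
    adjoin-scale c (incl x) = incl (subspace 𝓐 _ .scale∈ c x)
    adjoin-scale c (apply x) = conv (E-scale c _) (apply (adjoin-scale c x))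
    adjoin-scale c (plus x y) = conv (≈ᴹ-sym (*ₗ-distribˡ c _ _)) (plus (adjoin-scale c x) (adjoin-scale c y))
    adjoin-scale c (conv eq x) = conv (*ₗ-congˡ eq) (adjoin-scale c x)

    adjoin-mono : ∀ {s t v} → s ℕ.≤ t → Adjoin 𝓐 E s v → Adjoin 𝓐 E t v
    adjoin-mono s≤t (incl x) = incl (mono 𝓐 s≤t x)
    adjoin-mono (s≤s s≤t) (apply x) = apply (adjoin-mono s≤t x)
    adjoin-mono s≤t (plus x y) = plus (adjoin-mono s≤t x) (adjoin-mono s≤t y)
    adjoin-mono s≤t (conv eq x) = conv eq (adjoin-mono s≤t x)

    adjoin : Filtration
    adjoin .Level≤ = Adjoin 𝓐 E
    adjoin .subspace t .resp = conv
    adjoin .subspace t .zero∈ = incl (subspace 𝓐 t .zero∈)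
    adjoin .subspace t .plus∈ = plus
    adjoin .subspace t .scale∈ c = adjoin-scale c
    adjoin .mono = adjoin-mono

    -- `L` moves past every `E` until it meets an element of `𝓐`. For multiplications this says that
    -- polynomials adjoined earlier keep their level.
    adjoin-map : ∀ d {L} → Linear L → (∀ v → L (E v) ≈ᴹ E (L v)) →
      (∀ {t v} → Level≤ 𝓐 t v → Adjoin 𝓐 E (d ℕ.+ t) (L v)) →
      ∀ {t v} → Adjoin 𝓐 E t v → Adjoin 𝓐 E (d ℕ.+ t) (L v)
    adjoin-map d L-lin comm L-𝓐 (incl x) = L-𝓐 x
    adjoin-map d {L} L-lin comm L-𝓐 {suc t} (apply {v = v} x) =
      conv (≈ᴹ-sym (comm v)) (subst (λ s → Adjoin 𝓐 E s (E (L v))) (≡.sym (ℕ.+-suc d t)) (apply (adjoin-map d L-lin comm L-𝓐 x)))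
    adjoin-map d L-lin comm L-𝓐 (plus x y) =
      conv (≈ᴹ-sym (Linear.L-plus L-lin _ _)) (plus (adjoin-map d L-lin comm L-𝓐 x) (adjoin-map d L-lin comm L-𝓐 y))
    adjoin-map d L-lin comm L-𝓐 (conv eq x) = conv (Linear.L-cong L-lin eq) (adjoin-map d L-lin comm L-𝓐 x)

    -- `E` acts innermost, so that `iterate (suc k) b` is `iterate k (E b)` by definition; the
    -- re-expansion of `E b` relies on this.
    iterate : ℕ → Carrierᴹ → Carrierᴹ
    iterate zero    v = v
    iterate (suc k) v = iterate k (E v)

    iterate-linear : ∀ k → Linear (iterate k)
    iterate-linear zero = record
      { L-cong = λ eq → eq ; L-zero = ≈ᴹ-refl ; L-plus = λ _ _ → ≈ᴹ-refl ; L-scale = λ _ _ → ≈ᴹ-refl }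
    iterate-linear (suc k) = record
      { L-cong  = K.L-cong ∘ E-cong
      ; L-zero  = ≈ᴹ-trans (K.L-cong E-zero) K.L-zero
      ; L-plus  = λ u v → ≈ᴹ-trans (K.L-cong (E-plus u v)) (K.L-plus _ _)
      ; L-scale = λ c v → ≈ᴹ-trans (K.L-cong (E-scale c v)) (K.L-scale c _)
      }
      where
      module K = Linear (iterate-linear k)

    preimage-subspace : ∀ {p L} {P : Carrierᴹ → Set p} → Linear L → Subspace P → Subspace (P ∘ L)
    preimage-subspace L-lin sub .resp eq = sub .resp (Linear.L-cong L-lin eq)
    preimage-subspace L-lin sub .zero∈ = sub .resp (≈ᴹ-sym (Linear.L-zero L-lin)) (sub .zero∈)
    preimage-subspace L-lin sub .plus∈ x y = sub .resp (≈ᴹ-sym (Linear.L-plus L-lin _ _)) (sub .plus∈ x y)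
    preimage-subspace L-lin sub .scale∈ c x = sub .resp (≈ᴹ-sym (Linear.L-scale L-lin c _)) (sub .scale∈ c x)

    -- With a basis adapted to 𝓐, level T of the new filtration is spanned by the
    -- b of level l ≤ T together with the E^(T-l) b: any other E^(1+k) b has
    -- 1+k+l < T, and there E b can be re-expanded as it lies in level 2+l of 𝓐.
    adjoin-span : (∀ {t v} → Level≤ 𝓐 t v → Level≤ 𝓐 (2 ℕ.+ t) (E v)) →
      ∀ T ws → (∀ {v} → Level≤ 𝓐 T v → Span ws v) →
      ¬ ¬ (∃[ us ] length us ℕ.≤ 2 ℕ.* length ws × (∀ {v} → Adjoin 𝓐 E T v → Span us v))
    adjoin-span raises T ws spans k =
      adapted-family (Level≤ 𝓐) (subspace 𝓐) (mono 𝓐) T ws spans λ (bs , len , lev , adapted) →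
        k (family bs , family-length bs len , λ x → spanned bs lev adapted 0 ℕ.≤-refl x)
      where
      top : Carrierᴹ × ℕ → Carrierᴹ
      top (b , l) = iterate (T ℕ.∸ l) b

      family : List (Carrierᴹ × ℕ) → List Carrierᴹ
      family bs = map proj₁ bs ++ map top bs

      family-length : ∀ bs → length bs ℕ.≤ length ws → length (family bs) ℕ.≤ 2 ℕ.* length ws
      family-length bs len = begin
        length (family bs)                              ≡⟨ List.length-++ (map proj₁ bs) ⟩
        length (map proj₁ bs) ℕ.+ length (map top bs)
          ≡⟨ ≡.cong₂ ℕ._+_ (List.length-map proj₁ bs) (List.length-map top bs) ⟩
        length bs ℕ.+ length bs                         ≤⟨ ℕ.+-mono-≤ len len ⟩
        length ws ℕ.+ length ws                         ≡⟨ ≡.cong (length ws ℕ.+_) (ℕ.+-identityʳ _) ⟨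
        2 ℕ.* length ws                                 ∎
        where open ℕ.≤-Reasoning

      module _ bs (lev : ∀ {b l} → (b , l) ∈ bs → Level≤ 𝓐 l b)
        (adapted : ∀ {t v} → t ℕ.≤ T → Level≤ 𝓐 t v → Span (below t bs) v) where

        sub : ∀ k → Subspace (Span (family bs) ∘ iterate k)
        sub k = preimage-subspace (iterate-linear k) (span-subspace (family bs))

        iterate-spanned : ∀ k {t v} → k ℕ.+ t ℕ.≤ T → Level≤ 𝓐 t v → Span (family bs) (iterate k v)
        iterate-spanned zero t≤T x = span-least (sub 0) listed (adapted t≤T x)
          where
          listed : ∀ {b} → b ∈ below _ bs → Span (family bs) b
          listed b∈ with ∈-below⁻ bs b∈
          ... | l , bl∈ , _ = span-∈ (∈-++⁺ˡ (∈-map⁺ proj₁ bl∈))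
        iterate-spanned (suc k) {t} 1+k+t≤T x =
          span-least (sub (suc k)) listed (adapted (ℕ.m+n≤o⇒n≤o (suc k) 1+k+t≤T) x)
          where
          listed : ∀ {b} → b ∈ below t bs → Span (family bs) (iterate (suc k) b)
          listed {b} b∈ with ∈-below⁻ bs b∈
          ... | l , bl∈ , l≤t with ℕ.m≤n⇒m<n∨m≡n (ℕ.≤-trans (ℕ.+-monoʳ-≤ (suc k) l≤t) 1+k+t≤T)
          -- Passing from `b` to `E b` costs two levels and saves one iteration; the strict
          -- inequality pays for the net increase of one.
          ...   | inj₁ 1+k+l<T = iterate-spanned k (subst (ℕ._≤ T) shift 1+k+l<T) (raises (lev bl∈))
            where
            shift : suc (suc k ℕ.+ l) ≡ k ℕ.+ (2 ℕ.+ l)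
            shift = ≡.sym (≡.trans (ℕ.+-suc k (suc l)) (≡.cong suc (ℕ.+-suc k l)))
          ...   | inj₂ ≡.refl = subst (λ j → Span (family bs) (iterate j b)) (ℕ.m+n∸n≡m (suc k) l)
                                  (span-∈ (∈-++⁺ʳ (map proj₁ bs) (∈-map⁺ top bl∈)))

        spanned : ∀ k {t v} → k ℕ.+ t ℕ.≤ T → Adjoin 𝓐 E t v → Span (family bs) (iterate k v)
        spanned k k+t≤T (incl x) = iterate-spanned k k+t≤T x
        spanned k {suc t} k+t≤T (apply x) = spanned (suc k) (subst (ℕ._≤ T) (ℕ.+-suc k t) k+t≤T) x
        spanned k k+t≤T (plus x y) = sub k .plus∈ (spanned k k+t≤T x) (spanned k k+t≤T y)
        spanned k k+t≤T (conv eq x) = sub k .resp eq (spanned k k+t≤T x)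

-- Exponent vectors, and polynomials seen through linear functionals.

infixl 6 _⊕_
_⊕_ : ∀ {n} → Vec ℕ n → Vec ℕ n → Vec ℕ n
_⊕_ = zipWith ℕ._+_

⊕-assoc : ∀ {n} (l m k : Vec ℕ n) → l ⊕ m ⊕ k ≡ l ⊕ (m ⊕ k)
⊕-assoc = Vec.zipWith-assoc ℕ.+-assoc

⊕-comm : ∀ {n} (l m : Vec ℕ n) → l ⊕ m ≡ m ⊕ l
⊕-comm = Vec.zipWith-comm ℕ.+-comm

⊕-identityˡ : ∀ {n} (m : Vec ℕ n) → replicate n 0 ⊕ m ≡ m
⊕-identityˡ = Vec.zipWith-identityˡ ℕ.+-identityˡ

module Evaluation {a ℓ₁ ℓ₂} (F : HeytingField a ℓ₁ ℓ₂) (n : ℕ) where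

  open HeytingField F
  open OverField F
  open RingProperties (CommutativeRing.ring (heytingRing F)) using (-‿distribˡ-*)
  open CommutativeSemigroupProperties (CommutativeMonoid.commutativeSemigroup (CommutativeRing.+-commutativeMonoid (heytingRing F)))
    using (interchange)
  open CommutativeSemigroupProperties (CommutativeRing.*-commutativeSemigroup (heytingRing F))
    using (x∙yz≈y∙xz)
  open SetoidReasoning setoid
  open RawSemiring (polyRawSemiring n) using () renaming (_*_ to _*ₚ_; 1# to 1ₚ)

  -- Polynomials are compared through these linear functionals, for which the
  -- ring laws hold by interchanging sums.
  eval : Poly n → (Monomial n → Carrier) → Carrier
  eval []            g = 0#
  eval ((c , m) ∷ p) g = c * g m + eval p g

  eval-cong : ∀ p {g h} → (∀ m → g m ≈ h m) → eval p g ≈ eval p h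
  eval-cong []            g≈h = refl
  eval-cong ((c , m) ∷ p) g≈h = +-cong (*-congˡ (g≈h m)) (eval-cong p g≈h)

  eval-++ : ∀ p q g → eval (p ++ q) g ≈ eval p g + eval q g
  eval-++ []            q g = sym (+-identityˡ _)
  eval-++ ((c , m) ∷ p) q g = trans (+-congˡ (eval-++ p q g)) (sym (+-assoc _ _ _))

  eval-0 : ∀ p {g} → (∀ m → g m ≈ 0#) → eval p g ≈ 0#
  eval-0 []            g≈0 = refl
  eval-0 ((c , m) ∷ p) g≈0 =
    trans (+-cong (trans (*-congˡ (g≈0 m)) (zeroʳ c)) (eval-0 p g≈0)) (+-identityˡ 0#)

  eval-+ : ∀ p g h → eval p (λ m → g m + h m) ≈ eval p g + eval p h
  eval-+ []            g h = sym (+-identityˡ 0#)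
  eval-+ ((c , m) ∷ p) g h =
    trans (+-cong (distribˡ c _ _) (eval-+ p g h)) (interchange _ _ _ _)

  eval-* : ∀ p c g → eval p (λ m → c * g m) ≈ c * eval p g
  eval-* []            c g = sym (zeroʳ c)
  eval-* ((d , m) ∷ p) c g = trans (+-cong (x∙yz≈y∙xz d c _) (eval-* p c g)) (sym (distribˡ c _ _))

  eval-swap : ∀ p q (g : Monomial n → Monomial n → Carrier) →
    eval p (λ l → eval q (g l)) ≈ eval q (λ m → eval p (λ l → g l m))
  eval-swap []            q g = sym (eval-0 q λ _ → refl)
  eval-swap ((c , l) ∷ p) q g = begin
    c * eval q (g l) + eval p (λ l → eval q (g l))
      ≈⟨ +-cong (sym (eval-* q c (g l))) (eval-swap p q g) ⟩
    eval q (λ m → c * g l m) + eval q (λ m → eval p (λ l → g l m))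
      ≈⟨ eval-+ q _ _ ⟨
    eval q (λ m → c * g l m + eval p (λ l → g l m)) ∎

  shifted : Carrier → Monomial n → Poly n → Poly n
  shifted c l = map λ (d , m) → c * d , l ⊕ m

  eval-shifted : ∀ c l q g → eval (shifted c l q) g ≈ c * eval q (g ∘ (l ⊕_))
  eval-shifted c l []            g = sym (zeroʳ c)
  eval-shifted c l ((d , m) ∷ q) g =
    trans (+-cong (*-assoc c d _) (eval-shifted c l q g)) (sym (distribˡ c _ _))

  eval-*ₚ : ∀ p q g → eval (p *ₚ q) g ≈ eval p (λ l → eval q (λ m → g (l ⊕ m)))
  eval-*ₚ []            q g = refl
  eval-*ₚ ((c , l) ∷ p) q g = trans (eval-++ (shifted c l q) (p *ₚ q) g)
    (+-cong (eval-shifted c l q g) (eval-*ₚ p q g))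

  infixr 7 _·ₚ_
  _·ₚ_ : Carrier → Poly n → Poly n
  c ·ₚ p = map (λ (d , m) → c * d , m) p

  eval-·ₚ : ∀ c p g → eval (c ·ₚ p) g ≈ c * eval p g
  eval-·ₚ c []            g = sym (zeroʳ c)
  eval-·ₚ c ((d , m) ∷ p) g =
    trans (+-cong (*-assoc c d _) (eval-·ₚ c p g)) (sym (distribˡ c _ _))

  eval-1ₚ : ∀ g → eval 1ₚ g ≈ g (replicate n 0)
  eval-1ₚ g = trans (+-identityʳ _) (*-identityˡ _)

  -ₚ_ : Poly n → Poly n
  -ₚ p = (- 1#) ·ₚ p

  eval--ₚ : ∀ p g → eval (-ₚ p) g ≈ - eval p g
  eval--ₚ p g = trans (eval-·ₚ _ p g) (trans (sym (-‿distribˡ-* 1# _)) (-‿cong (*-identityˡ _)))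

-- Polynomials modulo the span of the monomials outside D.
module PolynomialRing {a ℓ₁ ℓ₂} (F : HeytingField a ℓ₁ ℓ₂) (n : ℕ)
  (D : Vec ℕ n → Set) (D-closed : ∀ l m → D (l ⊕ m) → D l) where

  open HeytingField F
  open OverField F
  open Evaluation F n
  open RawSemiring (polyRawSemiring n) using () renaming (_*_ to _*ₚ_; 1# to 1ₚ)

  Supported : (Monomial n → Carrier) → Set ℓ₁
  Supported g = ∀ m → ¬ D m → g m ≈ 0#

  infix 4 _≋_
  record _≋_ (p q : Poly n) : Set (a ⊔ ℓ₁) where
    constructor mk
    field eval≈ : ∀ g → Supported g → eval p g ≈ eval q g
  open _≋_ public

  private
    -- Since `D` is closed under divisors, the monomials outside it span an ideal. Hence a
    -- functional supported in `D` remains so after composition with a multiplication, and products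
    -- respect `_≋_`.
    supported-⊕ : ∀ {g} q → Supported g → Supported (λ l → eval q (λ m → g (l ⊕ m)))
    supported-⊕ q sup l l∉D = eval-0 q λ m → sup _ (l∉D ∘ D-closed l m)

    supported-⊕ˡ : ∀ {g} l → Supported g → Supported (λ m → g (l ⊕ m))
    supported-⊕ˡ l sup m m∉D = sup _ (m∉D ∘ D-closed m l ∘ subst D (⊕-comm l m))

  *ₚ-comm : ∀ p q → p *ₚ q ≋ q *ₚ p
  *ₚ-comm p q .eval≈ g sup = begin
    eval (p *ₚ q) g                              ≈⟨ eval-*ₚ p q g ⟩
    eval p (λ l → eval q (λ m → g (l ⊕ m)))      ≈⟨ eval-swap p q _ ⟩
    eval q (λ m → eval p (λ l → g (l ⊕ m)))
      ≈⟨ eval-cong q (λ m → eval-cong p (λ l → reflexive (≡.cong g (⊕-comm l m)))) ⟩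
    eval q (λ m → eval p (λ l → g (m ⊕ l)))      ≈⟨ eval-*ₚ q p g ⟨
    eval (q *ₚ p) g                              ∎
    where open SetoidReasoning setoid

  *ₚ-assoc : ∀ p q r → (p *ₚ q) *ₚ r ≋ p *ₚ (q *ₚ r)
  *ₚ-assoc p q r .eval≈ g sup = begin
    eval ((p *ₚ q) *ₚ r) g                                            ≈⟨ eval-*ₚ (p *ₚ q) r g ⟩
    eval (p *ₚ q) (λ l → eval r (λ k → g (l ⊕ k)))                    ≈⟨ eval-*ₚ p q _ ⟩
    eval p (λ l → eval q (λ m → eval r (λ k → g (l ⊕ m ⊕ k))))
      ≈⟨ eval-cong p (λ l → eval-cong q (λ m → eval-cong r λ k → reflexive (≡.cong g (⊕-assoc l m k)))) ⟩
    eval p (λ l → eval q (λ m → eval r (λ k → g (l ⊕ (m ⊕ k)))))      ≈⟨ eval-cong p (λ l → eval-*ₚ q r _) ⟨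
    eval p (λ l → eval (q *ₚ r) (λ m → g (l ⊕ m)))                    ≈⟨ eval-*ₚ p (q *ₚ r) g ⟨
    eval (p *ₚ (q *ₚ r)) g                                            ∎
    where open SetoidReasoning setoid

  *ₚ-cong : ∀ {p p′ q q′} → p ≋ p′ → q ≋ q′ → p *ₚ q ≋ p′ *ₚ q′
  *ₚ-cong {p} {p′} {q} {q′} p≋p′ q≋q′ .eval≈ g sup = begin
    eval (p *ₚ q) g                                ≈⟨ eval-*ₚ p q g ⟩
    eval p (λ l → eval q (λ m → g (l ⊕ m)))        ≈⟨ eval-cong p (λ l → eval≈ q≋q′ _ (supported-⊕ˡ l sup)) ⟩
    eval p (λ l → eval q′ (λ m → g (l ⊕ m)))       ≈⟨ eval≈ p≋p′ _ (supported-⊕ q′ sup) ⟩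
    eval p′ (λ l → eval q′ (λ m → g (l ⊕ m)))      ≈⟨ eval-*ₚ p′ q′ g ⟨
    eval (p′ *ₚ q′) g                              ∎
    where open SetoidReasoning setoid

  *ₚ-identityˡ : ∀ p → 1ₚ *ₚ p ≋ p
  *ₚ-identityˡ p .eval≈ g sup = begin
    eval (1ₚ *ₚ p) g                          ≈⟨ eval-*ₚ 1ₚ p g ⟩
    eval 1ₚ (λ l → eval p (λ m → g (l ⊕ m)))  ≈⟨ eval-1ₚ (λ l → eval p (λ m → g (l ⊕ m))) ⟩
    eval p (λ m → g (replicate n 0 ⊕ m))      ≈⟨ eval-cong p (λ m → reflexive (≡.cong g (⊕-identityˡ m))) ⟩
    eval p g                                  ∎
    where open SetoidReasoning setoid

  *ₚ-distribʳ : ∀ r p q → (p ++ q) *ₚ r ≋ (p *ₚ r) ++ (q *ₚ r)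
  *ₚ-distribʳ r p q .eval≈ g sup = begin
    eval ((p ++ q) *ₚ r) g                  ≈⟨ eval-*ₚ (p ++ q) r g ⟩
    eval (p ++ q) _                         ≈⟨ eval-++ p q _ ⟩
    eval p _ + eval q _                     ≈⟨ +-cong (eval-*ₚ p r g) (eval-*ₚ q r g) ⟨
    eval (p *ₚ r) g + eval (q *ₚ r) g       ≈⟨ eval-++ (p *ₚ r) (q *ₚ r) g ⟨
    eval ((p *ₚ r) ++ (q *ₚ r)) g           ∎
    where open SetoidReasoning setoid

  ++-comm : ∀ p q → p ++ q ≋ q ++ p
  ++-comm p q .eval≈ g sup = trans (eval-++ p q g) (trans (+-comm _ _) (sym (eval-++ q p g)))

  ++-cong : ∀ {p p′ q q′} → p ≋ p′ → q ≋ q′ → p ++ q ≋ p′ ++ q′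
  ++-cong {p} {p′} {q} {q′} p≋ q≋ .eval≈ g sup =
    trans (eval-++ p q g) (trans (+-cong (eval≈ p≋ g sup) (eval≈ q≋ g sup)) (sym (eval-++ p′ q′ g)))

  ≋-refl : ∀ {p} → p ≋ p
  ≋-refl .eval≈ g sup = refl

  ≋-sym : ∀ {p q} → p ≋ q → q ≋ p
  ≋-sym eq .eval≈ g sup = sym (eval≈ eq g sup)

  ≋-trans : ∀ {p q r} → p ≋ q → q ≋ r → p ≋ r
  ≋-trans eq eq′ .eval≈ g sup = trans (eval≈ eq g sup) (eval≈ eq′ g sup)

  ≋-reflexive : ∀ {p q} → p ≡ q → p ≋ q
  ≋-reflexive ≡.refl = ≋-refl

  -ₚ-inverseʳ : ∀ p → p ++ (-ₚ p) ≋ []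
  -ₚ-inverseʳ p .eval≈ g sup =
    trans (eval-++ p (-ₚ p) g) (trans (+-congˡ (eval--ₚ p g)) (-‿inverseʳ _))

  polyRing : CommutativeRing a (a ⊔ ℓ₁)
  polyRing = record
    { Carrier = Poly n
    ; _≈_ = _≋_
    ; _+_ = _++_
    ; _*_ = _*ₚ_
    ; -_ = -ₚ_
    ; 0# = []
    ; 1# = 1ₚ
    ; isCommutativeRing = record
      { isRing = record
        { +-isAbelianGroup = record
          { isGroup = record
            { isMonoid = record
              { isSemigroup = record
                { isMagma = record
                  { isEquivalence = record { refl = ≋-refl ; sym = ≋-sym ; trans = ≋-trans }
                  ; ∙-cong = ++-cong }
                ; assoc = λ p q r → ≋-reflexive (List.++-assoc p q r) }
              ; identity = (λ p → ≋-refl) , (λ p → ≋-reflexive (List.++-identityʳ p)) }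
            ; inverse = (λ p → ≋-trans (++-comm (-ₚ p) p) (-ₚ-inverseʳ p)) , -ₚ-inverseʳ
            ; ⁻¹-cong = λ {p} {q} eq → mk λ g sup →
                trans (eval--ₚ p g) (trans (-‿cong (eval≈ eq g sup)) (sym (eval--ₚ q g))) }
          ; comm = ++-comm }
        ; *-cong = *ₚ-cong
        ; *-assoc = *ₚ-assoc
        ; *-identity = *ₚ-identityˡ , λ p → ≋-trans (*ₚ-comm p 1ₚ) (*ₚ-identityˡ p)
        ; distrib = (λ r p q → ≋-trans (*ₚ-comm r (p ++ q)) (≋-trans (*ₚ-distribʳ r p q)
                      (++-cong (*ₚ-comm p r) (*ₚ-comm q r)))) , *ₚ-distribʳ
        }
      ; *-comm = *ₚ-comm } }

  polyModule : LeftSemimodule (heytingSemiring F) a (a ⊔ ℓ₁)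
  polyModule = record
    { Carrierᴹ = Poly n
    ; _≈ᴹ_ = _≋_
    ; _+ᴹ_ = _++_
    ; _*ₗ_ = _·ₚ_
    ; 0ᴹ = []
    ; isLeftSemimodule = record
      { +ᴹ-isCommutativeMonoid = CommutativeRing.+-isCommutativeMonoid polyRing
      ; isPreleftSemimodule = record
        { *ₗ-cong = λ {c} {d} {p} {q} c≈d p≋q → mk λ g sup →
            trans (eval-·ₚ c p g) (trans (*-cong c≈d (eval≈ p≋q g sup)) (sym (eval-·ₚ d q g)))
        ; *ₗ-zeroˡ = λ p → mk λ g sup → trans (eval-·ₚ 0# p g) (zeroˡ _)
        ; *ₗ-distribʳ = λ p c d → mk λ g sup → trans (eval-·ₚ (c + d) p g) (trans (distribʳ _ c d)
            (sym (trans (eval-++ (c ·ₚ p) (d ·ₚ p) g) (+-cong (eval-·ₚ c p g) (eval-·ₚ d p g)))))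
        ; *ₗ-identityˡ = λ p → mk λ g sup → trans (eval-·ₚ 1# p g) (*-identityˡ _)
        ; *ₗ-assoc = λ c d p → mk λ g sup → trans (eval-·ₚ (c * d) p g) (trans (*-assoc c d _)
            (sym (trans (eval-·ₚ c (d ·ₚ p) g) (*-congˡ (eval-·ₚ d p g)))))
        ; *ₗ-zeroʳ = λ c → ≋-refl
        ; *ₗ-distribˡ = λ c p q → mk λ g sup → trans (eval-·ₚ c (p ++ q) g)
            (trans (*-congˡ (eval-++ p q g)) (trans (distribˡ c _ _)
            (sym (trans (eval-++ (c ·ₚ p) (c ·ₚ q) g) (+-cong (eval-·ₚ c p g) (eval-·ₚ c q g))))))
        } } }

  ·ₚ-*ₚ : ∀ c p q → (c ·ₚ p) *ₚ q ≋ c ·ₚ (p *ₚ q)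
  ·ₚ-*ₚ c p q .eval≈ g sup = trans (eval-*ₚ (c ·ₚ p) q g) (trans (eval-·ₚ c p _)
    (sym (trans (eval-·ₚ c (p *ₚ q) g) (*-congˡ (eval-*ₚ p q g)))))

  *ₚ-·ₚ : ∀ c p q → p *ₚ (c ·ₚ q) ≋ c ·ₚ (p *ₚ q)
  *ₚ-·ₚ c p q = ≋-trans (*ₚ-comm p (c ·ₚ q))
    (≋-trans (·ₚ-*ₚ c q p) (LeftSemimodule.*ₗ-congˡ polyModule (*ₚ-comm q p)))

-- Coefficients, degrees and truncation.

deg : ∀ {n} → Vec ℕ n → ℕ
deg = Vec.sum

deg-zeros : ∀ n → deg (replicate n 0) ≡ 0
deg-zeros zero    = ≡.refl
deg-zeros (suc n) = deg-zeros n

deg-⊕ : ∀ {n} (l m : Vec ℕ n) → deg (l ⊕ m) ≡ deg l ℕ.+ deg m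
deg-⊕ []      []      = ≡.refl
deg-⊕ (i ∷ l) (j ∷ m) = ≡.trans (≡.cong (i ℕ.+ j ℕ.+_) (deg-⊕ l m)) (interchange i j (deg l) (deg m))
  where open CommutativeSemigroupProperties ℕ.+-commutativeSemigroup using (interchange)

module Coefficients {a ℓ₁ ℓ₂} (F : HeytingField a ℓ₁ ℓ₂) (n : ℕ) where

  open HeytingField F hiding (zero)
  open OverField F
  open Evaluation F n
  open RawSemiring (polyRawSemiring n) using () renaming (_*_ to _*ₚ_)
  open CommutativeSemigroupProperties (CommutativeMonoid.commutativeSemigroup (CommutativeRing.+-commutativeMonoid (heytingRing F)))
    using (x∙yz≈y∙xz)
  open RingProperties (CommutativeRing.ring (heytingRing F)) using (x≈y⇒x∙y⁻¹≈ε; x∙y⁻¹≈ε⇒x≈y)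
  open SetoidReasoning setoid

  _≟ᵐ_ : (l m : Monomial n) → Dec (l ≡ m)
  _≟ᵐ_ = Vec.≡-dec ℕ._≟_

  mono : Monomial n → Poly n
  mono m = [ 1# , m ]

  δ : Monomial n → Monomial n → Carrier
  δ m l = if does (l ≟ᵐ m) then 1# else 0#

  eval-δ : ∀ p m → eval p (δ m) ≈ coeff p m
  eval-δ []            m = refl
  eval-δ ((c , l) ∷ p) m = +-cong (head (does (l ≟ᵐ m))) (eval-δ p m)
    where
    head : ∀ b → c * (if b then 1# else 0#) ≈ (if b then c else 0#)
    head true  = *-identityʳ c
    head false = zeroʳ c

  δ-refl : ∀ m → δ m m ≈ 1#
  δ-refl m with m ≟ᵐ m
  ... | yes _   = refl
  ... | no m≢m = contradiction ≡.refl m≢m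

  δ-≢ : ∀ {l m} → l ≢ m → δ m l ≈ 0#
  δ-≢ {l} {m} l≢m with l ≟ᵐ m
  ... | yes l≡m = contradiction l≡m l≢m
  ... | no _    = refl

  coeff-++ : ∀ p q m → coeff (p ++ q) m ≈ coeff p m + coeff q m
  coeff-++ p q m = begin
    coeff (p ++ q) m             ≈⟨ eval-δ (p ++ q) m ⟨
    eval (p ++ q) (δ m)          ≈⟨ eval-++ p q (δ m) ⟩
    eval p (δ m) + eval q (δ m)  ≈⟨ +-cong (eval-δ p m) (eval-δ q m) ⟩
    coeff p m + coeff q m        ∎

  coeff-∷-≢ : ∀ c p {l m} → l ≢ m → coeff ((c , l) ∷ p) m ≈ coeff p m
  coeff-∷-≢ c p {l} {m} l≢m with l ≟ᵐ m
  ... | yes l≡m = contradiction l≡m l≢m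
  ... | no _    = +-identityˡ _

  module _ {p} {P : Monomial n → Set p} (P? : Decidable P) where

    select : Poly n → Poly n
    select = filter (P? ∘ proj₂)

    coeff-select-yes : ∀ q {m} → P m → coeff (select q) m ≈ coeff q m
    coeff-select-yes [] Pm = refl
    coeff-select-yes ((c , l) ∷ q) {m} Pm with P? l
    ... | yes Pl = +-congˡ (coeff-select-yes q Pm)
    ... | no ¬Pl = trans (coeff-select-yes q Pm)
                     (sym (coeff-∷-≢ c q {l} {m} λ { ≡.refl → ¬Pl Pm }))

    coeff-select-no : ∀ q {m} → ¬ P m → coeff (select q) m ≈ 0#
    coeff-select-no [] ¬Pm = refl
    coeff-select-no ((c , l) ∷ q) {m} ¬Pm with P? l
    ... | yes Pl = trans (coeff-∷-≢ c (select q) {l} {m} λ { ≡.refl → ¬Pm Pl }) (coeff-select-no q ¬Pm)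
    ... | no ¬Pl = coeff-select-no q ¬Pm

    select-All : ∀ q → All (P ∘ proj₂) (select q)
    select-All q = All.all-filter (P? ∘ proj₂) q

  eval-split : ∀ {p} {P : Monomial n → Set p} (P? : Decidable P) q g →
    eval q g ≈ eval (select P? q) g + eval (select (¬? ∘ P?) q) g
  eval-split P? []            g = sym (+-identityˡ 0#)
  eval-split P? ((c , m) ∷ q) g with P? m
  ... | yes _ = trans (+-congˡ (eval-split P? q g)) (sym (+-assoc _ _ _))
  ... | no _  = trans (+-congˡ (eval-split P? q g)) (x∙yz≈y∙xz _ _ _)

  eval-single : ∀ m q g → eval (select (_≟ᵐ m) q) g ≈ coeff q m * g m
  eval-single m []            g = sym (zeroˡ _)
  eval-single m ((c , l) ∷ q) g with l ≟ᵐ m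
  ... | yes ≡.refl = trans (+-congˡ (eval-single m q g)) (sym (distribʳ _ _ _))
  ... | no l≢m = trans (eval-single m q g) (*-congʳ (sym (+-identityˡ _)))

  -- Well-founded on the number of terms: all terms with the first monomial are
  -- collected and removed at once.
  eval-vanishes : ∀ p g → (∀ m → coeff p m * g m ≈ 0#) → eval p g ≈ 0#
  eval-vanishes p g = go (length p) p ℕ.≤-refl
    where
    go : ∀ k p → length p ℕ.≤ k → (∀ m → coeff p m * g m ≈ 0#) → eval p g ≈ 0#
    go k [] _ _ = refl
    go (suc k) p@((c , m) ∷ q) (s≤s len) vanish = begin
      eval p g                                                    ≈⟨ eval-split (_≟ᵐ m) p g ⟩
      eval (select (_≟ᵐ m) p) g + eval rest g
        ≈⟨ +-cong (trans (eval-single m p g) (vanish m)) (go k rest rest≤k vanish′) ⟩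
      0# + 0#                                                     ≈⟨ +-identityˡ 0# ⟩
      0#                                                          ∎
      where
      rest = select (¬? ∘ (_≟ᵐ m)) p

      rest≤k : length rest ℕ.≤ k
      rest≤k = subst (λ r → length r ℕ.≤ k)
        (≡.sym (List.filter-reject (¬? ∘ (_≟ᵐ m) ∘ proj₂) {xs = q} (λ m≢m → m≢m ≡.refl)))
        (ℕ.≤-trans (List.length-filter (¬? ∘ (_≟ᵐ m) ∘ proj₂) q) len)

      vanish′ : ∀ l → coeff rest l * g l ≈ 0#
      vanish′ l with l ≟ᵐ m
      ... | yes l≡m = trans (*-congʳ (coeff-select-no (¬? ∘ (_≟ᵐ m)) p λ l≢m → l≢m l≡m)) (zeroˡ _)
      ... | no l≢m = trans (*-congʳ (coeff-select-yes (¬? ∘ (_≟ᵐ m)) p l≢m)) (vanish l)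

  -- The difference has zero coefficients, though its terms cancel only after being collected, which
  -- is the task of `eval-vanishes`. This carries `Computes`, a statement about coefficients, over
  -- to functionals.
  ≈ₚ⇒eval : ∀ {p q} → p ≈ₚ q → ∀ g → eval p g ≈ eval q g
  ≈ₚ⇒eval {p} {q} p≈q g = x∙y⁻¹≈ε⇒x≈y _ _ $ begin
    eval p g - eval q g           ≈⟨ +-congˡ (eval--ₚ q g) ⟨
    eval p g + eval (-ₚ q) g      ≈⟨ eval-++ p (-ₚ q) g ⟨
    eval (p ++ (-ₚ q)) g          ≈⟨ eval-vanishes (p ++ (-ₚ q)) g (λ m → trans (*-congʳ (vanish m)) (zeroˡ _)) ⟩
    0#                            ∎
    where
    vanish : ∀ m → coeff (p ++ (-ₚ q)) m ≈ 0#
    vanish m = begin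
      coeff (p ++ (-ₚ q)) m               ≈⟨ coeff-++ p (-ₚ q) m ⟩
      coeff p m + coeff (-ₚ q) m          ≈⟨ +-congˡ (trans (sym (eval-δ (-ₚ q) m)) (eval--ₚ q (δ m))) ⟩
      coeff p m - eval q (δ m)            ≈⟨ +-congˡ (-‿cong (eval-δ q m)) ⟩
      coeff p m - coeff q m               ≈⟨ x≈y⇒x∙y⁻¹≈ε (p≈q m) ⟩
      0#                                  ∎

  module Full = PolynomialRing F n (λ _ → ⊤) (λ _ _ _ → tt)
  open Full

  eval⇒≋ : ∀ {p q} → (∀ g → eval p g ≈ eval q g) → p ≋ q
  eval⇒≋ eq = mk λ g _ → eq g

  ≋⇒eval : ∀ {p q} → p ≋ q → ∀ g → eval p g ≈ eval q g
  ≋⇒eval p≋q g = eval≈ p≋q g λ m ¬⊤ → contradiction tt ¬⊤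

  ∷-split : ∀ c m q → (c ·ₚ mono m) ++ q ≋ (c , m) ∷ q
  ∷-split c m q = eval⇒≋ λ g → +-congʳ (*-congʳ (*-identityʳ c))

  Terms : ∀ {p} → (ℕ → Set p) → Poly n → Set _
  Terms P = All (P ∘ deg ∘ proj₂)

  terms-shifted : ∀ {p q r} {P : ℕ → Set p} {Q : ℕ → Set q} {R : ℕ → Set r} →
    (∀ {i j} → P i → Q j → R (i ℕ.+ j)) → ∀ c {l} {s} → P (deg l) → Terms Q s → Terms R (shifted c l s)
  terms-shifted PQR c Pl [] = []
  terms-shifted {P = P} {Q} {R} PQR c {l} Pl (_∷_ {x = _ , m} Qm Qs) =
    subst R (≡.sym (deg-⊕ l m)) (PQR Pl Qm) ∷ terms-shifted {P = P} {Q} {R} PQR c Pl Qs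

  terms-* : ∀ {p q r} {P : ℕ → Set p} {Q : ℕ → Set q} {R : ℕ → Set r} →
    (∀ {i j} → P i → Q j → R (i ℕ.+ j)) → ∀ {s t} → Terms P s → Terms Q t → Terms R (s *ₚ t)
  terms-* PQR [] Qt = []
  terms-* {P = P} {Q} {R} PQR (_∷_ {x = c , l} Pl Ps) Qt =
    All.++⁺ (terms-shifted {P = P} {Q} {R} PQR c Pl Qt) (terms-* {P = P} {Q} {R} PQR Ps Qt)

  -- A list may contain terms that cancel, and coefficients cannot be compared with zero. A degree
  -- condition therefore asks for some equal list all of whose terms satisfy it; such lists can be
  -- added and multiplied term by term.
  HasDegrees : ∀ {q} → (ℕ → Set q) → Poly n → Set _
  HasDegrees P p = ∃[ q ] p ≋ q × Terms P q

  module _ {q} {P : ℕ → Set q} where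

    degrees-resp : ∀ {p p′} → p ≋ p′ → HasDegrees P p → HasDegrees P p′
    degrees-resp eq (q , p≋q , ts) = q , ≋-trans (≋-sym eq) p≋q , ts

    degrees-0 : HasDegrees P []
    degrees-0 = [] , ≋-refl , []

    degrees-++ : ∀ {p p′} → HasDegrees P p → HasDegrees P p′ → HasDegrees P (p ++ p′)
    degrees-++ (q , p≋q , ts) (q′ , p′≋q′ , ts′) = q ++ q′ , ++-cong p≋q p′≋q′ , All.++⁺ ts ts′

    degrees-· : ∀ c {p} → HasDegrees P p → HasDegrees P (c ·ₚ p)
    degrees-· c (q , p≋q , ts) = c ·ₚ q , LeftSemimodule.*ₗ-congˡ polyModule p≋q , All.map⁺ ts

  degrees-weaken : ∀ {q r} {P : ℕ → Set q} {Q : ℕ → Set r} → (∀ {i} → P i → Q i) →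
    ∀ {p} → HasDegrees P p → HasDegrees Q p
  degrees-weaken P⇒Q (q , p≋q , ts) = q , p≋q , All.map P⇒Q ts

  degrees-* : ∀ {p q r} {P : ℕ → Set p} {Q : ℕ → Set q} {R : ℕ → Set r} →
    (∀ {i j} → P i → Q j → R (i ℕ.+ j)) →
    ∀ {s t} → HasDegrees P s → HasDegrees Q t → HasDegrees R (s *ₚ t)
  degrees-* {P = P} {Q} {R} PQR (s , ≋s , Ps) (t , ≋t , Qt) =
    s *ₚ t , *ₚ-cong ≋s ≋t , terms-* {P = P} {Q} {R} PQR Ps Qt

  degrees-mono : ∀ {q} {P : ℕ → Set q} m → P (deg m) → HasDegrees P (mono m)
  degrees-mono m Pm = mono m , ≋-refl , Pm ∷ []

  Degree≤⇒HasDegrees : ∀ {d p} → Degree≤ d p → HasDegrees (ℕ._≤ d) p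
  Degree≤⇒HasDegrees {d} {p} low = select low? p , eval⇒≋ eq , select-All low? p
    where
    low? : Decidable λ m → deg m ℕ.≤ d
    low? m = deg m ℕ.≤? d

    vanish : ∀ m → coeff (select (¬? ∘ low?) p) m ≈ 0#
    vanish m with low? m
    ... | yes m≤d = coeff-select-no (¬? ∘ low?) p (λ m≰d → m≰d m≤d)
    ... | no m≰d = trans (coeff-select-yes (¬? ∘ low?) p m≰d) (low m (ℕ.≰⇒> m≰d))

    eq : ∀ g → eval p g ≈ eval (select low? p) g
    eq g = trans (eval-split low? p g) (trans
      (+-congˡ (eval-vanishes (select (¬? ∘ low?) p) g λ m → trans (*-congʳ (vanish m)) (zeroˡ _)))
      (+-identityʳ _))

  constant? : Decidable λ (m : Monomial n) → deg m ℕ.≤ 0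
  constant? m = deg m ℕ.≤? 0

  constantPart nonconstantPart : Poly n → Poly n
  constantPart = select constant?
  nonconstantPart = select (¬? ∘ constant?)

  constant+nonconstant : ∀ p → p ≋ constantPart p ++ nonconstantPart p
  constant+nonconstant p = eval⇒≋ λ g →
    trans (eval-split constant? p g) (sym (eval-++ (constantPart p) (nonconstantPart p) g))

  constantPart-degree : ∀ p → HasDegrees (ℕ._≤ 0) (constantPart p)
  constantPart-degree p = constantPart p , ≋-refl , select-All constant? p

  nonconstantPart-degree : ∀ p → HasDegrees (1 ℕ.≤_) (nonconstantPart p)
  nonconstantPart-degree p = nonconstantPart p , ≋-refl ,
    All.map ℕ.≰⇒> (select-All (¬? ∘ constant?) p)

  Truncated : ℕ → Monomial n → Set
  Truncated k m = deg m ℕ.< k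

  truncated-closed : ∀ k l m → Truncated k (l ⊕ m) → Truncated k l
  truncated-closed k l m lm<k =
    ℕ.≤-<-trans (subst (deg l ℕ.≤_) (≡.sym (deg-⊕ l m)) (ℕ.m≤m+n (deg l) (deg m))) lm<k

  module Trunc (k : ℕ) = PolynomialRing F n (Truncated k) (truncated-closed k)

  ≋⇒truncated : ∀ k {p q} → p ≋ q → Trunc._≋_ k p q
  ≋⇒truncated k p≋q = Trunc.mk λ g _ → ≋⇒eval p≋q g

  high⇒0 : ∀ k {p} → HasDegrees (k ℕ.≤_) p → Trunc._≋_ k p []
  high⇒0 k {p} (q , p≋q , high) = Trunc.mk λ g sup → trans (≋⇒eval p≋q g) (vanish q high g sup)
    where
    vanish : ∀ q → Terms (k ℕ.≤_) q → ∀ g → Trunc.Supported k g → eval q g ≈ 0#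
    vanish [] [] g sup = refl
    vanish ((c , m) ∷ q) (k≤m ∷ high) g sup =
      trans (+-cong (trans (*-congˡ (sup m (ℕ.≤⇒≯ k≤m))) (zeroʳ c)) (vanish q high g sup)) (+-identityˡ 0#)

-- Partial derivatives.

infixl 7 _⊖_
-- At exponent zero `pred` changes nothing, but there the derivative carries the factor zero.
_⊖_ : ∀ {n} → Vec ℕ n → Fin n → Vec ℕ n
m ⊖ i = m [ i ]%= ℕ.pred

⊖-⊕ˡ : ∀ {n} (l m : Vec ℕ n) i {k} → Vec.lookup l i ≡ suc k → (l ⊕ m) ⊖ i ≡ (l ⊖ i) ⊕ m
⊖-⊕ˡ (_ ∷ l) (_ ∷ m) zero    ≡.refl = ≡.refl
⊖-⊕ˡ (a ∷ l) (b ∷ m) (suc i) eq     = ≡.cong (a ℕ.+ b ∷_) (⊖-⊕ˡ l m i eq)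

⊖-⊕ʳ : ∀ {n} (l m : Vec ℕ n) i {k} → Vec.lookup m i ≡ suc k → (l ⊕ m) ⊖ i ≡ l ⊕ (m ⊖ i)
⊖-⊕ʳ l m i eq = ≡.trans (≡.cong (_⊖ i) (⊕-comm l m)) (≡.trans (⊖-⊕ˡ m l i eq) (⊕-comm (m ⊖ i) l))

deg-⊖ : ∀ {n} (m : Vec ℕ n) i {k} → Vec.lookup m i ≡ suc k → deg (m ⊖ i) ≡ ℕ.pred (deg m)
deg-⊖ (_ ∷ m)     zero    ≡.refl = ≡.refl
deg-⊖ (a ∷ m)     (suc i) eq = begin
  a ℕ.+ deg (m ⊖ i)          ≡⟨ ≡.cong (a ℕ.+_) (deg-⊖ m i eq) ⟩
  a ℕ.+ ℕ.pred (deg m)       ≡⟨ +-pred a (positive m i eq) ⟩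
  ℕ.pred (a ℕ.+ deg m)       ∎
  where
  open ≡-Reasoning
  positive : ∀ {n} (m : Vec ℕ n) i {k} → Vec.lookup m i ≡ suc k → ∃[ j ] deg m ≡ suc j
  positive (_ ∷ m) zero    ≡.refl = _ , ≡.refl
  positive (a ∷ m) (suc i) eq with positive m i eq
  ... | j , eq′ = a ℕ.+ j , ≡.trans (≡.cong (a ℕ.+_) eq′) (ℕ.+-suc a j)
  +-pred : ∀ a {b} → ∃[ j ] b ≡ suc j → a ℕ.+ ℕ.pred b ≡ ℕ.pred (a ℕ.+ b)
  +-pred a (j , ≡.refl) = ≡.cong ℕ.pred (≡.sym (ℕ.+-suc a j))

module Derivation {a ℓ₁ ℓ₂} (F : HeytingField a ℓ₁ ℓ₂) (n : ℕ) where

  open HeytingField F hiding (zero)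
  open OverField F
  open Evaluation F n
  open Coefficients F n
  open Full
  open RawSemiring (polyRawSemiring n) using () renaming (_*_ to _*ₚ_)
  open SemiringMult (heytingSemiring F)
    using (×-homo-+; ×-congʳ; ×-comm-*; ×-assoc-*) renaming (_×_ to _·_)
  open SetoidReasoning setoid

  -- Exponent zero yields no term instead of one with coefficient zero, whose monomial would keep
  -- its degree and spoil the bound in `∂-degree`.
  ∂-term : Carrier → Monomial n → Fin n → ℕ → Poly n
  ∂-term c m i zero    = []
  ∂-term c m i (suc k) = [ suc k · c , m ⊖ i ]

  ∂ : Fin n → Poly n → Poly n
  ∂ i []            = []
  ∂ i ((c , m) ∷ p) = ∂-term c m i (Vec.lookup m i) ++ ∂ i p

  -- The transpose of `∂ i` on functionals. Through it the Leibniz rule becomes an identity for a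
  -- pair of exponent vectors.
  ∂ᵗ : Fin n → (Monomial n → Carrier) → Monomial n → Carrier
  ∂ᵗ i g m = Vec.lookup m i · g (m ⊖ i)

  eval-∂-term : ∀ c m i k g → eval (∂-term c m i k) g ≈ c * (k · g (m ⊖ i))
  eval-∂-term c m i zero    g = sym (zeroʳ c)
  eval-∂-term c m i (suc k) g = trans (+-identityʳ _)
    (trans (×-assoc-* (suc k) c _) (sym (×-comm-* (suc k) c _)))

  eval-∂ : ∀ i p g → eval (∂ i p) g ≈ eval p (∂ᵗ i g)
  eval-∂ i []            g = refl
  eval-∂ i ((c , m) ∷ p) g = trans (eval-++ (∂-term c m i (Vec.lookup m i)) (∂ i p) g)
    (+-cong (eval-∂-term c m i (Vec.lookup m i) g) (eval-∂ i p g))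

  eval-· : ∀ p k g → eval p (λ m → k · g m) ≈ k · eval p g
  eval-· p zero    g = eval-0 p λ _ → refl
  eval-· p (suc k) g = trans (eval-+ p g (λ m → k · g m)) (+-congˡ (eval-· p k g))

  ∂-cong : ∀ i {p q} → p ≋ q → ∂ i p ≋ ∂ i q
  ∂-cong i {p} {q} p≋q = eval⇒≋ λ g →
    trans (eval-∂ i p g) (trans (≋⇒eval p≋q (∂ᵗ i g)) (sym (eval-∂ i q g)))

  ∂-++ : ∀ i p q → ∂ i (p ++ q) ≋ ∂ i p ++ ∂ i q
  ∂-++ i p q = eval⇒≋ λ g → begin
    eval (∂ i (p ++ q)) g                    ≈⟨ eval-∂ i (p ++ q) g ⟩
    eval (p ++ q) (∂ᵗ i g)                   ≈⟨ eval-++ p q _ ⟩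
    eval p (∂ᵗ i g) + eval q (∂ᵗ i g)        ≈⟨ +-cong (eval-∂ i p g) (eval-∂ i q g) ⟨
    eval (∂ i p) g + eval (∂ i q) g          ≈⟨ eval-++ (∂ i p) (∂ i q) g ⟨
    eval (∂ i p ++ ∂ i q) g                  ∎

  ∂ᵗ-⊕ : ∀ i g l m → ∂ᵗ i g (l ⊕ m) ≈ Vec.lookup l i · g ((l ⊖ i) ⊕ m) + Vec.lookup m i · g (l ⊕ (m ⊖ i))
  ∂ᵗ-⊕ i g l m = begin
    Vec.lookup (l ⊕ m) i · g ((l ⊕ m) ⊖ i)
      ≡⟨ ≡.cong (_· g ((l ⊕ m) ⊖ i)) (Vec.lookup-zipWith ℕ._+_ i l m) ⟩
    (Vec.lookup l i ℕ.+ Vec.lookup m i) · g ((l ⊕ m) ⊖ i)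
      ≈⟨ ×-homo-+ _ (Vec.lookup l i) (Vec.lookup m i) ⟩
    Vec.lookup l i · g ((l ⊕ m) ⊖ i) + Vec.lookup m i · g ((l ⊕ m) ⊖ i)              ≈⟨ +-cong
      (shift (Vec.lookup l i) λ eq → ⊖-⊕ˡ l m i eq) (shift (Vec.lookup m i) λ eq → ⊖-⊕ʳ l m i eq) ⟩
    Vec.lookup l i · g ((l ⊖ i) ⊕ m) + Vec.lookup m i · g (l ⊕ (m ⊖ i))              ∎
    where
    shift : ∀ k {u v} → (∀ {j} → k ≡ suc j → u ≡ v) → k · g u ≈ k · g v
    shift zero    u≡v = refl
    shift (suc k) u≡v = reflexive (≡.cong (λ u → suc k · g u) (u≡v ≡.refl))

  ∂-* : ∀ i p q → ∂ i (p *ₚ q) ≋ (∂ i p *ₚ q) ++ (p *ₚ ∂ i q)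
  ∂-* i p q = eval⇒≋ λ g → begin
    eval (∂ i (p *ₚ q)) g
      ≈⟨ trans (eval-∂ i (p *ₚ q) g) (eval-*ₚ p q _) ⟩
    eval p (λ l → eval q (λ m → ∂ᵗ i g (l ⊕ m)))
      ≈⟨ eval-cong p (λ l → trans (eval-cong q (∂ᵗ-⊕ i g l)) (eval-+ q _ _)) ⟩
    eval p (λ l → eval q (λ m → Vec.lookup l i · g ((l ⊖ i) ⊕ m)) + eval q (λ m → Vec.lookup m i · g (l ⊕ (m ⊖ i))))
      ≈⟨ eval-+ p _ _ ⟩
    eval p (λ l → eval q (λ m → Vec.lookup l i · g ((l ⊖ i) ⊕ m))) + eval p (λ l → eval q (λ m → Vec.lookup m i · g (l ⊕ (m ⊖ i))))
      ≈⟨ +-cong (eval-cong p λ l → eval-· q (Vec.lookup l i) _) (eval-cong p λ l → sym (eval-∂ i q _)) ⟩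
    eval p (∂ᵗ i (λ l → eval q (λ m → g (l ⊕ m)))) + eval p (λ l → eval (∂ i q) (λ m → g (l ⊕ m)))
      ≈⟨ +-cong (trans (eval-*ₚ (∂ i p) q g) (eval-∂ i p _)) (eval-*ₚ p (∂ i q) g) ⟨
    eval (∂ i p *ₚ q) g + eval (p *ₚ ∂ i q) g
      ≈⟨ eval-++ (∂ i p *ₚ q) (p *ₚ ∂ i q) g ⟨
    eval ((∂ i p *ₚ q) ++ (p *ₚ ∂ i q)) g ∎

  ∂-degree : ∀ i {d p} → HasDegrees (ℕ._≤ d) p → HasDegrees (ℕ._≤ ℕ.pred d) (∂ i p)
  ∂-degree i {d} (q , p≋q , low) = ∂ i q , ∂-cong i p≋q , terms q low
    where
    term : ∀ c m k → Vec.lookup m i ≡ k → deg m ℕ.≤ d → Terms (ℕ._≤ ℕ.pred d) (∂-term c m i k)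
    term c m zero    eq m≤d = []
    term c m (suc k) eq m≤d = subst (ℕ._≤ ℕ.pred d) (≡.sym (deg-⊖ m i eq)) (ℕ.pred-mono-≤ m≤d) ∷ []

    terms : ∀ q → Terms (ℕ._≤ d) q → Terms (ℕ._≤ ℕ.pred d) (∂ i q)
    terms [] [] = []
    terms ((c , m) ∷ q) (m≤d ∷ low) = All.++⁺ (term c m (Vec.lookup m i) ≡.refl m≤d) (terms q low)

  mono-⊕ : ∀ l m → mono l *ₚ mono m ≋ mono (l ⊕ m)
  mono-⊕ l m = eval⇒≋ λ g → +-congʳ (*-congʳ (*-identityˡ 1#))

  pure : Fin n → ℕ → Monomial n
  pure i k = replicate n 0 [ i ]≔ k

  private
    pure-0 : ∀ {n} (i : Fin n) → replicate n 0 [ i ]≔ 0 ≡ replicate n 0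
    pure-0 zero    = ≡.refl
    pure-0 (suc i) = ≡.cong (0 ∷_) (pure-0 i)

    pure-⊕ : ∀ {n} (i : Fin n) k l → (replicate n 0 [ i ]≔ k) ⊕ (replicate n 0 [ i ]≔ l) ≡ replicate n 0 [ i ]≔ (k ℕ.+ l)
    pure-⊕ zero    k l = ≡.cong (k ℕ.+ l ∷_) (⊕-identityˡ _)
    pure-⊕ (suc i) k l = ≡.cong (0 ∷_) (pure-⊕ i k l)

  open RawSemiringDefs (polyRawSemiring n) using (sum; _^_)

  var-^ : ∀ i d → var i ^ d ≋ mono (pure i d)
  var-^ i zero    = ≋-reflexive (≡.cong mono (≡.sym (pure-0 i)))
  var-^ i (suc d) = ≋-trans (*ₚ-cong (≋-refl {var i}) (var-^ i d))
    (≋-trans (mono-⊕ (pure i 1) (pure i d)) (≋-reflexive (≡.cong mono (pure-⊕ i 1 d))))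

  private
    sum-single : ∀ {k} (t : Fin k → Poly n) (i : Fin k) g → (∀ j → j ≢ i → eval (t j) g ≈ 0#) →
      eval (sum t) g ≈ eval (t i) g
    sum-zero : ∀ {k} (t : Fin k → Poly n) g → (∀ j → eval (t j) g ≈ 0#) → eval (sum t) g ≈ 0#
    sum-zero {zero}  t g t≈0 = refl
    sum-zero {suc k} t g t≈0 = trans (eval-++ (t zero) (sum (t ∘ suc)) g)
      (trans (+-cong (t≈0 zero) (sum-zero (t ∘ suc) g (t≈0 ∘ suc))) (+-identityˡ 0#))
    sum-single {suc k} t zero g other = trans (eval-++ (t zero) (sum (t ∘ suc)) g)
      (trans (+-congˡ (sum-zero (t ∘ suc) g λ j → other (suc j) λ ())) (+-identityʳ _))
    sum-single {suc k} t (suc i) g other = trans (eval-++ (t zero) (sum (t ∘ suc)) g)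
      (trans (+-cong (other zero λ ()) (sum-single (t ∘ suc) i g λ j j≢i → other (suc j) (j≢i ∘ Fin.suc-injective)))
        (+-identityˡ _))

  ∂-powerSum : ∀ i d → ∂ i (powerSum n d) ≋ (d · 1#) ·ₚ mono (pure i (ℕ.pred d))
  ∂-powerSum i d = eval⇒≋ λ g → begin
    eval (∂ i (powerSum n d)) g                     ≈⟨ eval-∂ i (powerSum n d) g ⟩
    eval (powerSum n d) (∂ᵗ i g)                    ≈⟨ sum-single (λ j → var j ^ d) i (∂ᵗ i g) (λ j j≢i →
                                                         trans (≋⇒eval (var-^ j d) (∂ᵗ i g)) (other g j j≢i)) ⟩
    eval (var i ^ d) (∂ᵗ i g)                       ≈⟨ ≋⇒eval (var-^ i d) (∂ᵗ i g) ⟩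
    eval (mono (pure i d)) (∂ᵗ i g)                 ≈⟨ trans (+-identityʳ _) (*-identityˡ _) ⟩
    Vec.lookup (pure i d) i · g (pure i d ⊖ i)
      ≡⟨ ≡.cong₂ (λ k m → k · g m) (Vec.lookup∘updateAt i (replicate n 0)) (Vec.updateAt-updateAt i (replicate n 0)) ⟩
    d · g (pure i (ℕ.pred d))                       ≈⟨ ×-congʳ d (*-identityˡ _) ⟨
    d · (1# * g (pure i (ℕ.pred d)))                ≈⟨ ×-assoc-* d 1# _ ⟨
    (d · 1#) * g (pure i (ℕ.pred d))                ≈⟨ *-congˡ (trans (+-identityʳ _) (*-identityˡ _)) ⟨
    (d · 1#) * eval (mono (pure i (ℕ.pred d))) g    ≈⟨ eval-·ₚ (d · 1#) (mono (pure i (ℕ.pred d))) g ⟨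
    eval ((d · 1#) ·ₚ mono (pure i (ℕ.pred d))) g   ∎
    where
    other : ∀ g j → j ≢ i → eval (mono (pure j d)) (∂ᵗ i g) ≈ 0#
    other g j j≢i = trans (+-identityʳ _) (trans (*-identityˡ _) (reflexive (≡.cong (_· g (pure j d ⊖ i))
      (≡.trans (Vec.lookup∘updateAt′ i j (j≢i ∘ ≡.sym) (replicate n 0)) (Vec.lookup-replicate i 0)))))

-- Linear recurrences over a commutative ring.

module MatrixSums {r ℓ} (R : CommutativeRing r ℓ) (s : ℕ) where

  open CommutativeRing R hiding (zero)
  open SemiringSum semiring
  open GroupProperties +-group using (∙-cancelʳ)
  open SetoidReasoning setoid

  assoc-sum : ∀ (x z : Fin s → Carrier) (y : Fin s → Fin s → Carrier) →
    ∑[ u < s ] (x u * ∑[ v < s ] (y u v * z v)) ≈ ∑[ v < s ] (∑[ u < s ] (x u * y u v) * z v)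
  assoc-sum x z y = begin
    ∑[ u < s ] (x u * ∑[ v < s ] (y u v * z v))
      ≈⟨ sum-cong-≋ (λ u → trans (*-distribˡ-sum (x u) (λ v → y u v * z v)) (sum-cong-≋ {n = s} λ v → sym (*-assoc _ _ _))) ⟩
    ∑[ u < s ] ∑[ v < s ] (x u * y u v * z v)      ≈⟨ ∑-comm (λ u v → x u * y u v * z v) ⟩
    ∑[ v < s ] ∑[ u < s ] (x u * y u v * z v)      ≈⟨ sum-cong-≋ (λ v → *-distribʳ-sum (z v) (λ u → x u * y u v)) ⟨
    ∑[ v < s ] (∑[ u < s ] (x u * y u v) * z v)    ∎

  sum-single : ∀ {k} (t : Fin k → Carrier) i → (∀ j → j ≢ i → t j ≈ 0#) → sum t ≈ t i
  sum-single {suc k} t zero others = trans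
    (+-congˡ (trans (sum-cong-≋ {n = k} λ j → others (suc j) λ ()) (sum-replicate-zero k))) (+-identityʳ _)
  sum-single {suc k} t (suc i) others = trans
    (+-cong (others zero λ ()) (sum-single (t ∘ suc) i λ j j≢i → others (suc j) (j≢i ∘ Fin.suc-injective)))
    (+-identityˡ _)

  sum-snoc : ∀ (f : ℕ → Carrier) k → f 0 + ∑[ i < k ] f (suc (toℕ i)) ≈ ∑[ i < k ] f (toℕ i) + f k
  sum-snoc f k = begin
    ∑[ i < suc k ] f (toℕ i)                          ≈⟨ sum-init-last (f ∘ toℕ {suc k}) ⟩
    ∑[ i < k ] f (toℕ (inject₁ i)) + f (toℕ (Fin.fromℕ k))
      ≡⟨ ≡.cong₂ _+_ (sum-cong-≗ {n = k} λ i → ≡.cong f (Fin.toℕ-inject₁ i)) (≡.cong f (Fin.toℕ-fromℕ k)) ⟩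
    ∑[ i < k ] f (toℕ i) + f k                        ∎

  -- dP = dP M + P dM and Q = c + M Q give dP c = P dM Q, both sides being
  -- dP Q - dP M Q.
  derivative-of-solution : ∀ (M dM : Fin s → Fin s → Carrier) (P dP Q c : Fin s → Carrier) →
    (∀ v → dP v ≈ ∑[ u < s ] (dP u * M u v) + ∑[ u < s ] (P u * dM u v)) →
    (∀ u → Q u ≈ c u + ∑[ v < s ] (M u v * Q v)) →
    ∑[ v < s ] (dP v * c v) ≈ ∑[ u < s ] (P u * ∑[ v < s ] (dM u v * Q v))
  derivative-of-solution M dM P dP Q c dP≈ Q≈ = ∙-cancelʳ (∑[ u < s ] (dP u * ∑[ v < s ] (M u v * Q v))) _ _ $ begin
    ∑[ v < s ] (dP v * c v) + ∑[ u < s ] (dP u * ∑[ v < s ] (M u v * Q v))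
      ≈⟨ ∑-distrib-+ (λ v → dP v * c v) _ ⟨
    ∑[ u < s ] (dP u * c u + dP u * ∑[ v < s ] (M u v * Q v))
      ≈⟨ sum-cong-≋ {n = s} (λ u → trans (*-congˡ (Q≈ u)) (distribˡ (dP u) _ _)) ⟨
    ∑[ u < s ] (dP u * Q u)
      ≈⟨ sum-cong-≋ {n = s} (λ v → trans (*-congʳ (dP≈ v)) (distribʳ (Q v) _ _)) ⟩
    ∑[ v < s ] (∑[ u < s ] (dP u * M u v) * Q v + ∑[ u < s ] (P u * dM u v) * Q v)
      ≈⟨ ∑-distrib-+ (λ v → ∑[ u < s ] (dP u * M u v) * Q v) _ ⟩
    ∑[ v < s ] (∑[ u < s ] (dP u * M u v) * Q v) + ∑[ v < s ] (∑[ u < s ] (P u * dM u v) * Q v)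
      ≈⟨ +-comm _ _ ⟩
    ∑[ v < s ] (∑[ u < s ] (P u * dM u v) * Q v) + ∑[ v < s ] (∑[ u < s ] (dP u * M u v) * Q v)
      ≈⟨ +-cong (assoc-sum P Q dM) (assoc-sum dP Q M) ⟨
    ∑[ u < s ] (P u * ∑[ v < s ] (dM u v * Q v)) + ∑[ u < s ] (dP u * ∑[ v < s ] (M u v * Q v)) ∎

-- Topological order of a finite acyclic graph.

sorted-vertices : ∀ {s} (h : Fin s → ℕ) → ∃[ vs ] vs ↭ allFin s ×
  (∀ {i j} → toℕ i ℕ.≤ toℕ j → h (lookup vs i) ℕ.≤ h (lookup vs j))
sorted-vertices {s} h = sort (allFin s) , sort-↭ (allFin s) ,
    λ {i} {j} → Sorted.lookup-mono-≤ (DecTotalOrder.totalOrder order) (sort-↗ (allFin s)) {i} {j}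
  where
  order = On.decTotalOrder ℕ.≤-decTotalOrder h
  open Sort order

module Acyclic {s} (_⟶_ : Fin s → Fin s → Set) (_⟶?_ : ∀ u v → Dec (u ⟶ v))
  (acyclic : ∀ v → ¬ TransClosure _⟶_ v v) where

  private
    wellFounded : WellFounded (TransClosure _⟶_)
    wellFounded = Fin.spo-wellFounded record
      { isEquivalence = isEquivalence
      ; irrefl = λ { ≡.refl → acyclic _ }
      ; trans = Plus._++_
      ; <-resp-≈ = (λ { ≡.refl x → x }) , (λ { ≡.refl x → x }) }

    open SemiringSum ℕ.+-*-semiring using (sum; sum-cong-≗)

    term≤sum : ∀ {k} (t : Fin k → ℕ) i → t i ℕ.≤ sum t
    term≤sum t zero    = ℕ.m≤m+n _ _
    term≤sum t (suc i) = ℕ.≤-trans (term≤sum (t ∘ suc) i) (ℕ.m≤n+m _ (t zero))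

    -- Any function that strictly increases along edges would do; a sum is convenient because it
    -- dominates each of its terms. The recursion runs on accessibility, which acyclicity grants on
    -- a finite set.
    height : ∀ v → Acc (TransClosure _⟶_) v → ℕ
    contribution : ∀ v → Acc (TransClosure _⟶_) v → ∀ u → Dec (u ⟶ v) → ℕ
    height v a = sum (λ u → contribution v a u (u ⟶? v))
    contribution v (acc rec) u (yes e) = suc (height u (rec Plus.[ e ]))
    contribution v (acc rec) u (no _)  = 0

    height-irrelevant : ∀ v a a′ → height v a ≡ height v a′
    height-irrelevant v (acc rec) (acc rec′) = sum-cong-≗ λ u → eq u (u ⟶? v)
      where
      eq : ∀ u d → contribution v (acc rec) u d ≡ contribution v (acc rec′) u d
      eq u (yes e) = ≡.cong suc (height-irrelevant u (rec Plus.[ e ]) (rec′ Plus.[ e ]))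
      eq u (no _)  = ≡.refl

    height-increases : ∀ {u v} → u ⟶ v → height u (wellFounded u) ℕ.< height v (wellFounded v)
    height-increases {u} {v} e = ℕ.≤-trans (lower (wellFounded v) (u ⟶? v))
      (term≤sum (λ u → contribution v (wellFounded v) u (u ⟶? v)) u)
      where
      lower : ∀ a d → suc (height u (wellFounded u)) ℕ.≤ contribution v a u d
      lower (acc rec) (yes e′) = ℕ.≤-reflexive (≡.cong suc (height-irrelevant u _ _))
      lower (acc rec) (no ¬e)  = contradiction e ¬e

  -- Heights may exceed `s`, so they are replaced by the positions in a list of the vertices sorted
  -- by height.
  rank-exists : ∃[ rank ] (∀ v → rank v ℕ.< s) × (∀ {u v} → u ⟶ v → rank u ℕ.< rank v)
  rank-exists with sorted-vertices (λ v → height v (wellFounded v))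
  ... | vs , vs↭ , sorted = rank , rank<s , increases
    where
    occurs : ∀ v → v ∈ vs
    occurs v = ∈-resp-↭ (↭-sym vs↭) (∈-allFin v)

    rank : Fin s → ℕ
    rank v = toℕ (Any.index (occurs v))

    rank<s : ∀ v → rank v ℕ.< s
    rank<s v = subst (rank v ℕ.<_) (≡.trans (↭-length vs↭) (List.length-tabulate (λ i → i))) (Fin.toℕ<n _)

    increases : ∀ {u v} → u ⟶ v → rank u ℕ.< rank v
    increases {u} {v} e = ℕ.≰⇒> λ v≤u → ℕ.<⇒≱ (height-increases e)
      (≡.subst₂ (λ x y → height x (wellFounded x) ℕ.≤ height y (wellFounded y))
        (≡.sym (lookup-index (occurs v))) (≡.sym (lookup-index (occurs u))) (sorted v≤u))

-- Path sums of a branching program and their derivatives.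

module PathSums {a ℓ₁ ℓ₂} (F : HeytingField a ℓ₁ ℓ₂) {n : ℕ} (A : OverField.ABP F n) where

  open OverField F
  open Coefficients F n
  open Full
  open Derivation F n
  open ABP A renaming (size to s) hiding (output)
  open CommutativeRing polyRing hiding (zero)
  open SemiringSum semiring
  open SetoidReasoning setoid hiding (start)
  open MatrixSums polyRing s
  open Acyclic _⟶_ (λ u v → T? (edge u v)) acyclic

  entry : ∀ u v → Dec (u ⟶ v) → Poly n
  entry u v (yes e) = label e
  entry u v (no _)  = []

  M : Fin s → Fin s → Poly n
  M u v = entry u v (T? (edge u v))

  total : List (Poly n) → Poly n
  total = foldr _++_ []

  -- The `k`-th power of the matrix `M`, in the form in which the output lists its paths.
  W : ℕ → Fin s → Fin s → Poly n
  W k u v = total (map weight (pathsOfLength k u v))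

  total-++ : ∀ ps qs → total (ps ++ qs) ≈ total ps + total qs
  total-++ []       qs = refl
  total-++ (p ∷ ps) qs = trans (+-congˡ (total-++ ps qs)) (sym (+-assoc p _ _))

  total-concatMap-tabulate : ∀ {ℓ k} {B : Set ℓ} (f : B → List (Poly n)) (g : Fin k → B) →
    total (concatMap f (tabulate g)) ≈ ∑[ i < k ] total (f (g i))
  total-concatMap-tabulate {k = zero}  f g = refl
  total-concatMap-tabulate {k = suc k} f g = trans (total-++ (f (g zero)) _)
    (+-congˡ (total-concatMap-tabulate f (g ∘ suc)))

  total-paths : ∀ {u v} (f : Fin s → List (Path u v)) (t : Fin s → Poly n) →
    (∀ w → total (map weight (f w)) ≈ t w) →
    total (map weight (concatMap f (allFin s))) ≈ sum t
  total-paths f t eq = begin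
    total (map weight (concatMap f (allFin s)))        ≡⟨ ≡.cong total (List.map-concatMap weight f (allFin s)) ⟩
    total (concatMap (map weight ∘ f) (allFin s))      ≈⟨ total-concatMap-tabulate (map weight ∘ f) (λ i → i) ⟩
    ∑[ w < s ] total (map weight (f w))                ≈⟨ sum-cong-≋ eq ⟩
    sum t                                              ∎

  total-◅ : ∀ {u w v} (e : u ⟶ w) (ps : List (Path w v)) →
    total (map weight (map (e ◅_) ps)) ≈ label e * total (map weight ps)
  total-◅ e []       = sym (zeroʳ (label e))
  total-◅ e (p ∷ ps) = trans (+-congˡ (total-◅ e ps)) (sym (distribˡ (label e) _ _))

  -- pathsVia is the local function of pathsOfLength, recovered by unification.
  mutual
    pathsVia : ∀ k u v → Fin s → List (Path u v)
    pathsVia k u v = _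

    W-suc : ∀ k u v → W (suc k) u v ≈ ∑[ w < s ] (M u w * W k w v)
    W-suc k u v = total-paths (pathsVia k u v) _ (total-pathsVia k u v)

    total-pathsVia : ∀ k u v w → total (map weight (pathsVia k u v w)) ≈ M u w * W k w v
    total-pathsVia k u v w with T? (edge u w)
    ... | yes e = total-◅ e (pathsOfLength k w v)
    ... | no _  = refl

  W₀-refl : ∀ v → W 0 v v ≈ 1#
  W₀-refl v with v Fin.≟ v
  ... | yes ≡.refl = +-identityʳ 1#
  ... | no v≢v = contradiction ≡.refl v≢v

  W₀-≢ : ∀ {u v} → u ≢ v → W 0 u v ≈ 0#
  W₀-≢ {u} {v} u≢v with u Fin.≟ v
  ... | yes ≡.refl = contradiction ≡.refl u≢v
  ... | no _ = refl

  W₀-sumˡ : ∀ u (x : Fin s → Poly n) → ∑[ w < s ] (W 0 u w * x w) ≈ x u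
  W₀-sumˡ u x = trans
    (sum-single (λ w → W 0 u w * x w) u λ w w≢u → trans (*-congʳ {x w} (W₀-≢ {u} {w} (w≢u ∘ ≡.sym))) (zeroˡ (x w)))
    (trans (*-congʳ {x u} (W₀-refl u)) (*-identityˡ (x u)))

  W₀-sumʳ : ∀ v (x : Fin s → Poly n) → ∑[ w < s ] (x w * W 0 w v) ≈ x v
  W₀-sumʳ v x = trans
    (sum-single (λ w → x w * W 0 w v) v λ w w≢v → trans (*-congˡ {x w} (W₀-≢ {w} {v} w≢v)) (zeroʳ (x w)))
    (trans (*-congˡ {x v} (W₀-refl v)) (*-identityʳ (x v)))

  -- Paths are listed by their first edge, whereas the recurrence for `P` splits off the last one;
  -- associativity of the matrix product mediates.
  W-sucʳ : ∀ k u v → W (suc k) u v ≈ ∑[ w < s ] (W k u w * M w v)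
  W-sucʳ zero u v = begin
    W 1 u v                           ≈⟨ W-suc 0 u v ⟩
    ∑[ w < s ] (M u w * W 0 w v)      ≈⟨ W₀-sumʳ v (M u) ⟩
    M u v                             ≈⟨ W₀-sumˡ u (λ w → M w v) ⟨
    ∑[ w < s ] (W 0 u w * M w v)      ∎
  W-sucʳ (suc k) u v = begin
    W (suc (suc k)) u v                                        ≈⟨ W-suc (suc k) u v ⟩
    ∑[ w < s ] (M u w * W (suc k) w v)
      ≈⟨ sum-cong-≋ {n = s} (λ w → *-congˡ {M u w} (W-sucʳ k w v)) ⟩
    ∑[ w < s ] (M u w * ∑[ x < s ] (W k w x * M x v))          ≈⟨ assoc-sum (M u) (λ x → M x v) (W k) ⟩
    ∑[ x < s ] (∑[ w < s ] (M u w * W k w x) * M x v)          ≈⟨ sum-cong-≋ {n = s} (λ x → *-congʳ {M x v} (W-suc k u x)) ⟨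
    ∑[ x < s ] (W (suc k) u x * M x v)                         ∎

  rank : Fin s → ℕ
  rank = proj₁ rank-exists

  rank<s : ∀ v → rank v ℕ.< s
  rank<s = proj₁ (proj₂ rank-exists)

  rank-increases : ∀ {u v} → u ⟶ v → rank u ℕ.< rank v
  rank-increases = proj₂ (proj₂ rank-exists)

  -- Every edge raises the rank, so a path of length `k` from `u` ends at rank at least
  -- `k + rank u`.
  W-vanishes : ∀ k {u v} → rank v ℕ.< k ℕ.+ rank u → W k u v ≈ 0#
  W-vanishes zero {u} {v} v<u = W₀-≢ {u} {v} λ { ≡.refl → ℕ.<-irrefl ≡.refl v<u }
  W-vanishes (suc k) {u} {v} v<1+k+u = trans (W-suc k u v)
    (trans (sum-cong-≋ {n = s} λ w → term w (T? (edge u w))) (sum-replicate-zero s))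
    where
    term : ∀ w (d : Dec (u ⟶ w)) → entry u w d * W k w v ≈ 0#
    term w (yes e) = trans (*-congˡ {label e} (W-vanishes k {w} {v} (ℕ.<-≤-trans v<1+k+u
      (subst (ℕ._≤ k ℕ.+ rank w) (ℕ.+-suc k (rank u)) (ℕ.+-monoʳ-≤ k (rank-increases e)))))) (zeroʳ (label e))
    term w (no _) = refl

  W-size : ∀ u v → W s u v ≈ 0#
  W-size u v = W-vanishes s (ℕ.<-≤-trans (rank<s v) (ℕ.m≤m+n s (rank u)))

  P Q : Fin s → Poly n
  P v = ∑[ k < s ] W (toℕ k) start v
  Q u = ∑[ k < s ] W (toℕ k) u end

  -- As the power `s` of `M` vanishes, the geometric series cut off at `s` inverts 1 - M. The two
  -- recurrences below express this from the right and from the left.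
  sum-W : ∀ u v → ∑[ k < s ] W (toℕ k) u v ≈ W 0 u v + ∑[ k < s ] W (suc (toℕ k)) u v
  sum-W u v = trans (sym (trans (+-congˡ (W-size u v)) (+-identityʳ _))) (sym (sum-snoc (λ k → W k u v) s))

  P-recurrence : ∀ v → P v ≈ W 0 start v + ∑[ u < s ] (P u * M u v)
  P-recurrence v = trans (sum-W start v) $ +-congˡ {W 0 start v} $ begin
    ∑[ k < s ] W (suc (toℕ k)) start v                        ≈⟨ sum-cong-≋ {n = s} (λ k → W-sucʳ (toℕ k) start v) ⟩
    ∑[ k < s ] ∑[ u < s ] (W (toℕ k) start u * M u v)
      ≈⟨ ∑-comm {s} {s} (λ k u → W (toℕ k) start u * M u v) ⟩
    ∑[ u < s ] ∑[ k < s ] (W (toℕ k) start u * M u v)         ≈⟨ sum-cong-≋ {n = s} (λ u → *-distribʳ-sum {s} (M u v) (λ k → W (toℕ k) start u)) ⟨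
    ∑[ u < s ] (P u * M u v)                                  ∎

  Q-recurrence : ∀ u → Q u ≈ W 0 u end + ∑[ v < s ] (M u v * Q v)
  Q-recurrence u = trans (sum-W u end) $ +-congˡ {W 0 u end} $ begin
    ∑[ k < s ] W (suc (toℕ k)) u end                          ≈⟨ sum-cong-≋ {n = s} (λ k → W-suc (toℕ k) u end) ⟩
    ∑[ k < s ] ∑[ v < s ] (M u v * W (toℕ k) v end)           ≈⟨ ∑-comm {s} {s} (λ k v → M u v * W (toℕ k) v end) ⟩
    ∑[ v < s ] ∑[ k < s ] (M u v * W (toℕ k) v end)           ≈⟨ sum-cong-≋ {n = s} (λ v → *-distribˡ-sum {s} (M u v) (λ k → W (toℕ k) v end)) ⟨
    ∑[ v < s ] (M u v * Q v)                                  ∎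

  total-concatMap-applyUpTo : ∀ {ℓ} {B : Set ℓ} (f : B → List (Poly n)) (g : ℕ → B) k →
    total (concatMap f (applyUpTo g k)) ≈ ∑[ i < k ] total (f (g (toℕ i)))
  total-concatMap-applyUpTo f g zero    = refl
  total-concatMap-applyUpTo f g (suc k) = trans (total-++ (f (g 0)) _)
    (+-congˡ (total-concatMap-applyUpTo f (g ∘ suc) k))

  output≈P : output A ≈ P end
  output≈P = begin
    total (map weight (paths start end))
      ≡⟨ ≡.cong total (List.map-concatMap weight (λ k → pathsOfLength k start end) (upTo s)) ⟩
    total (concatMap (λ k → map weight (pathsOfLength k start end)) (upTo s))
      ≈⟨ total-concatMap-applyUpTo (λ k → map weight (pathsOfLength k start end)) (λ k → k) s ⟩
    P end                                                                          ∎

  ∂-sum : ∀ i {k} (t : Fin k → Poly n) → ∂ i (sum t) ≈ ∑[ j < k ] ∂ i (t j)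
  ∂-sum i {zero}  t = refl
  ∂-sum i {suc k} t = trans (∂-++ i (t zero) (sum (t ∘ suc))) (+-congˡ (∂-sum i (t ∘ suc)))

  ∂-1 : ∀ i → ∂ i 1# ≈ 0#
  ∂-1 i = ≋-reflexive (≡.cong (λ k → ∂-term _ _ i k ++ []) (Vec.lookup-replicate i 0))

  ∂-W₀ : ∀ i u v → ∂ i (W 0 u v) ≈ 0#
  ∂-W₀ i u v with u Fin.≟ v
  ... | yes ≡.refl = trans (∂-cong i (+-identityʳ 1#)) (∂-1 i)
  ... | no _ = refl

  ∂-P : ∀ i v → ∂ i (P v) ≈ ∑[ u < s ] (∂ i (P u) * M u v) + ∑[ u < s ] (P u * ∂ i (M u v))
  ∂-P i v = begin
    ∂ i (P v)
      ≈⟨ ∂-cong i (P-recurrence v) ⟩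
    ∂ i (W 0 start v + ∑[ u < s ] (P u * M u v))
      ≈⟨ ∂-++ i (W 0 start v) _ ⟩
    ∂ i (W 0 start v) + ∂ i (∑[ u < s ] (P u * M u v))
      ≈⟨ trans (+-congʳ (∂-W₀ i start v)) (+-identityˡ _) ⟩
    ∂ i (∑[ u < s ] (P u * M u v))
      ≈⟨ trans (∂-sum i (λ u → P u * M u v)) (sum-cong-≋ {n = s} λ u → ∂-* i (P u) (M u v)) ⟩
    ∑[ u < s ] (∂ i (P u) * M u v + P u * ∂ i (M u v))
      ≈⟨ ∑-distrib-+ (λ u → ∂ i (P u) * M u v) _ ⟩
    ∑[ u < s ] (∂ i (P u) * M u v) + ∑[ u < s ] (P u * ∂ i (M u v)) ∎

  -- The function `λ u → W 0 u end` is the indicator of `end`; as the constant term `c` of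
  -- `derivative-of-solution` it singles out the derivative of `P end`.
  ∂-output : ∀ i → ∂ i (output A) ≈ ∑[ u < s ] (P u * ∑[ v < s ] (∂ i (M u v) * Q v))
  ∂-output i = begin
    ∂ i (output A)                                             ≈⟨ ∂-cong i output≈P ⟩
    ∂ i (P end)                                                ≈⟨ W₀-sumʳ end (λ v → ∂ i (P v)) ⟨
    ∑[ v < s ] (∂ i (P v) * W 0 v end)
      ≈⟨ derivative-of-solution M (λ u v → ∂ i (M u v)) P (λ v → ∂ i (P v)) Q (λ u → W 0 u end) (∂-P i) Q-recurrence ⟩
    ∑[ u < s ] (P u * ∑[ v < s ] (∂ i (M u v) * Q v))          ∎

-- Counting exponent vectors.

unique-lookup-injective : ∀ {a} {A : Set a} {xs : List A} → Unique xs →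
  ∀ {i j} → lookup xs i ≡ lookup xs j → i ≡ j
unique-lookup-injective (x∉ ∷ u) {zero}  {zero}  eq = ≡.refl
unique-lookup-injective (x∉ ∷ u) {zero}  {suc j} eq = contradiction eq (All.lookup x∉ (∈-lookup j))
unique-lookup-injective (x∉ ∷ u) {suc i} {zero}  eq = contradiction (≡.sym eq) (All.lookup x∉ (∈-lookup i))
unique-lookup-injective (x∉ ∷ u) {suc i} {suc j} eq = ≡.cong suc (unique-lookup-injective u eq)

length-cartesianProductWith : ∀ {a b c} {A : Set a} {B : Set b} {C : Set c} (f : A → B → C) xs ys →
  length (cartesianProductWith f xs ys) ≡ length xs ℕ.* length ys
length-cartesianProductWith f []       ys = ≡.refl
length-cartesianProductWith f (x ∷ xs) ys = ≡.trans (List.length-++ (map (f x) ys))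
  (≡.cong₂ ℕ._+_ (List.length-map (f x) ys) (length-cartesianProductWith f xs ys))

box : ∀ k n → List (Vec (Fin k) n)
box k zero    = [] ∷ []
box k (suc n) = cartesianProductWith _∷_ (allFin k) (box k n)

length-box : ∀ k n → length (box k n) ≡ k ℕ.^ n
length-box k zero    = ≡.refl
length-box k (suc n) = ≡.trans (length-cartesianProductWith _∷_ (allFin k) (box k n))
  (≡.cong₂ ℕ._*_ (List.length-tabulate {n = k} (λ i → i)) (length-box k n))

box-unique : ∀ k n → Unique (box k n)
box-unique k zero    = [] ∷ []
box-unique k (suc n) = Unique.cartesianProductWith⁺ _∷_ Vec.∷-injective (Unique.allFin⁺ k) (box-unique k n)

∈-box : ∀ {k n} (v : Vec (Fin k) n) → v ∈ box k n
∈-box []      = here ≡.refl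
∈-box (i ∷ v) = ∈-cartesianProductWith⁺ _∷_ (∈-allFin i) (∈-box v)

map-toℕ-injective : ∀ {k n} {v w : Vec (Fin k) n} → Vec.map toℕ v ≡ Vec.map toℕ w → v ≡ w
map-toℕ-injective {v = []}    {[]}    _  = ≡.refl
map-toℕ-injective {v = i ∷ v} {j ∷ w} eq with Vec.∷-injective eq
... | i≡j , v≡w = ≡.cong₂ _∷_ (Fin.toℕ-injective i≡j) (map-toℕ-injective v≡w)

simplex : ∀ β n → List (Vec ℕ n)
simplex β n = filter (λ m → deg m ℕ.≤? β) (map (Vec.map toℕ) (box (suc β) n))

simplex-unique : ∀ β n → Unique (simplex β n)
simplex-unique β n = Unique.filter⁺ (λ m → deg m ℕ.≤? β)
  (Unique.map⁺ map-toℕ-injective (box-unique (suc β) n))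

∈-simplex⁻ : ∀ {β n m} → m ∈ simplex β n → deg m ℕ.≤ β
∈-simplex⁻ {β} {n} = proj₂ ∘ ∈-filter⁻ (λ m → deg m ℕ.≤? β) {xs = map (Vec.map toℕ) (box (suc β) n)}

to-box : ∀ {β n} (m : Vec ℕ n) → deg m ℕ.≤ β → ∃[ v ] m ≡ Vec.map toℕ v × v ∈ box (suc β) n
to-box []      _ = [] , ≡.refl , here ≡.refl
to-box {β} (i ∷ m) le with to-box m (ℕ.m+n≤o⇒n≤o i le)
... | v , m≡ , _ = fromℕ< i<1+β ∷ v , ≡.cong₂ _∷_ (≡.sym (Fin.toℕ-fromℕ< i<1+β)) m≡ , ∈-box (fromℕ< i<1+β ∷ v)
  where
  i<1+β : i ℕ.< suc β
  i<1+β = s≤s (ℕ.m+n≤o⇒m≤o i le)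

∈-simplex⁺ : ∀ {β n} m → deg m ℕ.≤ β → m ∈ simplex β n
∈-simplex⁺ {β} m m≤β with to-box m m≤β
... | v , m≡ , v∈ = ∈-filter⁺ (λ m → deg m ℕ.≤? β)
  (subst (_∈ map (Vec.map toℕ) (box (suc β) _)) (≡.sym m≡) (∈-map⁺ (Vec.map toℕ) v∈)) m≤β

-- Division by `k` with remainder in every coordinate, read backwards: the first argument holds the
-- remainders, the second the quotients.
digits : ∀ {k n} → Vec (Fin k) n → Vec ℕ n → Vec ℕ n
digits {k} = zipWith λ i j → toℕ i ℕ.+ j ℕ.* k

private
  digit-injective : ∀ {k} {i i′ : Fin k} {j j′} →
    toℕ i ℕ.+ j ℕ.* k ≡ toℕ i′ ℕ.+ j′ ℕ.* k → i ≡ i′ × j ≡ j′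
  digit-injective {suc k} {i} {i′} {j} {j′} eq = Fin.toℕ-injective i≡i′ , ℕ.*-cancelʳ-≡ j j′ (suc k)
      (ℕ.+-cancelˡ-≡ (toℕ i) _ _ (≡.trans eq (≡.cong (ℕ._+ j′ ℕ.* suc k) (≡.sym i≡i′))))
    where
    low : ∀ (i : Fin (suc k)) j → (toℕ i ℕ.+ j ℕ.* suc k) % suc k ≡ toℕ i
    low i j = ≡.trans (ℕ.[m+kn]%n≡m%n (toℕ i) j (suc k)) (ℕ.m<n⇒m%n≡m (Fin.toℕ<n i))
    i≡i′ : toℕ i ≡ toℕ i′
    i≡i′ = ≡.trans (≡.sym (low i j)) (≡.trans (≡.cong (_% suc k) eq) (low i′ j′))

digits-injective : ∀ {k n} {v v′ : Vec (Fin k) n} {m m′} → digits v m ≡ digits v′ m′ → v ≡ v′ × m ≡ m′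
digits-injective {v = []}    {[]}     {[]}    {[]}     eq = ≡.refl , ≡.refl
digits-injective {v = i ∷ v} {i′ ∷ v′} {j ∷ m} {j′ ∷ m′} eq
  with Vec.∷-injective eq
... | eq₁ , eq₂ with digit-injective {i = i} {i′} {j} {j′} eq₁ | digits-injective {v = v} {v′} eq₂
...   | ≡.refl , ≡.refl | ≡.refl , ≡.refl = ≡.refl , ≡.refl

digits-⊕ : ∀ {k n} (v : Vec (Fin k) n) m → digits v m ≡ Vec.map toℕ v ⊕ Vec.map (ℕ._* k) m
digits-⊕ []      []      = ≡.refl
digits-⊕ {k} (i ∷ v) (j ∷ m) = ≡.cong (toℕ i ℕ.+ j ℕ.* k ∷_) (digits-⊕ v m)

-- The exponents whose quotients by k have sum at most β.
grid : ∀ k β n → List (Vec ℕ n)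
grid k β n = cartesianProductWith digits (box k n) (simplex β n)

-- The length of the simplex is never computed: both counts in `bezout` contain it for the same `β`,
-- and it cancels.
length-grid : ∀ k β n → length (grid k β n) ≡ k ℕ.^ n ℕ.* length (simplex β n)
length-grid k β n = ≡.trans (length-cartesianProductWith digits (box k n) (simplex β n))
  (≡.cong (ℕ._* length (simplex β n)) (length-box k n))

grid-unique : ∀ k β n → Unique (grid k β n)
grid-unique k β n = Unique.cartesianProductWith⁺ digits digits-injective (box-unique k n) (simplex-unique β n)

-- Rounding each exponent down to a multiple of `k` does not increase the degree, so the quotients
-- have sum at most `β`.
∈-grid : ∀ k .{{_ : NonZero k}} {β n} (m : Vec ℕ n) → deg m ℕ.≤ β ℕ.* k → m ∈ grid k β n
∈-grid k {β} {n} m m≤ = subst (_∈ grid k β n) (digits-divMod m)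
  (∈-cartesianProductWith⁺ digits (∈-box (Vec.map (ℕ._mod k) m))
    (∈-simplex⁺ (Vec.map (_/ k) m) (ℕ.*-cancelʳ-≤ _ _ k (ℕ.≤-trans (deg-/ m) m≤))))
  where
  digits-divMod : ∀ {n} (m : Vec ℕ n) → digits (Vec.map (ℕ._mod k) m) (Vec.map (_/ k) m) ≡ m
  digits-divMod []      = ≡.refl
  digits-divMod (i ∷ m) = ≡.cong₂ _∷_
    (≡.trans (≡.cong (ℕ._+ i / k ℕ.* k) (Fin.toℕ-fromℕ< (ℕ.m%n<n i k))) (≡.sym (ℕ.m≡m%n+[m/n]*n i k)))
    (digits-divMod m)

  deg-/ : ∀ {n} (m : Vec ℕ n) → deg (Vec.map (_/ k) m) ℕ.* k ℕ.≤ deg m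
  deg-/ []      = z≤n
  deg-/ (i ∷ m) = subst (ℕ._≤ i ℕ.+ deg m) (≡.sym (ℕ.*-distribʳ-+ k (i / k) (deg (Vec.map (_/ k) m))))
    (ℕ.+-mono-≤ (ℕ.m/n*n≤m i k) (deg-/ m))

deg-toℕ : ∀ {k n} (v : Vec (Fin k) n) → deg (Vec.map toℕ v) ℕ.≤ n ℕ.* ℕ.pred k
deg-toℕ []            = z≤n
deg-toℕ {suc k} (i ∷ v) = ℕ.+-mono-≤ (ℕ.≤-pred (Fin.toℕ<n i)) (deg-toℕ v)

-- Linear independence of monomials.

module MonomialCount {a ℓ₁ ℓ₂} (F : HeytingField a ℓ₁ ℓ₂) (n : ℕ)
  (D : Vec ℕ n → Set) (D-closed : ∀ l m → D (l ⊕ m) → D l) where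

  open HeytingField F hiding (zero)
  open OverField F
  open Evaluation F n
  open Coefficients F n using (mono; δ; δ-refl; δ-≢)
  open PolynomialRing F n D D-closed
  open LinearAlgebra F polyModule
  open Subspace

  -- The flag consists of the vectors of the span whose coefficients at `es` vanish from position
  -- `t` on; the monomial at position `t` separates consecutive levels. As `es` lies in `D`, these
  -- coefficients are well defined in the quotient.
  monomials-bound : ∀ es ws → Unique es → (∀ {e} → e ∈ es → D e) →
    (∀ {e} → e ∈ es → Span ws (mono e)) → length es ℕ.≤ length ws
  monomials-bound es ws unique es⊆D spanned =
    strict-flag-length A A-subspace (λ s≤t (s , z) → s , λ i t≤i → z i (ℕ.≤-trans s≤t t≤i))
      (length es) ws proj₁ strict
    where
    A : ℕ → Poly n → Set _
    A t v = Span ws v × (∀ i → t ℕ.≤ toℕ i → eval v (δ (lookup es i)) ≈ 0#)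

    supported : ∀ i → Supported (δ (lookup es i))
    supported i m ¬Dm = δ-≢ {m} {lookup es i} λ { ≡.refl → ¬Dm (es⊆D (∈-lookup i)) }

    A-subspace : ∀ t → Subspace (A t)
    A-subspace t .resp eq (s , z) = span-subspace ws .resp eq s ,
      λ i t≤i → trans (sym (eval≈ eq _ (supported i))) (z i t≤i)
    A-subspace t .zero∈ = span-subspace ws .zero∈ , λ _ _ → refl
    A-subspace t .plus∈ {u} {v} (s , z) (s′ , z′) = span-subspace ws .plus∈ s s′ ,
      λ i t≤i → trans (eval-++ u v _) (trans (+-cong (z i t≤i) (z′ i t≤i)) (+-identityˡ 0#))
    A-subspace t .scale∈ c {v} (s , z) = span-subspace ws .scale∈ c s ,
      λ i t≤i → trans (eval-·ₚ c v _) (trans (*-congˡ (z i t≤i)) (zeroʳ c))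

    1≉0 : ¬ 1# ≈ 0#
    1≉0 1≈0 = proj₂ (tight 1# 0#) 1≈0 (invertible⇒# (1# , trans (*-identityˡ _) 1-0 , trans (*-identityʳ _) 1-0))
      where
      1-0 : 1# - 0# ≈ 1#
      1-0 = trans (+-congˡ (-‿cong (sym 1≈0))) (trans (-‿inverseʳ 1#) (sym 1≈0))

    eval-mono : ∀ m g → eval (mono m) g ≈ g m
    eval-mono m g = trans (+-identityʳ _) (*-identityˡ _)

    strict : ∀ {t} → t ℕ.< length es → ∃[ v ] A (suc t) v × ¬ A t v
    strict {t} t<M = mono (lookup es i) ,
      (spanned (∈-lookup i) , λ j t<j → trans (eval-mono (lookup es i) (δ (lookup es j))) (δ-≢ {lookup es i} {lookup es j} λ eq →
        ℕ.<-irrefl ≡.refl (subst (t ℕ.<_) (≡.trans (≡.cong toℕ (≡.sym (unique-lookup-injective unique eq))) (Fin.toℕ-fromℕ< t<M)) t<j))) ,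
      λ (_ , z) → 1≉0 (trans (sym (δ-refl (lookup es i))) (trans (sym (eval-mono (lookup es i) (δ (lookup es i))))
        (z i (ℕ.≤-reflexive (≡.sym (Fin.toℕ-fromℕ< t<M))))))
      where i = fromℕ< t<M

-- `Ψ` records a cost and an exponent vector, both additive. It is kept general so that the
-- recursion can pass to the tail with a leading zero put back.
scaled-vector-induction : ∀ {ℓ n} (Ψ : ℕ → Vec ℕ n → Set ℓ) → Ψ 0 (replicate n 0) →
  (∀ {s t l m} → Ψ s l → Ψ t m → Ψ (s ℕ.+ t) (l ⊕ m)) →
  ∀ {c k} → (∀ i → Ψ c (replicate n 0 [ i ]≔ k)) →
  ∀ b → Ψ (deg b ℕ.* c) (Vec.map (ℕ._* k) b)
scaled-vector-induction Ψ Ψ0 add single [] = Ψ0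
scaled-vector-induction {n = suc n} Ψ Ψ0 add {c} {k} single (j ∷ b) =
  ≡.subst₂ Ψ (≡.sym (ℕ.*-distribʳ-+ c j (deg b)))
    (≡.cong₂ _∷_ (ℕ.+-identityʳ (j ℕ.* k)) (⊕-identityˡ _))
    (add (multiple j) (scaled-vector-induction (λ t m → Ψ t (0 ∷ m)) Ψ0 add (single ∘ suc) b))
  where
  multiple : ∀ j → Ψ (j ℕ.* c) (j ℕ.* k ∷ replicate n 0)
  multiple zero    = Ψ0
  multiple (suc j) = subst (Ψ (suc j ℕ.* c)) (≡.cong (suc j ℕ.* k ∷_) (⊕-identityˡ _)) (add (single zero) (multiple j))

-- Filtrations of the polynomial ring.

module Filtrations {a ℓ₁ ℓ₂} (F : HeytingField a ℓ₁ ℓ₂) (n : ℕ) where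

  open OverField F
  open Evaluation F n
  open Coefficients F n renaming (mono to monomial)
  open Full
  open LinearAlgebra F polyModule
  open Adjunction F polyModule
  open Subspace
  open Filtration
  private
    module R = CommutativeRing polyRing
  open R using (_*_)
  open SemiringSum R.semiring using (sum)

  multiplication-linear : ∀ z → Linear (z *_)
  multiplication-linear z = record
    { L-cong = R.*-congˡ {z}
    ; L-zero = R.zeroʳ z
    ; L-plus = R.distribˡ z
    ; L-scale = λ c → *ₚ-·ₚ c z
    }

  -- The working meaning of lying in level `d`. Levels are not assumed to be compatible with
  -- products, so the condition is put on the action of `z` on all levels.
  Tame : Filtration → ℕ → Poly n → Set (a ⊔ ℓ₁)
  Tame 𝓐 d z = ∀ {t v} → Level≤ 𝓐 t v → Level≤ 𝓐 (d ℕ.+ t) (z * v)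

  module _ (𝓐 : Filtration) where

    tame-resp : ∀ {d z z′} → z ≋ z′ → Tame 𝓐 d z → Tame 𝓐 d z′
    tame-resp {d} {z} {z′} eq tame {t} {v} x = subspace 𝓐 _ .resp (R.*-congʳ {v} {z} {z′} eq) (tame x)

    tame-0 : ∀ {d} → Tame 𝓐 d []
    tame-0 x = subspace 𝓐 _ .zero∈

    tame-+ : ∀ {d z z′} → Tame 𝓐 d z → Tame 𝓐 d z′ → Tame 𝓐 d (z ++ z′)
    tame-+ {z = z} {z′} tame tame′ {v = v} x =
      subspace 𝓐 _ .resp (≋-sym (R.distribʳ v z z′)) (subspace 𝓐 _ .plus∈ (tame x) (tame′ x))

    tame-· : ∀ c {d z} → Tame 𝓐 d z → Tame 𝓐 d (c ·ₚ z)
    tame-· c {z = z} tame {v = v} x =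
      subspace 𝓐 _ .resp (≋-sym (·ₚ-*ₚ c z v)) (subspace 𝓐 _ .scale∈ c (tame x))

    tame-* : ∀ {d e z z′} → Tame 𝓐 d z → Tame 𝓐 e z′ → Tame 𝓐 (d ℕ.+ e) (z * z′)
    tame-* {d} {e} {z} {z′} tame tame′ {t} {v} x = subst (λ j → Level≤ 𝓐 j (z * z′ * v)) (≡.sym (ℕ.+-assoc d e t))
      (subspace 𝓐 _ .resp (≋-sym (R.*-assoc z z′ v)) (tame (tame′ x)))

    tame-weaken : ∀ {d e z} → d ℕ.≤ e → Tame 𝓐 d z → Tame 𝓐 e z
    tame-weaken d≤e tame {t} x = mono 𝓐 (ℕ.+-monoˡ-≤ t d≤e) (tame x)

    tame-sum : ∀ {d k} (z : Fin k → Poly n) → (∀ i → Tame 𝓐 d (z i)) → Tame 𝓐 d (sum z)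
    tame-sum {k = zero}  z tame = tame-0
    tame-sum {k = suc k} z tame = tame-+ {z = z zero} (tame zero) (tame-sum (z ∘ suc) (tame ∘ suc))

  -- Inclusion of the levels does not imply that tame polynomials stay tame, yet everything adjoined
  -- so far must survive later adjunctions.
  record _⊑_ (𝓐 𝓑 : Filtration) : Set (a ⊔ ℓ₁) where
    field
      ⊑-level : ∀ {t v} → Level≤ 𝓐 t v → Level≤ 𝓑 t v
      ⊑-tame  : ∀ {z} → Tame 𝓐 1 z → Tame 𝓑 1 z
  open _⊑_ public

  ⊑-refl : ∀ {𝓐} → 𝓐 ⊑ 𝓐
  ⊑-refl = record { ⊑-level = id ; ⊑-tame = λ tame → tame }

  ⊑-trans : ∀ {𝓐 𝓑 𝓒} → 𝓐 ⊑ 𝓑 → 𝓑 ⊑ 𝓒 → 𝓐 ⊑ 𝓒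
  ⊑-trans p q = record { ⊑-level = ⊑-level q ∘ ⊑-level p ; ⊑-tame = λ {z} tame → ⊑-tame q {z} (⊑-tame p {z} tame) }

  Spanned : Filtration → ℕ → ℕ → Set (a ⊔ ℓ₁)
  Spanned 𝓐 T N = ∃[ ws ] length ws ℕ.≤ N × (∀ {v} → Level≤ 𝓐 T v → Span ws v)

  adjoin-one : ∀ 𝓐 z {T N} → Tame 𝓐 2 z → Spanned 𝓐 T N →
    ¬ ¬ (∃[ 𝓑 ] 𝓐 ⊑ 𝓑 × Tame 𝓑 1 z × Spanned 𝓑 T (2 ℕ.* N))
  adjoin-one 𝓐 z {T} {N} tame (ws , len , spans) k =
    adjoin-span 𝓐 (multiplication-linear z) tame T ws spans λ (us , len′ , spans′) →
      k (adjoin 𝓐 (multiplication-linear z) , 𝓐⊑ , apply , us , ℕ.≤-trans len′ (ℕ.*-monoʳ-≤ 2 len) , spans′)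
    where
    𝓐⊑ : 𝓐 ⊑ adjoin 𝓐 (multiplication-linear z)
    𝓐⊑ .⊑-level = incl
    𝓐⊑ .⊑-tame {y} tame-y = adjoin-map 𝓐 (multiplication-linear z) 1 (multiplication-linear y)
      (λ v → R.trans (R.sym (R.*-assoc y z v)) (R.trans (R.*-congʳ {v} (R.*-comm y z)) (R.*-assoc z y v)))
      (λ x → incl (tame-y x))

  module _ {s} (f : Fin s → Poly n) (h : Fin s → ℕ) (𝓐₀ : Filtration)
    (raises : ∀ 𝓑 → 𝓐₀ ⊑ 𝓑 → ∀ v → (∀ u → h u ℕ.< h v → Tame 𝓑 1 (f u)) → Tame 𝓑 2 (f v)) where

    private
      -- Invariant: each vertex is still in the list or already tame. By sortedness a vertex with
      -- smaller `h` than the head cannot be in the list, so it is tame, as `raises` demands.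
      adjoin-list : ∀ vs → (∀ {i j} → toℕ i ℕ.≤ toℕ j → h (lookup vs i) ℕ.≤ h (lookup vs j)) →
        ∀ 𝓐 {T N} → 𝓐₀ ⊑ 𝓐 → (∀ u → u ∈ vs ⊎ Tame 𝓐 1 (f u)) → Spanned 𝓐 T N →
        ¬ ¬ (∃[ 𝓑 ] 𝓐₀ ⊑ 𝓑 × (∀ u → Tame 𝓑 1 (f u)) × Spanned 𝓑 T (2 ℕ.^ length vs ℕ.* N))
      adjoin-list [] sorted 𝓐 {T} {N} ext done spanned k =
        k (𝓐 , ext , (λ u → [ (λ ()) , (λ tame → tame) ]′ (done u)) ,
           subst (Spanned 𝓐 T) (≡.sym (ℕ.+-identityʳ N)) spanned)
      adjoin-list (v ∷ vs) sorted 𝓐 {T} {N} ext done spanned k =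
        adjoin-one 𝓐 (f v) (raises 𝓐 ext v earlier) spanned λ (𝓑 , 𝓐⊑𝓑 , tame-v , spanned′) →
          adjoin-list vs (λ {i} {j} i≤j → sorted {suc i} {suc j} (s≤s i≤j)) 𝓑 (⊑-trans ext 𝓐⊑𝓑) (rest 𝓑 𝓐⊑𝓑 tame-v) spanned′
            λ (𝓒 , ext′ , tame , spanned″) → k (𝓒 , ext′ , tame , subst (Spanned 𝓒 T) (double (2 ℕ.^ length vs) N) spanned″)
        where
        earlier : ∀ u → h u ℕ.< h v → Tame 𝓐 1 (f u)
        earlier u u<v with done u
        ... | inj₁ u∈ = contradiction (subst (λ w → h v ℕ.≤ h w) (≡.sym (lookup-index u∈)) (sorted {zero} {Any.index u∈} z≤n)) (ℕ.<⇒≱ u<v)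
        ... | inj₂ tame = tame

        rest : ∀ 𝓑 → 𝓐 ⊑ 𝓑 → Tame 𝓑 1 (f v) → ∀ u → u ∈ vs ⊎ Tame 𝓑 1 (f u)
        rest 𝓑 𝓐⊑𝓑 tame-v u with done u
        ... | inj₁ (here ≡.refl) = inj₂ tame-v
        ... | inj₁ (there u∈)    = inj₁ u∈
        ... | inj₂ tame          = inj₂ (⊑-tame 𝓐⊑𝓑 {f u} tame)

        double : ∀ x y → x ℕ.* (2 ℕ.* y) ≡ 2 ℕ.* x ℕ.* y
        double = solve-∀

    adjoin-all : ∀ {T N} vs → (∀ u → u ∈ vs) → length vs ≡ s →
      (∀ {i j} → toℕ i ℕ.≤ toℕ j → h (lookup vs i) ℕ.≤ h (lookup vs j)) → Spanned 𝓐₀ T N →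
      ¬ ¬ (∃[ 𝓑 ] 𝓐₀ ⊑ 𝓑 × (∀ u → Tame 𝓑 1 (f u)) × Spanned 𝓑 T (2 ℕ.^ s ℕ.* N))
    adjoin-all {T} {N} vs all length≡s sorted spanned k = adjoin-list vs sorted 𝓐₀ ⊑-refl (inj₁ ∘ all) spanned
      λ (𝓑 , ext , tame , spanned′) → k (𝓑 , ext , (λ u → tame u) , subst (λ l → Spanned 𝓑 T (2 ℕ.^ l ℕ.* N)) length≡s spanned′)

  module _ (Δ : ℕ) where

    degreeFiltration : Filtration
    degreeFiltration .Level≤ t = HasDegrees (ℕ._≤ Δ ℕ.* t)
    degreeFiltration .subspace t .resp = degrees-resp {P = ℕ._≤ Δ ℕ.* t}
    degreeFiltration .subspace t .zero∈ = degrees-0 {P = ℕ._≤ Δ ℕ.* t}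
    degreeFiltration .subspace t .plus∈ = degrees-++ {P = ℕ._≤ Δ ℕ.* t}
    degreeFiltration .subspace t .scale∈ = degrees-· {P = ℕ._≤ Δ ℕ.* t}
    degreeFiltration .mono {s} {t} {v} s≤t = degrees-weaken {P = ℕ._≤ Δ ℕ.* s} {ℕ._≤ Δ ℕ.* t} (λ i≤ → ℕ.≤-trans i≤ (ℕ.*-monoʳ-≤ Δ s≤t)) {v}

    low-degree-tame : ∀ {z} → HasDegrees (ℕ._≤ Δ) z → Tame degreeFiltration 1 z
    low-degree-tame {z} low {t} {v} x = degrees-* {P = ℕ._≤ Δ} {ℕ._≤ Δ ℕ.* t} {ℕ._≤ Δ ℕ.* suc t}
      (λ i≤ j≤ → ℕ.≤-trans (ℕ.+-mono-≤ i≤ j≤) (ℕ.≤-reflexive (≡.sym (ℕ.*-suc Δ t)))) {z} {v} low x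

    degreeFiltration-spanned : ∀ {T} k .{{_ : NonZero k}} β → Δ ℕ.* T ℕ.≤ β ℕ.* k →
      Spanned degreeFiltration T (length (grid k β n))
    degreeFiltration-spanned {T} k β le = ws , ℕ.≤-reflexive (List.length-map monomial (grid k β n)) ,
      λ (q , v≋q , low) → span-subspace ws .resp (≋-sym v≋q) (spans q low)
      where
      ws = map monomial (grid k β n)

      spans : ∀ q → Terms (ℕ._≤ Δ ℕ.* T) q → Span ws q
      spans [] [] = span-subspace ws .zero∈
      spans ((c , m) ∷ q) (m≤ ∷ low) = span-subspace ws .resp (∷-split c m q)
        (span-subspace ws .plus∈ (span-subspace ws .scale∈ c (span-∈ (∈-map⁺ monomial (∈-grid k m (ℕ.≤-trans m≤ le))))) (spans q low))

-- The Bézout inequality for programs computing the power sum.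

module PowerSumPrograms {a ℓ₁ ℓ₂} (F : HeytingField a ℓ₁ ℓ₂) (n Δ : ℕ)
  (A : OverField.ABP F n) (labels : OverField.LabelDegrees≤ F Δ A)
  (computes : OverField.Computes F A (OverField.powerSum F n n))
  (n#0 : HeytingField._#_ F (SemiringMult._×_ (heytingSemiring F) n (HeytingField.1# F)) (HeytingField.0# F)) where

  open OverField F
  open Evaluation F n
  open Coefficients F n renaming (mono to monomial)
  open Full
  open Derivation F n
  open PathSums F A
  open ABP A using (edge; label; start; end; _⟶_) renaming (size to s)
  private
    module K = HeytingField F
    module R = CommutativeRing polyRing
    module V = LeftSemimodule polyModule
  open R using (_*_)
  open SemiringSum R.semiring using (sum; sum-syntax)
  open LinearAlgebra F polyModule using (#0-inverse)

  n⁻¹ : K.Carrier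
  n⁻¹ = proj₁ (#0-inverse n#0)

  powerEquation : ∀ i → monomial (pure i (ℕ.pred n)) ≋ n⁻¹ ·ₚ ∑[ u < s ] (P u * ∑[ v < s ] (∂ i (M u v) * Q v))
  powerEquation i = begin
    monomial (pure i (ℕ.pred n))                                     ≈⟨ V.*ₗ-identityˡ _ ⟨
    K.1# ·ₚ monomial (pure i (ℕ.pred n))                             ≈⟨ V.*ₗ-congʳ (proj₂ (#0-inverse n#0)) ⟨
    (n⁻¹ K.* _) ·ₚ monomial (pure i (ℕ.pred n))                      ≈⟨ V.*ₗ-assoc n⁻¹ _ _ ⟩
    n⁻¹ ·ₚ (_ ·ₚ monomial (pure i (ℕ.pred n)))                       ≈⟨ V.*ₗ-congˡ (∂-powerSum i n) ⟨
    n⁻¹ ·ₚ ∂ i (powerSum n n)                                        ≈⟨ V.*ₗ-congˡ (∂-cong i {output A} {powerSum n n} (eval⇒≋ (≈ₚ⇒eval {output A} {powerSum n n} computes))) ⟨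
    n⁻¹ ·ₚ ∂ i (output A)                                            ≈⟨ V.*ₗ-congˡ (∂-output i) ⟩
    n⁻¹ ·ₚ ∑[ u < s ] (P u * ∑[ v < s ] (∂ i (M u v) * Q v))         ∎
    where open SetoidReasoning R.setoid

  M-degree : ∀ u v → HasDegrees (ℕ._≤ Δ) (M u v)
  M-degree u v = entry-degree (T? (edge u v))
    where
    entry-degree : ∀ (d : Dec (u ⟶ v)) → HasDegrees (ℕ._≤ Δ) (entry u v d)
    entry-degree (yes e) = Degree≤⇒HasDegrees (labels e)
    entry-degree (no _)  = degrees-0 {P = ℕ._≤ Δ}

  W₀-degree : ∀ u v → HasDegrees (ℕ._≤ 0) (W 0 u v)
  W₀-degree u v with u Fin.≟ v
  ... | yes ≡.refl = degrees-resp {P = ℕ._≤ 0} (R.sym (R.+-identityʳ R.1#))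
                       (degrees-mono {P = ℕ._≤ 0} (replicate n 0) (ℕ.≤-reflexive (deg-zeros n)))
  ... | no _ = degrees-0 {P = ℕ._≤ 0}

  open Filtrations F n
  open LinearAlgebra F polyModule
  open Adjunction F polyModule
  open Filtration
  open Subspace

  private
    Tame-low : Filtration → Set _
    Tame-low 𝓑 = ∀ {z} → HasDegrees (ℕ._≤ Δ) z → Tame 𝓑 1 z

    tame-W₀ : ∀ 𝓑 → Tame-low 𝓑 → ∀ u v → Tame 𝓑 2 (W 0 u v)
    tame-W₀ 𝓑 low u v = tame-weaken 𝓑 {z = W 0 u v} (s≤s z≤n)
      (low {W 0 u v} (degrees-weaken {P = ℕ._≤ 0} {ℕ._≤ Δ} (λ i≤0 → ℕ.≤-trans i≤0 z≤n) {W 0 u v} (W₀-degree u v)))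

    -- Every product in the recurrence pairs a predecessor, tame by assumption, with a label, and
    -- each of the two raises levels by one.
    raises-P : ∀ 𝓑 → Tame-low 𝓑 → ∀ v → (∀ u → rank u ℕ.< rank v → Tame 𝓑 1 (P u)) → Tame 𝓑 2 (P v)
    raises-P 𝓑 low v earlier = tame-resp 𝓑 (R.sym (P-recurrence v))
      (tame-+ 𝓑 {z = W 0 start v} (tame-W₀ 𝓑 low start v)
        (tame-sum 𝓑 (λ u → P u * M u v) λ u → term u (T? (edge u v))))
      where
      term : ∀ u (d : Dec (u ⟶ v)) → Tame 𝓑 2 (P u * entry u v d)
      term u (yes e) = tame-* 𝓑 {1} {1} {P u} {label e} (earlier u (rank-increases e))
                         (low {label e} (Degree≤⇒HasDegrees (labels e)))
      term u (no _)  = tame-resp 𝓑 (R.sym (R.zeroʳ (P u))) (tame-0 𝓑)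

    -- `Q` is determined by successors, so the order is reversed; the truncated difference is
    -- strictly decreasing in the rank because all ranks are below `s`.
    raises-Q : ∀ 𝓑 → Tame-low 𝓑 → ∀ u → (∀ v → s ℕ.∸ rank v ℕ.< s ℕ.∸ rank u → Tame 𝓑 1 (Q v)) → Tame 𝓑 2 (Q u)
    raises-Q 𝓑 low u earlier = tame-resp 𝓑 (R.sym (Q-recurrence u))
      (tame-+ 𝓑 {z = W 0 u end} (tame-W₀ 𝓑 low u end)
        (tame-sum 𝓑 (λ v → M u v * Q v) λ v → term v (T? (edge u v))))
      where
      term : ∀ v (d : Dec (u ⟶ v)) → Tame 𝓑 2 (entry u v d * Q v)
      term v (yes e) = tame-* 𝓑 {1} {1} {label e} {Q v} (low {label e} (Degree≤⇒HasDegrees (labels e)))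
                         (earlier v (ℕ.∸-monoʳ-< (rank-increases e) (ℕ.<⇒≤ (rank<s v))))
      term v (no _)  = tame-0 𝓑

    tame-power : ∀ 𝓑 → Tame-low 𝓑 → (∀ u → Tame 𝓑 1 (P u)) → (∀ u → Tame 𝓑 1 (Q u)) →
      ∀ i → Tame 𝓑 3 (monomial (pure i (ℕ.pred n)))
    tame-power 𝓑 low tame-P tame-Q i = tame-resp 𝓑 (R.sym (powerEquation i))
      (tame-· 𝓑 n⁻¹ {z = ∑[ u < s ] (P u * ∑[ v < s ] (∂ i (M u v) * Q v))}
        (tame-sum 𝓑 (λ u → P u * ∑[ v < s ] (∂ i (M u v) * Q v)) λ u →
          tame-* 𝓑 {1} {2} {P u} {∑[ v < s ] (∂ i (M u v) * Q v)} (tame-P u)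
            (tame-sum 𝓑 (λ v → ∂ i (M u v) * Q v) λ v →
              tame-* 𝓑 {1} {1} {∂ i (M u v)} {Q v}
                (low {∂ i (M u v)} (degrees-weaken {P = ℕ._≤ ℕ.pred Δ} {ℕ._≤ Δ} (λ i≤ → ℕ.≤-trans i≤ ℕ.pred[n]≤n) {∂ i (M u v)}
                  (∂-degree i (M-degree u v))))
                (tame-Q v))))

    tame-powers : ∀ 𝓑 → (∀ i → Tame 𝓑 3 (monomial (pure i (ℕ.pred n)))) →
      ∀ b → Tame 𝓑 (deg b ℕ.* 3) (monomial (Vec.map (ℕ._* ℕ.pred n) b))
    tame-powers 𝓑 tame = scaled-vector-induction (λ t m → Tame 𝓑 t (monomial m))
      (λ {t} {v} x → subspace 𝓑 t .resp (R.sym (R.*-identityˡ v)) x)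
      (λ {s t l m} x y → tame-resp 𝓑 (mono-⊕ l m) (tame-* 𝓑 {s} {t} {monomial l} {monomial m} x y))
      tame

  bezout : 1 ℕ.≤ Δ → ℕ.pred n ℕ.^ n ℕ.≤ 2 ℕ.^ s ℕ.* (2 ℕ.^ s ℕ.* (4 ℕ.* Δ) ℕ.^ n)
  bezout 1≤Δ = decidable-stable (_ ℕ.≤? _) λ ¬le →
    adjoin-sorted P rank (degreeFiltration Δ) (λ 𝓑 ext → raises-P 𝓑 (tame-low ext)) spanned₀ λ (𝓐 , ext , tame-P , spanned₁) →
    adjoin-sorted Q (λ v → s ℕ.∸ rank v) 𝓐 (λ 𝓑 ext′ → raises-Q 𝓑 (tame-low (⊑-trans ext ext′))) spanned₁
      λ (𝓑 , ext′ , tame-Q , ws , len , spans) →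
      ¬le (ℕ.*-cancelʳ-≤ _ _ S (ℕ.≤-trans
        (count 𝓑 (⊑-trans ext ext′) (λ u → ⊑-tame ext′ {P u} (tame-P u)) tame-Q ws spans)
        (ℕ.≤-trans len (ℕ.≤-reflexive arrange))))
    where
    -- A monomial is split by digits in base n - 1. The remainders have degree at most n², hence lie
    -- in level n², and the quotients, of sum at most `β`, cost three levels each. With `β` equal to
    -- n² this makes `T` equal to 4β, whence the factor 4Δ; a larger `β` would bring it closer to
    -- 3Δ.
    β = n ℕ.* n
    T = n ℕ.* n ℕ.+ 3 ℕ.* β
    S = length (simplex β n)

    instance
      S-nonZero : NonZero S
      S-nonZero = ℕ.>-nonZero (∈-length (∈-simplex⁺ (replicate n 0) (ℕ.≤-trans (ℕ.≤-reflexive (deg-zeros n)) z≤n)))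

      4Δ-nonZero : NonZero (4 ℕ.* Δ)
      4Δ-nonZero = ℕ.>-nonZero (ℕ.≤-trans 1≤Δ (ℕ.m≤n*m Δ 4))

    spanned₀ : Spanned (degreeFiltration Δ) T (length (grid (4 ℕ.* Δ) β n))
    spanned₀ = degreeFiltration-spanned Δ (4 ℕ.* Δ) β (ℕ.≤-reflexive (eq Δ n))
      where
      eq : ∀ Δ n → Δ ℕ.* (n ℕ.* n ℕ.+ 3 ℕ.* (n ℕ.* n)) ≡ n ℕ.* n ℕ.* (4 ℕ.* Δ)
      eq = solve-∀

    adjoin-sorted : ∀ f h 𝓐 → (∀ 𝓑 → 𝓐 ⊑ 𝓑 → ∀ v → (∀ u → h u ℕ.< h v → Tame 𝓑 1 (f u)) → Tame 𝓑 2 (f v)) →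
      ∀ {N} → Spanned 𝓐 T N →
      ¬ ¬ (∃[ 𝓑 ] 𝓐 ⊑ 𝓑 × (∀ u → Tame 𝓑 1 (f u)) × Spanned 𝓑 T (2 ℕ.^ s ℕ.* N))
    adjoin-sorted f h 𝓐 raises with sorted-vertices h
    ... | vs , vs↭ , sorted = adjoin-all f h 𝓐 raises vs
      (λ u → ∈-resp-↭ (↭-sym vs↭) (∈-allFin u))
      (≡.trans (↭-length vs↭) (List.length-tabulate {n = s} id)) (λ {i} {j} → sorted {i} {j})

    tame-low : ∀ {𝓑} → degreeFiltration Δ ⊑ 𝓑 → Tame-low 𝓑
    tame-low ext {z} low = ⊑-tame ext {z} (low-degree-tame Δ {z} low)

    arrange : 2 ℕ.^ s ℕ.* (2 ℕ.^ s ℕ.* length (grid (4 ℕ.* Δ) β n)) ≡ 2 ℕ.^ s ℕ.* (2 ℕ.^ s ℕ.* (4 ℕ.* Δ) ℕ.^ n) ℕ.* S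
    arrange = ≡.trans (≡.cong (λ l → 2 ℕ.^ s ℕ.* (2 ℕ.^ s ℕ.* l)) (length-grid (4 ℕ.* Δ) β n))
      (eq (2 ℕ.^ s) ((4 ℕ.* Δ) ℕ.^ n) S)
      where
      eq : ∀ x y z → x ℕ.* (x ℕ.* (y ℕ.* z)) ≡ x ℕ.* (x ℕ.* y) ℕ.* z
      eq = solve-∀

    count : ∀ 𝓑 → degreeFiltration Δ ⊑ 𝓑 → (∀ u → Tame 𝓑 1 (P u)) → (∀ u → Tame 𝓑 1 (Q u)) →
      ∀ ws → (∀ {v} → Level≤ 𝓑 T v → Span ws v) → ℕ.pred n ℕ.^ n ℕ.* S ℕ.≤ length ws
    count 𝓑 ext tame-P tame-Q ws spans = subst (ℕ._≤ length ws) (length-grid (ℕ.pred n) β n)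
      (monomials-bound (grid (ℕ.pred n) β n) ws (grid-unique (ℕ.pred n) β n) (λ _ → tt) λ e∈ → spans (inside e∈))
      where
      open MonomialCount F n (λ _ → ⊤) (λ _ _ _ → tt)

      inside : ∀ {e} → e ∈ grid (ℕ.pred n) β n → Level≤ 𝓑 T (monomial e)
      inside e∈ with ∈-cartesianProductWith⁻ digits (box (ℕ.pred n) n) (simplex β n) e∈
      ... | v , b , _ , b∈ , ≡.refl = mono 𝓑 level≤
        (subspace 𝓑 (deg b ℕ.* 3 ℕ.+ n ℕ.* n) .resp factors
          (tame-powers 𝓑 (tame-power 𝓑 (tame-low ext) tame-P tame-Q) b (⊑-level ext (degrees-mono {P = ℕ._≤ Δ ℕ.* (n ℕ.* n)} (Vec.map toℕ v) low))))
        where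
        factors : monomial (Vec.map (ℕ._* ℕ.pred n) b) * monomial (Vec.map toℕ v) ≋ monomial (digits v b)
        factors = R.trans (mono-⊕ (Vec.map (ℕ._* ℕ.pred n) b) (Vec.map toℕ v))
          (≋-reflexive (≡.cong monomial (≡.trans (⊕-comm (Vec.map (ℕ._* ℕ.pred n) b) (Vec.map toℕ v)) (≡.sym (digits-⊕ v b)))))

        low : deg (Vec.map toℕ v) ℕ.≤ Δ ℕ.* (n ℕ.* n)
        low = ℕ.≤-trans (deg-toℕ v) (ℕ.≤-trans
          (ℕ.*-monoʳ-≤ n (ℕ.≤-trans ℕ.pred[n]≤n ℕ.pred[n]≤n))
          (ℕ.m≤n*m (n ℕ.* n) Δ {{ℕ.>-nonZero 1≤Δ}}))

        level≤ : deg b ℕ.* 3 ℕ.+ n ℕ.* n ℕ.≤ T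
        level≤ = ℕ.≤-trans (ℕ.+-monoˡ-≤ (n ℕ.* n) (ℕ.*-monoˡ-≤ 3 (∈-simplex⁻ {β} {n} b∈)))
          (ℕ.≤-reflexive (≡.trans (ℕ.+-comm (β ℕ.* 3) (n ℕ.* n)) (≡.cong (n ℕ.* n ℕ.+_) (ℕ.*-comm β 3))))

-- The inequality `n ≤ 2 s`, by comparing growth in truncated polynomial rings.

^-distribʳ-* : ∀ x y k → (x ℕ.* y) ℕ.^ k ≡ x ℕ.^ k ℕ.* y ℕ.^ k
^-distribʳ-* x y zero    = ≡.refl
^-distribʳ-* x y (suc k) = ≡.trans (≡.cong (x ℕ.* y ℕ.*_) (^-distribʳ-* x y k)) (interchange x y (x ℕ.^ k) (y ℕ.^ k))
  where open CommutativeSemigroupProperties ℕ.*-commutativeSemigroup using (interchange)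

-- The case distinction behind rewriting with the powers `x_i^k`: a monomial is either irreducible
-- or has such a factor.
small-or-divisible : ∀ k {n} (m : Vec ℕ n) →
  (∃[ v ] m ≡ Vec.map (toℕ {k}) v) ⊎ (∃[ i ] ∃[ l ] m ≡ l ⊕ (replicate n 0 [ i ]≔ k))
small-or-divisible k [] = inj₁ ([] , ≡.refl)
small-or-divisible k (j ∷ m) with j ℕ.<? k | small-or-divisible k m
... | no j≮k | _ = inj₂ (zero , j ℕ.∸ k ∷ m , ≡.cong₂ _∷_
  (≡.sym (ℕ.m∸n+n≡m (ℕ.≮⇒≥ j≮k))) (≡.sym (≡.trans (⊕-comm m _) (⊕-identityˡ m))))
... | yes j<k | inj₁ (v , m≡) = inj₁ (fromℕ< j<k ∷ v , ≡.cong₂ _∷_ (≡.sym (Fin.toℕ-fromℕ< j<k)) m≡)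
... | yes j<k | inj₂ (i , l , m≡) = inj₂ (suc i , j ∷ l , ≡.cong₂ _∷_ (≡.sym (ℕ.+-identityʳ j)) m≡)

deg-pure : ∀ {n} (i : Fin n) k → deg (replicate n 0 [ i ]≔ k) ≡ k
deg-pure {suc n} zero    k = ≡.trans (≡.cong (k ℕ.+_) (deg-zeros n)) (ℕ.+-identityʳ k)
deg-pure {suc n} (suc i) k = deg-pure i k

-- In the ring of polynomials modulo degree k, elements without constant term
-- are nilpotent.
module TruncatedSpans {a ℓ₁ ℓ₂} (F : HeytingField a ℓ₁ ℓ₂) (n k : ℕ) where

  open OverField F
  open Evaluation F n
  open Coefficients F n renaming (mono to monomial)
  open Full using (_≋_; ≋-refl)
  module Tr = Trunc k
  module R = CommutativeRing Tr.polyRing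
  module V = LeftSemimodule Tr.polyModule
  open R using (_*_; _≈_)
  open LinearAlgebra F Tr.polyModule public
  open Subspace

  Stable : Poly n → List (Poly n) → Set _
  Stable z ws = ∀ {v} → Span ws v → Span ws (z * v)

  multiple-subspace : ∀ z {p} {P : Poly n → Set p} → Subspace P → Subspace (P ∘ (z *_))
  multiple-subspace z sub .resp eq = sub .resp (R.*-congˡ {z} eq)
  multiple-subspace z sub .zero∈ = sub .resp (R.sym (R.zeroʳ z)) (sub .zero∈)
  multiple-subspace z sub .plus∈ {u} {v} x y = sub .resp (R.sym (R.distribˡ z u v)) (sub .plus∈ x y)
  multiple-subspace z sub .scale∈ c {v} x = sub .resp (R.sym (Tr.*ₚ-·ₚ c z v)) (sub .scale∈ c x)

  power : Poly n → ℕ → Poly n → Poly n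
  power z zero    w = w
  power z (suc j) w = z * power z j w

  power-degree : ∀ {z} → HasDegrees (1 ℕ.≤_) z → ∀ j w → HasDegrees (j ℕ.≤_) (power z j w)
  power-degree pos zero    w = w , ≋-refl , All.universal (λ _ → z≤n) w
  power-degree {z} pos (suc j) w = degrees-* {P = 1 ℕ.≤_} {j ℕ.≤_} {suc j ℕ.≤_} ℕ.+-mono-≤ {z} pos (power-degree pos j w)

  powers : Poly n → ℕ → List (Poly n) → List (Poly n)
  powers z zero    ws = []
  powers z (suc j) ws = ws ++ map (z *_) (powers z j ws)

  length-powers : ∀ z j ws → length (powers z j ws) ≡ j ℕ.* length ws
  length-powers z zero    ws = ≡.refl
  length-powers z (suc j) ws = ≡.trans (List.length-++ ws)
    (≡.cong (length ws ℕ.+_) (≡.trans (List.length-map (z *_) (powers z j ws)) (length-powers z j ws)))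

  powers-last : ∀ z j ws {u} → u ∈ powers z (suc j) ws → u ∈ powers z j ws ⊎ (∃[ w ] u ≡ power z j w)
  powers-last z j ws u∈ with ∈-++⁻ ws u∈
  powers-last z zero    ws u∈ | inj₁ u∈ws = inj₂ (_ , ≡.refl)
  powers-last z (suc j) ws u∈ | inj₁ u∈ws = inj₁ (∈-++⁺ˡ u∈ws)
  powers-last z (suc j) ws u∈ | inj₂ u∈zp with ∈-map⁻ (z *_) u∈zp
  ... | u′ , u′∈ , ≡.refl with powers-last z j ws u′∈
  ...   | inj₁ u′∈′       = inj₁ (∈-++⁺ʳ ws (∈-map⁺ (z *_) u′∈′))
  ...   | inj₂ (w , ≡.refl) = inj₂ (w , ≡.refl)

  powers-shift : ∀ z j ws {v} → Span (powers z j ws) v → Span (powers z (suc j) ws) (z * v)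
  powers-shift z j ws = span-least (multiple-subspace z (span-subspace _)) λ w∈ → span-∈ (∈-++⁺ʳ ws (∈-map⁺ (z *_) w∈))

  -- Multiplication by `z` shifts the list; the only new elements are the products of the `k`-th
  -- power of `z` with some `w`, of degree at least `k`, and these vanish in the truncation.
  powers-stable : ∀ {z} → HasDegrees (1 ℕ.≤_) z → ∀ ws → Stable z (powers z k ws)
  powers-stable {z} pos ws s = span-least (span-subspace _) drop-last (powers-shift z k ws s)
    where
    drop-last : ∀ {u} → u ∈ powers z (suc k) ws → Span (powers z k ws) u
    drop-last u∈ with powers-last z k ws u∈
    ... | inj₁ u∈′ = span-∈ u∈′
    ... | inj₂ (w , ≡.refl) = span-subspace _ .resp (R.sym (high⇒0 k (power-degree pos k w))) (span-subspace _ .zero∈)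

  -- Multiplication by `y` commutes with `z`, so it acts on each copy of `ws` separately.
  stable-powers : ∀ {y} z j ws → Stable y ws → Stable y (powers z j ws)
  stable-powers {y} z zero    ws stable = span-least (multiple-subspace y (span-subspace _)) λ ()
  stable-powers {y} z (suc j) ws stable = span-least (multiple-subspace y (span-subspace _)) element
    where
    element : ∀ {w} → w ∈ powers z (suc j) ws → Span (powers z (suc j) ws) (y * w)
    element w∈ with ∈-++⁻ ws w∈
    ... | inj₁ w∈ws = span-least (span-subspace _) (span-∈ ∘ ∈-++⁺ˡ) (stable (span-∈ w∈ws))
    ... | inj₂ w∈zp with ∈-map⁻ (z *_) w∈zp
    ...   | w′ , w′∈ , ≡.refl = span-subspace _ .resp swap
              (powers-shift z j ws (stable-powers {y} z j ws stable (span-∈ w′∈)))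
      where
      swap : z * (y * w′) ≈ y * (z * w′)
      swap = R.trans (R.sym (R.*-assoc z y w′)) (R.trans (R.*-congʳ {w′} (R.*-comm z y)) (R.*-assoc y z w′))

  -- The monomials in the generators with all exponents below `k`, times `ws`. By nilpotency they
  -- span the whole module that `ws` generates over the generators.
  products : List (Poly n) → List (Poly n) → List (Poly n)
  products []       ws = ws
  products (z ∷ zs) ws = powers z k (products zs ws)

  length-products : ∀ zs ws → length (products zs ws) ≡ k ℕ.^ length zs ℕ.* length ws
  length-products []       ws = ≡.sym (ℕ.+-identityʳ _)
  length-products (z ∷ zs) ws = ≡.trans (length-powers z k (products zs ws))
    (≡.trans (≡.cong (k ℕ.*_) (length-products zs ws)) (≡.sym (ℕ.*-assoc k _ _)))

  products-stable : ∀ {zs} ws → (∀ {z} → z ∈ zs → HasDegrees (1 ℕ.≤_) z) →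
    ∀ {z} → z ∈ zs → Stable z (products zs ws)
  products-stable {z ∷ zs} ws pos (here ≡.refl) = powers-stable (pos (here ≡.refl)) (products zs ws)
  products-stable {z ∷ zs} ws pos {y} (there y∈) =
    stable-powers {y} z k (products zs ws) (products-stable ws (pos ∘ there) {y} y∈)

  products-⊇ : 1 ℕ.≤ k → ∀ zs {ws w} → w ∈ ws → w ∈ products zs ws
  products-⊇ 1≤k []       w∈ = w∈
  products-⊇ 1≤k (z ∷ zs) {ws} w∈ = lemma 1≤k (products-⊇ 1≤k zs w∈)
    where
    lemma : ∀ {j} → 1 ℕ.≤ j → ∀ {w} → w ∈ products zs ws → w ∈ powers z j (products zs ws)
    lemma (s≤s _) = ∈-++⁺ˡ

module _ {r ℓ} (R : CommutativeRing r ℓ) where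

  open CommutativeRing R
  open RingSolver commutativeSemiring

  -- To be used with `α` and `β` the constant parts of `P` and `Q`, and with `z` and `w` their
  -- nonconstant parts. All summands but the first are then visible multiples of generators.
  expand-at-constants : ∀ p α z D β w →
    p * ((α + z) * (D * (β + w))) ≈ (p * (α * (D * β)) + w * (p * (α * D))) + z * (p * (D * (β + w)))
  expand-at-constants = solve 6 (λ p α z D β w →
    p :* ((α :+ z) :* (D :* (β :+ w))) := (p :* (α :* (D :* β)) :+ w :* (p :* (α :* D))) :+ z :* (p :* (D :* (β :+ w)))) refl

module Krull {a ℓ₁ ℓ₂} (F : HeytingField a ℓ₁ ℓ₂) (n Δ : ℕ)
  (A : OverField.ABP F n) (labels : OverField.LabelDegrees≤ F Δ A)
  (computes : OverField.Computes F A (OverField.powerSum F n n))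
  (n#0 : HeytingField._#_ F (SemiringMult._×_ (heytingSemiring F) n (HeytingField.1# F)) (HeytingField.0# F))
  (1≤Δ : 1 ℕ.≤ Δ) (Δ<n : Δ ℕ.< n) where

  open OverField F
  open Evaluation F n
  open Coefficients F n renaming (mono to monomial)
  open Derivation F n
  open PathSums F A
  open ABP A using () renaming (size to s)
  open PowerSumPrograms F n Δ A labels computes n#0
  private
    module S = CommutativeRing Full.polyRing

  z-P z-Q : Fin s → Poly n
  z-P u = nonconstantPart (P u)
  z-Q u = nonconstantPart (Q u)

  generators : List (Poly n)
  generators = map z-P (allFin s) ++ map z-Q (allFin s)

  length-generators : length generators ≡ 2 ℕ.* s
  length-generators = ≡.trans (List.length-++ (map z-P (allFin s))) (≡.cong₂ ℕ._+_ (length-half z-P)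
    (≡.trans (length-half z-Q) (≡.sym (ℕ.+-identityʳ s))))
    where
    length-half : ∀ f → length (map f (allFin s)) ≡ s
    length-half f = ≡.trans (List.length-map f (allFin s)) (List.length-tabulate {n = s} id)

  generators-degree : ∀ {z} → z ∈ generators → HasDegrees (1 ℕ.≤_) z
  generators-degree z∈ with ∈-++⁻ (map z-P (allFin s)) z∈
  ... | inj₁ z∈P with ∈-map⁻ z-P z∈P
  ...   | u , _ , ≡.refl = nonconstantPart-degree (P u)
  generators-degree z∈ | inj₂ z∈Q with ∈-map⁻ z-Q z∈Q
  ...   | u , _ , ≡.refl = nonconstantPart-degree (Q u)

  z-P∈ : ∀ u → z-P u ∈ generators
  z-P∈ u = ∈-++⁺ˡ (∈-map⁺ z-P (∈-allFin u))

  z-Q∈ : ∀ u → z-Q u ∈ generators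
  z-Q∈ u = ∈-++⁺ʳ (map z-P (allFin s)) (∈-map⁺ z-Q (∈-allFin u))

  module Modulo (k : ℕ) (1≤k : 1 ℕ.≤ k) where

    open TruncatedSpans F n k
    open R using (_*_; _≈_)
    open Subspace
    open CommutativeSemigroupProperties (CommutativeMonoid.commutativeSemigroup R.+-commutativeMonoid)
      using (interchange)
    open SemiringSum S.semiring using (sum; sum-syntax)

    smallMonomials : List (Poly n)
    smallMonomials = map (monomial ∘ Vec.map toℕ) (box (ℕ.pred n) n)

    W′ : List (Poly n)
    W′ = products generators smallMonomials

    -- Successive approximation: the error has degree at least `l`, and at `l = k` it vanishes in
    -- the truncation. Induction on `l` takes the part of Nakayama's lemma.
    SpannedUpTo : ℕ → Poly n → Set _
    SpannedUpTo l p = ∃[ σ ] ∃[ q ] Span W′ σ × HasDegrees (l ℕ.≤_) q × p ≈ σ ++ q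

    spanned-subspace : ∀ l → Subspace (SpannedUpTo l)
    spanned-subspace l .resp eq (σ , q , sp , high , p≈) = σ , q , sp , high , R.trans (R.sym eq) p≈
    spanned-subspace l .zero∈ = [] , [] , span-subspace W′ .zero∈ , degrees-0 {P = l ℕ.≤_} , R.refl
    spanned-subspace l .plus∈ (σ , q , sp , high , p≈) (σ′ , q′ , sp′ , high′ , p′≈) =
      σ ++ σ′ , q ++ q′ , span-subspace W′ .plus∈ sp sp′ , degrees-++ {P = l ℕ.≤_} high high′ ,
      R.trans (R.+-cong p≈ p′≈) (interchange σ q σ′ q′)
    spanned-subspace l .scale∈ c (σ , q , sp , high , p≈) =
      c ·ₚ σ , c ·ₚ q , span-subspace W′ .scale∈ c sp , degrees-· {P = l ℕ.≤_} c high ,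
      R.trans (V.*ₗ-congˡ {c} p≈) (V.*ₗ-distribˡ c σ q)

    -- The span is stable under `z`, and the error gains a degree because `z` has no constant term.
    spanned-multiple : ∀ {l z h} → z ∈ generators → SpannedUpTo l h → SpannedUpTo (suc l) (z * h)
    spanned-multiple {l} {z} z∈ (σ , q , sp , high , h≈) = z * σ , z * q ,
      products-stable smallMonomials generators-degree z∈ sp ,
      degrees-* {P = 1 ℕ.≤_} {l ℕ.≤_} {suc l ℕ.≤_} ℕ.+-mono-≤ {z} {q} (generators-degree z∈) high ,
      R.trans (R.*-congˡ {z} h≈) (R.distribˡ z σ q)

    module Step (l : ℕ) (multiples : ∀ {z} → z ∈ generators → ∀ h → SpannedUpTo l (z * h)) where

      private
        G = SpannedUpTo l
        G-resp : ∀ {p q} → Full._≋_ p q → G p → G q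
        G-resp eq = spanned-subspace l .resp (≋⇒truncated k eq)

      G-sum : ∀ {j} (t : Fin j → Poly n) → (∀ i → G (t i)) → G (sum t)
      G-sum {zero}  t t∈ = spanned-subspace l .zero∈
      G-sum {suc j} t t∈ = spanned-subspace l .plus∈ (t∈ zero) (G-sum (t ∘ suc) (t∈ ∘ suc))

      G-combination : ∀ q → All (G ∘ monomial ∘ proj₂) q → G q
      G-combination [] [] = spanned-subspace l .zero∈
      G-combination ((c , m) ∷ q) (m∈ ∷ ms) = G-resp (∷-split c m q)
        (spanned-subspace l .plus∈ (spanned-subspace l .scale∈ c m∈) (G-combination q ms))

      -- Up to multiples of the generators, P and Q may be replaced by their
      -- constant parts.
      G-term : ∀ p (D : Poly n) u v → G (p * (constantPart (P u) * (D * constantPart (Q v)))) →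
        G (p * (P u * (D * Q v)))
      G-term p D u v low = G-resp (S.sym eq)
        (spanned-subspace l .plus∈ (spanned-subspace l .plus∈ low (multiples (z-Q∈ v) _)) (multiples (z-P∈ u) _))
        where
        α = constantPart (P u)
        β = constantPart (Q v)
        eq : Full._≋_ (p * (P u * (D * Q v)))
          ((p * (α * (D * β)) ++ z-Q v * (p * (α * D))) ++ z-P u * (p * (D * (β ++ z-Q v))))
        eq = S.trans (S.*-congˡ {p} (S.*-cong (constant+nonconstant (P u)) (S.*-congˡ {D} (constant+nonconstant (Q v)))))
          (expand-at-constants Full.polyRing p α (z-P u) D β (z-Q v))

      -- With `P` and `Q` replaced by constants, the power equation leaves degree at most deg m + Δ
      -- - 1. By `Δ < n` this is less than deg m + n - 1, so the monomials that remain are covered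
      -- by `mono∈`.
      G-power : ∀ {d} → (∀ m → deg m ℕ.< d → G (monomial m)) →
        ∀ m i → deg m ℕ.+ ℕ.pred n ℕ.≤ d → G (monomial m * monomial (pure i (ℕ.pred n)))
      G-power {d} mono∈ m i le = G-resp (S.sym eq) (spanned-subspace l .scale∈ n⁻¹
        (G-sum (λ u → ∑[ v < s ] (x * (P u * (D u v * Q v)))) λ u →
          G-sum (λ v → x * (P u * (D u v * Q v))) λ v → G-term x (D u v) u v (low u v)))
        where
        x = monomial m
        D : Fin s → Fin s → Poly n
        D u v = ∂ i (M u v)

        eq : Full._≋_ (x * monomial (pure i (ℕ.pred n))) (n⁻¹ ·ₚ ∑[ u < s ] ∑[ v < s ] (x * (P u * (D u v * Q v))))
        eq = begin
          x * monomial (pure i (ℕ.pred n))                                 ≈⟨ S.*-congˡ {x} (powerEquation i) ⟩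
          x * (n⁻¹ ·ₚ ∑[ u < s ] (P u * ∑[ v < s ] (D u v * Q v)))
            ≈⟨ Full.*ₚ-·ₚ n⁻¹ x (∑[ u < s ] (P u * ∑[ v < s ] (D u v * Q v))) ⟩
          n⁻¹ ·ₚ (x * ∑[ u < s ] (P u * ∑[ v < s ] (D u v * Q v)))
            ≈⟨ LeftSemimodule.*ₗ-congˡ Full.polyModule {n⁻¹} distribute ⟩
          n⁻¹ ·ₚ ∑[ u < s ] ∑[ v < s ] (x * (P u * (D u v * Q v)))         ∎
          where
          open SetoidReasoning S.setoid
          open SemiringSum S.semiring using (*-distribˡ-sum; sum-cong-≋)
          distribute : Full._≋_ (x * ∑[ u < s ] (P u * ∑[ v < s ] (D u v * Q v))) (∑[ u < s ] ∑[ v < s ] (x * (P u * (D u v * Q v))))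
          distribute = S.trans (*-distribˡ-sum {s} x (λ u → P u * ∑[ v < s ] (D u v * Q v)))
            (sum-cong-≋ {n = s} λ u → S.trans (S.*-congˡ {x} (*-distribˡ-sum {s} (P u) (λ v → D u v * Q v)))
              (*-distribˡ-sum {s} x (λ v → P u * (D u v * Q v))))

        low-degree : ∀ u v → HasDegrees (ℕ._< d) (x * (constantPart (P u) * (D u v * constantPart (Q v))))
        low-degree u v = degrees-weaken {P = ℕ._≤ deg m ℕ.+ ℕ.pred Δ} {ℕ._< d} (λ j≤ → ℕ.≤-<-trans j≤ small) {x * (constantPart (P u) * (D u v * constantPart (Q v)))}
          (degrees-* {P = ℕ._≤ deg m} {ℕ._≤ ℕ.pred Δ} {ℕ._≤ deg m ℕ.+ ℕ.pred Δ} ℕ.+-mono-≤ {x} (degrees-mono {P = ℕ._≤ deg m} m ℕ.≤-refl)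
            (degrees-* {P = ℕ._≤ 0} {ℕ._≤ ℕ.pred Δ} {ℕ._≤ ℕ.pred Δ} ℕ.+-mono-≤ {constantPart (P u)} (constantPart-degree (P u))
              (degrees-* {P = ℕ._≤ ℕ.pred Δ} {ℕ._≤ 0} {ℕ._≤ ℕ.pred Δ}
                (λ i≤ j≤ → ℕ.≤-trans (ℕ.+-mono-≤ i≤ j≤) (ℕ.≤-reflexive (ℕ.+-identityʳ _))) {D u v}
                (∂-degree i (M-degree u v)) (constantPart-degree (Q v)))))
          where
          small : deg m ℕ.+ ℕ.pred Δ ℕ.< d
          small = ℕ.<-≤-trans (ℕ.+-monoʳ-< (deg m) (ℕ.pred-mono-< {{ℕ.>-nonZero 1≤Δ}} Δ<n)) le

        low : ∀ u v → G (x * (constantPart (P u) * (D u v * constantPart (Q v))))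
        low u v with low-degree u v
        ... | q , ≋q , ts = G-resp (S.sym ≋q) (G-combination q (All.map (λ {t} → mono∈ (proj₂ t)) ts))

      G-monomial : ∀ d m → deg m ℕ.< d → G (monomial m)
      G-monomial (suc d) m (s≤s m≤d) with small-or-divisible (ℕ.pred n) m
      ... | inj₁ (v , ≡.refl) = monomial m , [] , span-∈ (products-⊇ 1≤k generators (∈-map⁺ (monomial ∘ Vec.map toℕ) (∈-box v))) ,
              degrees-0 {P = l ℕ.≤_} , R.sym (R.+-identityʳ (monomial m))
      ... | inj₂ (i , m′ , ≡.refl) = G-resp (mono-⊕ m′ (pure i (ℕ.pred n))) (G-power (G-monomial d) m′ i
              (subst (ℕ._≤ d) (≡.trans (deg-⊕ m′ (pure i (ℕ.pred n))) (≡.cong (deg m′ ℕ.+_) (deg-pure i (ℕ.pred n)))) m≤d))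

      G-all : ∀ p → G p
      G-all p = G-combination p (All.universal (λ (_ , m) → G-monomial (suc (deg m)) m ℕ.≤-refl) p)

    spanned-up-to : ∀ l p → SpannedUpTo l p
    spanned-up-to zero    p = [] , p , span-subspace W′ .zero∈ , (p , Full.≋-refl , All.universal (λ _ → z≤n) p) , R.refl
    spanned-up-to (suc l) p = Step.G-all (suc l) (λ z∈ h → spanned-multiple z∈ (spanned-up-to l h)) p

    all-spanned : ∀ p → Span W′ p
    all-spanned p with spanned-up-to k p
    ... | σ , q , sp , high , p≈ = span-subspace W′ .resp
      (R.sym (R.trans p≈ (R.trans (R.+-congˡ {σ} (high⇒0 k high)) (R.+-identityʳ σ)))) sp

    length-W′ : length W′ ≡ k ℕ.^ (2 ℕ.* s) ℕ.* ℕ.pred n ℕ.^ n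
    length-W′ = ≡.trans (length-products generators smallMonomials)
      (≡.cong₂ (λ i j → k ℕ.^ i ℕ.* j) length-generators
        (≡.trans (List.length-map (monomial ∘ Vec.map toℕ) (box (ℕ.pred n) n)) (length-box (ℕ.pred n) n)))

  -- Truncation at degree `n κ` keeps every monomial with all exponents below `κ`, so `κ^n` of them
  -- stay independent, while the length of `W′` grows in `κ` only with exponent `2 s`.
  truncated-count : ∀ κ → 1 ℕ.≤ κ → κ ℕ.^ n ℕ.≤ (n ℕ.* κ) ℕ.^ (2 ℕ.* s) ℕ.* ℕ.pred n ℕ.^ n
  truncated-count κ 1≤κ = ≡.subst₂ ℕ._≤_ (≡.trans (List.length-map (Vec.map toℕ) (box κ n)) (length-box κ n)) length-W′
    (monomials-bound (map (Vec.map toℕ) (box κ n)) W′ (Unique.map⁺ map-toℕ-injective (box-unique κ n)) inside (λ _ → all-spanned _))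
    where
    1≤n : 1 ℕ.≤ n
    1≤n = ℕ.≤-trans 1≤Δ (ℕ.<⇒≤ Δ<n)
    open Modulo (n ℕ.* κ) (ℕ.*-mono-≤ 1≤n 1≤κ)
    open MonomialCount F n (Truncated (n ℕ.* κ)) (truncated-closed (n ℕ.* κ))

    inside : ∀ {e} → e ∈ map (Vec.map toℕ) (box κ n) → deg e ℕ.< n ℕ.* κ
    inside e∈ with ∈-map⁻ (Vec.map toℕ) e∈
    ... | v , _ , ≡.refl = ℕ.≤-<-trans (deg-toℕ v)
      (ℕ.*-monoʳ-< n {{ℕ.>-nonZero 1≤n}} (ℕ.≤-reflexive (ℕ.suc-pred κ {{ℕ.>-nonZero 1≤κ}})))

  n≤2s : n ℕ.≤ 2 ℕ.* s
  n≤2s = ℕ.≮⇒≥ λ 2s<n → ℕ.<⇒≱ (too-small 2s<n) (truncated-count κ (s≤s z≤n))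
    where
    instance
      n-nonZero : NonZero n
      n-nonZero = ℕ.>-nonZero (ℕ.≤-trans 1≤Δ (ℕ.<⇒≤ Δ<n))

    m = ℕ.pred n
    X = m ℕ.^ n
    -- If `2 s ≤ m`, the bound of `truncated-count` is at most `n^m X κ^m`, so `κ` need only exceed
    -- `n^m X`.
    κ = suc (n ℕ.^ m ℕ.* X)

    too-small : 2 ℕ.* s ℕ.< n → (n ℕ.* κ) ℕ.^ (2 ℕ.* s) ℕ.* X ℕ.< κ ℕ.^ n
    too-small 2s<n = begin-strict
      (n ℕ.* κ) ℕ.^ (2 ℕ.* s) ℕ.* X
        ≤⟨ ℕ.*-monoˡ-≤ X (ℕ.^-monoʳ-≤ (n ℕ.* κ) {{ℕ.m*n≢0 n κ}} (ℕ.<⇒≤pred 2s<n)) ⟩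
      (n ℕ.* κ) ℕ.^ m ℕ.* X                ≡⟨ ≡.cong (ℕ._* X) (^-distribʳ-* n κ m) ⟩
      n ℕ.^ m ℕ.* κ ℕ.^ m ℕ.* X            ≡⟨ eq (n ℕ.^ m) (κ ℕ.^ m) X ⟩
      n ℕ.^ m ℕ.* X ℕ.* κ ℕ.^ m            <⟨ ℕ.*-monoˡ-< (κ ℕ.^ m) {{ℕ.m^n≢0 κ m}} (ℕ.n<1+n (n ℕ.^ m ℕ.* X)) ⟩
      κ ℕ.* κ ℕ.^ m                        ≡⟨ ≡.cong (κ ℕ.^_) (ℕ.suc-pred n) ⟩
      κ ℕ.^ n                              ∎
      where
      open ℕ.≤-Reasoning
      eq : ∀ x y z → x ℕ.* y ℕ.* z ≡ x ℕ.* z ℕ.* y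
      eq = solve-∀

-- Powers of rationals, binary logarithms and the final estimate.

open RawSemiringDefs ℚ.+-*-rawSemiring using (_^_)
open CommutativeSemiringExp (CommutativeRing.commutativeSemiring ℚ.+-*-commutativeRing)
  using (^-homo-*; ^-distrib-*; ^-congˡ)

^-cancelʳ-≤ : ∀ k l → 2 ℕ.^ k ℕ.≤ 2 ℕ.^ l → k ℕ.≤ l
^-cancelʳ-≤ k l le = ℕ.≮⇒≥ λ l<k → ℕ.<⇒≱ (ℕ.^-monoʳ-< 2 (s≤s (s≤s z≤n)) l<k) le

binary-log : ∀ m → 1 ℕ.≤ m → ∃[ k ] 2 ℕ.^ k ℕ.≤ m × m ℕ.< 2 ℕ.^ suc k
binary-log (suc zero) _ = 0 , ℕ.≤-refl , ℕ.≤-refl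
binary-log (suc (suc m)) _ with binary-log (suc m) (s≤s z≤n)
... | k , lower , upper with ℕ.m≤n⇒m<n∨m≡n upper
...   | inj₁ lt = k , ℕ.m≤n⇒m≤1+n lower , lt
...   | inj₂ eq = suc k , ℕ.≤-reflexive (≡.sym eq) ,
          subst (ℕ._< 2 ℕ.^ suc (suc k)) (≡.sym eq) (ℕ.^-monoʳ-< 2 (s≤s (s≤s z≤n)) (ℕ.n<1+n (suc k)))

nat : ℕ → ℚᵘ
nat m = + m ℚ./ 1

nat-* : ∀ l m → nat l ℚ.* nat m ≃ nat (l ℕ.* m)
nat-* l m = *≡* (≡.cong (ℤ._* + 1) (≡.sym (ℤ.pos-* l m)))

nat-≤⁻ : ∀ {l m} → nat l ℚ.≤ nat m → l ℕ.≤ m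
nat-≤⁻ {l} {m} (*≤* le) = ℤ.drop‿+≤+ (subst₂ ℤ._≤_ (ℤ.*-identityʳ (+ l)) (ℤ.*-identityʳ (+ m)) le)

nat-≤⁺ : ∀ {l m} → l ℕ.≤ m → nat l ℚ.≤ nat m
nat-≤⁺ {l} {m} le = *≤* (subst₂ ℤ._≤_ (≡.sym (ℤ.*-identityʳ (+ l))) (≡.sym (ℤ.*-identityʳ (+ m))) (ℤ.+≤+ le))

nat-<⁺ : ∀ {l m} → l ℕ.< m → nat l ℚ.< nat m
nat-<⁺ {l} {m} lt = *<* (subst₂ ℤ._<_ (≡.sym (ℤ.*-identityʳ (+ l))) (≡.sym (ℤ.*-identityʳ (+ m))) (ℤ.+<+ lt))

nat-^ : ∀ m k → nat m ^ k ≃ nat (m ℕ.^ k)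
nat-^ m zero    = ℚ.≃-refl
nat-^ m (suc k) = ℚ.≃-trans (ℚ.*-congˡ {nat m} (nat-^ m k)) (nat-* m (m ℕ.^ k))

^-nonNeg : ∀ p .{{_ : NonNegative p}} k → NonNegative (p ^ k)
^-nonNeg p zero    = _
^-nonNeg p (suc k) = ℚ.nonNeg*nonNeg⇒nonNeg p (p ^ k) {{^-nonNeg p k}}

^-mono-≤ : ∀ {p q} .{{_ : NonNegative p}} k → p ℚ.≤ q → p ^ k ℚ.≤ q ^ k
^-mono-≤ zero    p≤q = ℚ.≤-refl
^-mono-≤ {p} {{p≥0}} (suc k) p≤q = ℚ.*-mono-≤-nonNeg {{p≥0}} {{^-nonNeg p k}} p≤q (^-mono-≤ k p≤q)

power-bound : ∀ {m x} d k → nat m ℚ.≤ x → x ^ d ℚ.≤ nat 2 ^ k → m ℕ.^ d ℕ.≤ 2 ℕ.^ k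
power-bound {m} {x} d k m≤x x^d≤ = nat-≤⁻ (begin
  nat (m ℕ.^ d)   ≃⟨ nat-^ m d ⟨
  nat m ^ d       ≤⟨ ^-mono-≤ {nat m} {x} d m≤x ⟩
  x ^ d           ≤⟨ x^d≤ ⟩
  nat 2 ^ k       ≃⟨ nat-^ 2 k ⟩
  nat (2 ℕ.^ k)   ∎)
  where open ℚ.≤-Reasoning

3/2 : ℚᵘ
3/2 = + 3 ℚ./ 2

-- Multiplying by `2^d` clears the denominators, so that log (3/2) can be estimated through log 3.
power-bound-3/2 : ∀ {x} d k → 3/2 ℚ.≤ x → x ^ d ℚ.≤ nat 2 ^ k → 3 ℕ.^ d ℕ.≤ 2 ℕ.^ (k ℕ.+ d)
power-bound-3/2 {x} d k 3/2≤x x^d≤ = nat-≤⁻ (begin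
  nat (3 ℕ.^ d)             ≃⟨ nat-^ 3 d ⟨
  nat 3 ^ d                 ≃⟨ ^-congˡ d {nat 3} {3/2 ℚ.* nat 2} (*≡* ≡.refl) ⟩
  (3/2 ℚ.* nat 2) ^ d       ≃⟨ ^-distrib-* 3/2 (nat 2) d ⟩
  3/2 ^ d ℚ.* nat 2 ^ d
    ≤⟨ ℚ.*-monoˡ-≤-nonNeg (nat 2 ^ d) {{^-nonNeg (nat 2) d}} (ℚ.≤-trans (^-mono-≤ {3/2} d 3/2≤x) x^d≤) ⟩
  nat 2 ^ k ℚ.* nat 2 ^ d   ≃⟨ ^-homo-* (nat 2) k d ⟨
  nat 2 ^ (k ℕ.+ d)         ≃⟨ nat-^ 2 (k ℕ.+ d) ⟩
  nat (2 ℕ.^ (k ℕ.+ d))     ∎)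
  where open ℚ.≤-Reasoning

-- From 2³ ≤ 3².
3^-bound : ∀ d k → 3 ℕ.^ d ℕ.≤ 2 ℕ.^ k → d ℕ.* 3 ℕ.≤ k ℕ.* 2
3^-bound d k le = ^-cancelʳ-≤ (d ℕ.* 3) (k ℕ.* 2) (begin
  2 ℕ.^ (d ℕ.* 3)     ≡⟨ ≡.cong (2 ℕ.^_) (ℕ.*-comm d 3) ⟩
  2 ℕ.^ (3 ℕ.* d)     ≡⟨ ℕ.^-*-assoc 2 3 d ⟨
  8 ℕ.^ d             ≤⟨ ℕ.^-monoˡ-≤ d (ℕ.n≤1+n 8) ⟩
  9 ℕ.^ d
    ≡⟨ ≡.trans (ℕ.^-*-assoc 3 2 d) (≡.trans (≡.cong (3 ℕ.^_) (ℕ.*-comm 2 d)) (≡.sym (ℕ.^-*-assoc 3 d 2))) ⟩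
  (3 ℕ.^ d) ℕ.^ 2     ≤⟨ ℕ.^-monoˡ-≤ 2 le ⟩
  (2 ℕ.^ k) ℕ.^ 2     ≡⟨ ℕ.^-*-assoc 2 k 2 ⟩
  2 ℕ.^ (k ℕ.* 2)     ∎)
  where open ℕ.≤-Reasoning


3/2≤log : ∀ {n y} → 3 ℕ.≤ n → log₂ (fromℕ n) y → 3/2 ℚ.≤ y
3/2≤log {n} {mkℚᵘ (+ k) d-1} 3≤n (_ , z , n<z , z^d≤) = *≤* (subst₂ ℤ._≤_ (ℤ.pos-* 3 (suc d-1)) (ℤ.pos-* k 2)
  (ℤ.+≤+ (subst (ℕ._≤ k ℕ.* 2) (ℕ.*-comm (suc d-1) 3)
    (3^-bound (suc d-1) k (power-bound (suc d-1) k (ℚ.≤-trans (nat-≤⁺ 3≤n) (ℚ.<⇒≤ n<z)) z^d≤)))))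
3/2≤log {n} {mkℚᵘ -[1+ _ ] _} _ (*<* () , _)

-- log n ≥ 3/2, and log (3/2) = log 3 - 1 ≥ 1/2; both come from `3^-bound`.
1/2≤loglog : ∀ {n ρ} → 3 ℕ.≤ n → log₂ (log₂ (fromℕ n)) ρ → + 1 ℚ./ 2 ℚ.≤ ρ
1/2≤loglog {n} {mkℚᵘ (+ k) d-1} 3≤n (_ , y , log<y , y^d≤) = *≤* (subst₂ ℤ._≤_ (ℤ.pos-* 1 d) (ℤ.pos-* k 2)
  (ℤ.+≤+ (ℕ.+-cancelʳ-≤ (2 ℕ.* d) _ _ (begin
    1 ℕ.* d ℕ.+ 2 ℕ.* d      ≡⟨ eq₁ d ⟩
    d ℕ.* 3                  ≤⟨ 3^-bound d (k ℕ.+ d) (power-bound-3/2 d k (3/2≤log 3≤n log<y) y^d≤) ⟩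
    (k ℕ.+ d) ℕ.* 2          ≡⟨ eq₂ k d ⟩
    k ℕ.* 2 ℕ.+ 2 ℕ.* d      ∎))))
  where
  d = suc d-1
  open ℕ.≤-Reasoning
  eq₁ : ∀ d → 1 ℕ.* d ℕ.+ 2 ℕ.* d ≡ d ℕ.* 3
  eq₁ = solve-∀
  eq₂ : ∀ k d → (k ℕ.+ d) ℕ.* 2 ≡ k ℕ.* 2 ℕ.+ 2 ℕ.* d
  eq₂ = solve-∀
1/2≤loglog {n} {mkℚᵘ -[1+ _ ] _} _ (*<* () , _)

exponent≤log : ∀ {m} j {σ} → 2 ℕ.^ j ℕ.≤ m → log₂ (fromℕ m) σ → nat j ℚ.≤ σ
exponent≤log {m} j {mkℚᵘ (+ k) d-1} 2^j≤m (_ , w , m<w , w^d≤) = *≤* (subst₂ ℤ._≤_ (ℤ.pos-* j (suc d-1)) (ℤ.pos-* k 1)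
  (ℤ.+≤+ (subst (j ℕ.* suc d-1 ℕ.≤_) (≡.sym (ℕ.*-identityʳ k)) (^-cancelʳ-≤ (j ℕ.* suc d-1) k (begin
    2 ℕ.^ (j ℕ.* suc d-1)    ≡⟨ ℕ.^-*-assoc 2 j (suc d-1) ⟨
    (2 ℕ.^ j) ℕ.^ suc d-1    ≤⟨ ℕ.^-monoˡ-≤ (suc d-1) 2^j≤m ⟩
    m ℕ.^ suc d-1            ≤⟨ power-bound (suc d-1) k (ℚ.<⇒≤ m<w) w^d≤ ⟩
    2 ℕ.^ k                  ∎)))))
  where open ℕ.≤-Reasoning
exponent≤log {m} j {mkℚᵘ -[1+ _ ] _} _ (*<* () , _)

log≤exponent : ∀ {m k} → m ℕ.< 2 ℕ.^ suc k → log₂ (fromℕ m) (nat (suc k))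
log≤exponent {m} {k} m<2^k = *<* (ℤ.+<+ (s≤s z≤n)) , nat 2 ^ suc k ,
  ℚ.<-≤-trans (nat-<⁺ m<2^k) (ℚ.≤-reflexive (ℚ.≃-sym (nat-^ 2 (suc k)))) ,
  ℚ.≤-reflexive (ℚ.*-identityʳ (nat 2 ^ suc k))

-- Taking logarithms of the second bound gives 2s ≥ n (N - 4 - j); the first one
-- absorbs the negative terms.
combine-bounds : ∀ n Δ s N j → 3 ℕ.≤ n → 2 ℕ.^ N ℕ.≤ n → Δ ℕ.< 2 ℕ.^ suc j →
  n ℕ.≤ 2 ℕ.* s → ℕ.pred n ℕ.^ n ℕ.≤ 2 ℕ.^ s ℕ.* (2 ℕ.^ s ℕ.* (4 ℕ.* Δ) ℕ.^ n) →
  suc n ℕ.* suc N ℕ.≤ 24 ℕ.* (s ℕ.* (1 ℕ.+ j ℕ.* 2))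
combine-bounds n@(suc n-1) Δ s N j 3≤n 2^N≤n Δ<2^j n≤2s bezout = begin
  suc n ℕ.* suc N                            ≤⟨ ℕ.*-monoˡ-≤ (suc N) (ℕ.+-monoˡ-≤ n (ℕ.≤-trans (s≤s z≤n) 3≤n)) ⟩
  (n ℕ.+ n) ℕ.* suc N                        ≡⟨ eq₁ n N ⟩
  2 ℕ.* (N ℕ.* n ℕ.+ n)                      ≤⟨ ℕ.*-monoʳ-≤ 2 (ℕ.+-monoˡ-≤ n Nn≤) ⟩
  2 ℕ.* (2 ℕ.* s ℕ.+ (j ℕ.+ 4) ℕ.* n ℕ.+ n)  ≡⟨ eq₂ s j n ⟩
  2 ℕ.* (2 ℕ.* s ℕ.+ (j ℕ.+ 5) ℕ.* n)        ≤⟨ ℕ.*-monoʳ-≤ 2 (ℕ.+-monoʳ-≤ (2 ℕ.* s) (ℕ.*-monoʳ-≤ (j ℕ.+ 5) n≤2s)) ⟩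
  -- The left side is 24 s + 4 s j. The padding completes it to 24 s + 48 s j, a multiple of 1 + 2j,
  -- which is twice the estimate 1/2 + j of log log n + log Δ.
  2 ℕ.* (2 ℕ.* s ℕ.+ (j ℕ.+ 5) ℕ.* (2 ℕ.* s)) ≤⟨ ℕ.m≤m+n _ (44 ℕ.* (s ℕ.* j)) ⟩
  2 ℕ.* (2 ℕ.* s ℕ.+ (j ℕ.+ 5) ℕ.* (2 ℕ.* s)) ℕ.+ 44 ℕ.* (s ℕ.* j) ≡⟨ eq₃ s j ⟩
  24 ℕ.* (s ℕ.* (1 ℕ.+ j ℕ.* 2))             ∎
  where
  open ℕ.≤-Reasoning
  eq₁ : ∀ n N → (n ℕ.+ n) ℕ.* suc N ≡ 2 ℕ.* (N ℕ.* n ℕ.+ n)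
  eq₁ = solve-∀
  eq₂ : ∀ s j n → 2 ℕ.* (2 ℕ.* s ℕ.+ (j ℕ.+ 4) ℕ.* n ℕ.+ n) ≡ 2 ℕ.* (2 ℕ.* s ℕ.+ (j ℕ.+ 5) ℕ.* n)
  eq₂ = solve-∀
  eq₃ : ∀ s j → 2 ℕ.* (2 ℕ.* s ℕ.+ (j ℕ.+ 5) ℕ.* (2 ℕ.* s)) ℕ.+ 44 ℕ.* (s ℕ.* j) ≡ 24 ℕ.* (s ℕ.* (1 ℕ.+ j ℕ.* 2))
  eq₃ = solve-∀
  eq₄ : ∀ s j n → n ℕ.+ (s ℕ.+ (s ℕ.+ (j ℕ.+ 3) ℕ.* n)) ≡ 2 ℕ.* s ℕ.+ (j ℕ.+ 4) ℕ.* n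
  eq₄ = solve-∀

  -- Replacing n - 1 by n / 2 costs a factor 2 in each of `n` factors, which turns `j + 3` into
  -- `j + 4`.
  n≤2pred : n ℕ.≤ 2 ℕ.* n-1
  n≤2pred = ℕ.≤-trans (ℕ.+-monoˡ-≤ _ (ℕ.≤-trans (s≤s z≤n) (ℕ.≤-pred 3≤n)))
    (ℕ.≤-reflexive (≡.cong (n-1 ℕ.+_) (≡.sym (ℕ.+-identityʳ n-1))))

  4Δ≤ : 4 ℕ.* Δ ℕ.≤ 2 ℕ.^ (j ℕ.+ 3)
  4Δ≤ = begin
    4 ℕ.* Δ                  ≤⟨ ℕ.*-monoʳ-≤ 4 (ℕ.<⇒≤ Δ<2^j) ⟩
    2 ℕ.^ 2 ℕ.* 2 ℕ.^ suc j  ≡⟨ ℕ.^-distribˡ-+-* 2 2 (suc j) ⟨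
    2 ℕ.^ (3 ℕ.+ j)          ≡⟨ ≡.cong (2 ℕ.^_) (ℕ.+-comm 3 j) ⟩
    2 ℕ.^ (j ℕ.+ 3)          ∎

  Nn≤ : N ℕ.* n ℕ.≤ 2 ℕ.* s ℕ.+ (j ℕ.+ 4) ℕ.* n
  Nn≤ = ^-cancelʳ-≤ (N ℕ.* n) (2 ℕ.* s ℕ.+ (j ℕ.+ 4) ℕ.* n) (begin
    2 ℕ.^ (N ℕ.* n)                                            ≡⟨ ℕ.^-*-assoc 2 N n ⟨
    (2 ℕ.^ N) ℕ.^ n                                            ≤⟨ ℕ.^-monoˡ-≤ n (ℕ.≤-trans 2^N≤n n≤2pred) ⟩
    (2 ℕ.* n-1) ℕ.^ n                                          ≡⟨ ^-distribʳ-* 2 n-1 n ⟩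
    2 ℕ.^ n ℕ.* n-1 ℕ.^ n                                      ≤⟨ ℕ.*-monoʳ-≤ (2 ℕ.^ n) bezout ⟩
    2 ℕ.^ n ℕ.* (2 ℕ.^ s ℕ.* (2 ℕ.^ s ℕ.* (4 ℕ.* Δ) ℕ.^ n))
      ≤⟨ ℕ.*-monoʳ-≤ (2 ℕ.^ n) (ℕ.*-monoʳ-≤ (2 ℕ.^ s) (ℕ.*-monoʳ-≤ (2 ℕ.^ s) (ℕ.^-monoˡ-≤ n 4Δ≤))) ⟩
    2 ℕ.^ n ℕ.* (2 ℕ.^ s ℕ.* (2 ℕ.^ s ℕ.* (2 ℕ.^ (j ℕ.+ 3)) ℕ.^ n))
      ≡⟨ ≡.cong (λ x → 2 ℕ.^ n ℕ.* (2 ℕ.^ s ℕ.* (2 ℕ.^ s ℕ.* x))) (ℕ.^-*-assoc 2 (j ℕ.+ 3) n) ⟩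
    2 ℕ.^ n ℕ.* (2 ℕ.^ s ℕ.* (2 ℕ.^ s ℕ.* 2 ℕ.^ ((j ℕ.+ 3) ℕ.* n)))  ≡⟨ collect ⟨
    2 ℕ.^ (n ℕ.+ (s ℕ.+ (s ℕ.+ (j ℕ.+ 3) ℕ.* n)))              ≡⟨ ≡.cong (2 ℕ.^_) (eq₄ s j n) ⟩
    2 ℕ.^ (2 ℕ.* s ℕ.+ (j ℕ.+ 4) ℕ.* n)                        ∎)
    where
    e = (j ℕ.+ 3) ℕ.* n
    collect : 2 ℕ.^ (n ℕ.+ (s ℕ.+ (s ℕ.+ e))) ≡ 2 ℕ.^ n ℕ.* (2 ℕ.^ s ℕ.* (2 ℕ.^ s ℕ.* 2 ℕ.^ e))
    collect = ≡.trans (ℕ.^-distribˡ-+-* 2 n (s ℕ.+ (s ℕ.+ e))) (≡.cong (2 ℕ.^ n ℕ.*_)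
      (≡.trans (ℕ.^-distribˡ-+-* 2 s (s ℕ.+ e)) (≡.cong (2 ℕ.^ s ℕ.*_) (ℕ.^-distribˡ-+-* 2 s e))))

cut-inequality : ∀ n Δ s → 3 ℕ.≤ n → 1 ℕ.≤ Δ →
  n ℕ.≤ 2 ℕ.* s → ℕ.pred n ℕ.^ n ℕ.≤ 2 ℕ.^ s ℕ.* (2 ℕ.^ s ℕ.* (4 ℕ.* Δ) ℕ.^ n) →
  fromℚ (+ 1 ℚ./ 96) *ᵣ (fromℕ n *ᵣ log₂ (fromℕ n)) ≤ᵣ fromℕ s *ᵣ (log₂ (log₂ (fromℕ n)) +ᵣ log₂ (fromℕ Δ))
cut-inequality n Δ s 3≤n 1≤Δ n≤2s bezout q (r , t , s<r , (ρ , σ , loglog<ρ , log<σ , ρ+σ≤t) , rt≤q)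
  with binary-log n (ℕ.≤-trans (s≤s z≤n) 3≤n) | binary-log Δ 1≤Δ
... | N , 2^N≤n , n<2^N | j , 2^j≤Δ , Δ<2^j =
  -- The cuts are open, so every witness lies strictly above its number: 1/48 above 1/96, `suc n`
  -- above `n`, and `suc N` above log n.
  + 1 ℚ./ 48 , nat (suc n) ℚ.* nat (suc N) , *<* (ℤ.+<+ (ℕ.m≤m+n 49 47)) ,
  (nat (suc n) , nat (suc N) , nat-<⁺ (ℕ.n<1+n n) , log≤exponent n<2^N , ℚ.≤-refl) ,
  (begin
    + 1 ℚ./ 48 ℚ.* (nat (suc n) ℚ.* nat (suc N))    ≤⟨ integral ⟩
    nat s ℚ.* (+ 1 ℚ./ 2 ℚ.+ nat j)                 ≤⟨ ℚ.*-mono-≤-nonNeg {nat s} {r} {+ 1 ℚ./ 2 ℚ.+ nat j} {t} {{_}} {{ℚ.nonNeg+nonNeg⇒nonNeg (+ 1 ℚ./ 2) (nat j)}} (ℚ.<⇒≤ s<r)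
                                                         (ℚ.≤-trans (ℚ.+-mono-≤ (1/2≤loglog 3≤n loglog<ρ) (exponent≤log j 2^j≤Δ log<σ)) ρ+σ≤t) ⟩
    r ℚ.* t                                         ≤⟨ rt≤q ⟩
    q                                               ∎)
  where
  open ℚ.≤-Reasoning
  integral : + 1 ℚ./ 48 ℚ.* (nat (suc n) ℚ.* nat (suc N)) ℚ.≤ nat s ℚ.* (+ 1 ℚ./ 2 ℚ.+ nat j)
  integral = *≤* (subst₂ ℤ._≤_ left right (ℤ.+≤+ (ℕ.*-monoˡ-≤ 2 (combine-bounds n Δ s N j 3≤n 2^N≤n Δ<2^j n≤2s bezout))))
    where
    left : + (suc n ℕ.* suc N ℕ.* 2) ≡ (+ 1 ℤ.* (+ suc n ℤ.* + suc N)) ℤ.* + 2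
    left = ≡.trans (ℤ.pos-* (suc n ℕ.* suc N) 2) (≡.cong (ℤ._* + 2) (≡.trans (ℤ.pos-* (suc n) (suc N)) (≡.sym (ℤ.*-identityˡ _))))
    right : + (24 ℕ.* (s ℕ.* (1 ℕ.+ j ℕ.* 2)) ℕ.* 2) ≡ (+ s ℤ.* (+ 1 ℤ.* + 1 ℤ.+ + j ℤ.* + 2)) ℤ.* + 48
    right = ≡.trans (≡.cong +_ (eq (s ℕ.* (1 ℕ.+ j ℕ.* 2)))) (≡.trans (ℤ.pos-* (s ℕ.* (1 ℕ.+ j ℕ.* 2)) 48)
      (≡.cong (ℤ._* + 48) (≡.trans (ℤ.pos-* s (1 ℕ.+ j ℕ.* 2)) (≡.cong (+ s ℤ.*_) (≡.cong (λ x → + 1 ℤ.+ x) (ℤ.pos-* j 2))))))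
      where
      eq : ∀ x → 24 ℕ.* x ℕ.* 2 ≡ x ℕ.* 48
      eq = solve-∀

theorem1p3 : ∀ {a ℓ₁ ℓ₂} →
    ∃[ c ] Positive c ×
    ((F : HeytingField a ℓ₁ ℓ₂) → let open OverField F in
    ∀ (p n Δ : ℕ) → HasCharacteristic p → ¬ (p ∣ n) →
    3 ≤ n → 1 ≤ Δ → Δ < n →
    (A : ABP n) → LabelDegrees≤ Δ A → Computes A (powerSum n n) →
    fromℚ c *ᵣ (fromℕ n *ᵣ log₂ (fromℕ n))
    ≤ᵣ fromℕ (size A) *ᵣ (log₂ (log₂ (fromℕ n)) +ᵣ log₂ (fromℕ Δ)))
theorem1p3 = + 1 ℚ./ 96 , _ , λ F p n Δ hasChar p∤n 3≤n 1≤Δ Δ<n A labels computes →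
  let open HeytingField F
      s = OverField.size A
      -- The characteristic only shows that n · 1 is not zero, and tightness makes this a doubly
      -- negated apartness. That suffices, as both bounds are decidable.
      ¬¬n#0 = λ ¬n#0 → p∤n (Equivalence.to (hasChar n) (proj₁ (tight _ 0#) ¬n#0))
  in cut-inequality n Δ s 3≤n 1≤Δ
      (decidable-stable (n ℕ.≤? 2 ℕ.* s) λ ¬n≤2s → ¬¬n#0 λ n#0 →
        ¬n≤2s (Krull.n≤2s F n Δ A labels computes n#0 1≤Δ Δ<n))
      (decidable-stable (ℕ.pred n ℕ.^ n ℕ.≤? 2 ℕ.^ s ℕ.* (2 ℕ.^ s ℕ.* (4 ℕ.* Δ) ℕ.^ n)) λ ¬bezout → ¬¬n#0 λ n#0 →
        ¬bezout (PowerSumPrograms.bezout F n Δ A labels computes n#0 1≤Δ))
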